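{- Let $r,m\geqslant 1$ be integers. Define the formal power series $$\ell_{m}(x) = \sum_{d \geqslant 0} W_m(dm)\,\lambda(m,dm)\,x^d,\qquad h_m(x) = \sum_{d \geqslant 0} W_m(dm)\,x^d .$$ Let $f_{r,m}(x)\in\mathbb{Z}[[x]]$ satisfy the functional equation $$f_{r,m}(x) = x\,\bigl(\ell_m(f_{r,m}(x))\bigr)^r .$$ Then the generating function $$F_{(r,m)}(x) = \sum_{n \geqslant 0} FC_{n}^{(r,m)}\,x^{n+1}$$ of the Hypergraph Fuss-Catalan numbers satisfies $$F_{(r,m)}(x) = x\, h_{m}\bigl(f_{r,m}(FC_{1}^{(r,m)}\,x)\bigr).$$
   Context: **Coefficients.** For $m\mid k$, $W_m(k)=\dfrac{k!}{(m!)^{k/m}(k/m)!}$ is the number of ways to partition a set of cardinality $k$ into subsets of cardinality $m$. Also $\lambda(r,g)=\binom{r-1+g}{r-1}$ is the dimension of the space of homogeneous polynomials of degree $g$ in $r$ variables. **Hypertrees.** An $(r+1)$-uniform hypertree with $n$ hyperedges is a connected hypergraph with $rn+1$ vertices and $n$ hyperedges, each hyperedge being a set of exactly $r+1$ vertices (for $n=0$: a single vertex and no hyperedges). Let $\mathcal{H}_n^{(r+1)}$ be the set of isomorphism classes (unlabeled, unrooted) of $(r+1)$-uniform hypertrees with $n$ hyperedges. For $T\in\mathcal{H}_n^{(r+1)}$, $\Gamma(T)$ is the automorphism group of $T$ (permutations of the vertices that map hyperedges to hyperedges). The associated bipartite graph $\tilde T$ has one black vertex for each vertex of $T$ and one white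 vertex for each hyperedge of $T$, a black vertex being adjacent to a white vertex exactly when the corresponding vertex belongs to the corresponding hyperedge; $\tilde T$ is a tree. **Walks.** For a black vertex $v$ of $\tilde T$, let $a_T^{(r,m)}(v)$ be the number of walks on $\tilde T$ that (1) begin and end at $v$; (2) use every edge of $\tilde T$ exactly $2m$ times, $m$ times going away from $v$ and $m$ times coming back towards $v$ (with $\tilde T$ regarded as rooted at $v$); (3) contain no consecutive subsequence of the form $v_1v_2v_1$ with $v_1$ black and $v_2$ white. **Hypergraph Fuss-Catalan numbers.** $$FC_n^{(r,m)} = \sum_{T\in\mathcal{H}_n^{(r+1)}}\ \sum_{v} \frac{a_T^{(r,m)}(v)}{|\Gamma(T)|},$$ the inner sum being over the black vertices $v$ of $\tilde T$. -}

module Defs where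

open import Algebra.Bundles using (CommutativeRing)
import Data.Bool.Properties as Bool
open import Data.Empty using (⊥)
open import Data.Fin.Base using (Fin; toℕ)
open import Data.Fin.Properties as Fin using ()
open import Data.Fin.Subset using (Subset; inside; outside; ∣_∣) renaming (_∈_ to _∈ˢ_)
open import Data.Fin.Subset.Properties using (⊆-antisym) renaming (_∈?_ to _∈ˢ?_)
open import Data.Integer.Base as ℤ using (ℤ)
open import Data.List.Base as List using (List; []; _∷_)
open import Data.List.Membership.Propositional using (lose) renaming (_∈_ to _∈ˡ_)
open import Data.List.Membership.Propositional.Properties using (∈-cartesianProductWith⁺; ∈-allFin; ∈-filter⁺; ∈-length)
open import Data.List.Relation.Binary.Infix.Heterogeneous using (Infix)
open import Data.List.Relation.Binary.Infix.Heterogeneous.Properties using (infix?)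
open import Data.List.Relation.Unary.Any as ListAny using (here; there)
open import Data.List.Relation.Unary.Linked using (Linked; linked?)
import Data.Maybe.Properties as Maybe
open import Data.Maybe.Base using (just)
open import Data.Nat.Base as ℕ using (ℕ; zero; suc; NonZero; _!; _/_; _∸_)
open import Data.Nat.Combinatorics using (_C_)
open import Data.Nat.Properties as ℕ using (_!≢0; m^n≢0; m*n≢0)
open import Data.Product.Base using (∃; _×_; _,_)
import Data.Product.Properties as Product
open import Data.Rational.Base as ℚ using (ℚ; 0ℚ; 1ℚ; _+_; _*_)
open import Data.Rational.Properties using (+-*-commutativeRing)
open import Data.Sum.Base using (_⊎_; inj₁; inj₂)
import Data.Sum.Properties as Sum
open import Data.Vec.Base as Vec using (Vec; []; _∷_; lookup; tabulate)
open import Data.Vec.Properties using (≡-dec; lookup-allFin; lookup∘tabulate; []=⇒lookup; lookup⇒[]=; map-id; map-cong)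
open import Data.Vec.Membership.Propositional using (_∈_)
open import Data.Vec.Relation.Unary.All as All using (All)
open import Data.Vec.Relation.Unary.AllPairs using (allPairs?)
open import Data.Vec.Relation.Unary.Any as Any using (Any)
open import Data.Vec.Relation.Unary.Unique.Propositional using (Unique)
open import Data.Vec.Relation.Unary.Unique.Propositional.Properties using (tabulate⁺)
open import Function.Base using (id; _∘_)
open import Level using (Level)
open import Relation.Binary.Construct.Closure.ReflexiveTransitive using (Star; ε; _◅_; _◅◅_)
open import Relation.Binary.Core using (Rel)
open import Relation.Binary.Definitions using (Decidable; DecidableEquality)
open import Relation.Binary.PropositionalEquality
  using (_≡_; refl; sym; trans; subst)
open import Relation.Nullary using (Dec; yes; no; does; ¬_)
open import Relation.Nullary.Decidable using (map′; _×-dec_; _⊎-dec_; _→-dec_; ¬?; dec-true)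
import Relation.Unary as Unary

open import Algebra.Properties.Semiring.Sum
  (CommutativeRing.semiring +-*-commutativeRing) using (sum)
open import Algebra.Properties.Semiring.Exp
  (CommutativeRing.semiring +-*-commutativeRing) using () renaming (_^_ to _^ℚ_)

private
  variable
    a ℓ : Level
    A : Set a
    N n : ℕ

Series : Set
Series = ℕ → ℚ

infix 4 _≈_
_≈_ : Series → Series → Set
f ≈ g = ∀ k → f k ≡ g k

1ˢ : Series
1ˢ zero    = 1ℚ
1ˢ (suc _) = 0ℚ

x·_ : Series → Series
(x· f) zero    = 0ℚ
(x· f) (suc k) = f k

infixl 7 _*ˢ_
_*ˢ_ : Series → Series → Series
(f *ˢ g) k = sum {suc k} λ i → f (toℕ i) * g (k ∸ toℕ i)

infixr 8 _^ˢ_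
_^ˢ_ : Series → ℕ → Series
f ^ˢ zero  = 1ˢ
f ^ˢ suc k = f *ˢ (f ^ˢ k)

-- Substitution g(f(x)) = Σ_d g_d f(x)^d.  It is meaningful only when f has
-- zero constant term; then f^d starts in degree d, so that the
-- coefficient of x^k receives contributions from d ≤ k only.  In a solution of
-- f = x·(g(f))^r the constant term is zero because of the leading factor x.
_⟨_⟩ : Series → Series → Series
(g ⟨ f ⟩) k = sum {suc k} λ d → g (toℕ d) * (f ^ˢ toℕ d) k

-- f(c x)
_[_·x] : Series → ℚ → Series
(f [ c ·x]) k = f k * (c ^ℚ k)

fromℤ : (ℕ → ℤ) → Series
fromℤ f k = f k ℚ./ 1

W : (m k : ℕ) .{{_ : NonZero m}} → ℚ
W m k = (ℤ.+ (k !)) ℚ./ ((m !) ℕ.^ (k / m) ℕ.* (k / m) !)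
  where instance
    _ = m !≢0
    _ = (k / m) !≢0
    _ = m^n≢0 (m !) (k / m)
    _ = m*n≢0 ((m !) ℕ.^ (k / m)) ((k / m) !)

-- Binomial (r - 1 + g choose r - 1); only used for r ≥ 1.
λ-dim : (r g : ℕ) → ℕ
λ-dim r g = (r ∸ 1 ℕ.+ g) C (r ∸ 1)

ℓ-series : (m : ℕ) .{{_ : NonZero m}} → Series
ℓ-series m d = W m (d ℕ.* m) * ((ℤ.+ λ-dim m (d ℕ.* m)) ℚ./ 1)

h-series : (m : ℕ) .{{_ : NonZero m}} → Series
h-series m d = W m (d ℕ.* m)

vectors : List A → (k : ℕ) → List (Vec A k)
vectors xs zero    = [] ∷ []
vectors xs (suc k) = List.cartesianProductWith _∷_ xs (vectors xs k)

∈-vectors : {xs : List A} → (∀ x → x ∈ˡ xs) → ∀ {k} (v : Vec A k) → v ∈ˡ vectors xs k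
∈-vectors all∈ []      = here refl
∈-vectors all∈ (x ∷ v) = ∈-cartesianProductWith⁺ _∷_ (all∈ x) (∈-vectors all∈ v)

-- Warshall's algorithm: Via ws u v holds when v can be reached from u with all
-- intermediate vertices in ws.
module _ {R : Rel (Fin N) ℓ} (R? : Decidable R) where

  private
    Via : List (Fin N) → Rel (Fin N) _
    Via []       u v = u ≡ v ⊎ R u v
    Via (w ∷ ws) u v = Via ws u v ⊎ (Via ws u w × Via ws w v)

    via? : ∀ ws → Decidable (Via ws)
    via? []       u v = (u Fin.≟ v) ⊎-dec R? u v
    via? (w ∷ ws) u v = via? ws u v ⊎-dec (via? ws u w ×-dec via? ws w v)

    via-base : ∀ ws {u v} → u ≡ v ⊎ R u v → Via ws u v
    via-base []       p = p
    via-base (w ∷ ws) p = inj₁ (via-base ws p)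

    via-trans : ∀ {w} ws → w ∈ˡ ws → ∀ {u v} → Via ws u w → Via ws w v → Via ws u v
    via-trans (w ∷ ws) (here refl) p q = inj₂ (to p , from q)
      where
      to : ∀ {u} → Via (w ∷ ws) u w → Via ws u w
      to (inj₁ p)       = p
      to (inj₂ (p , _)) = p
      from : ∀ {v} → Via (w ∷ ws) w v → Via ws w v
      from (inj₁ q)       = q
      from (inj₂ (_ , q)) = q
    via-trans (_ ∷ ws) (there w∈) (inj₁ p) (inj₁ q) = inj₁ (via-trans ws w∈ p q)
    via-trans (_ ∷ ws) (there w∈) (inj₁ p) (inj₂ (q , q′)) = inj₂ (via-trans ws w∈ p q , q′)
    via-trans (_ ∷ ws) (there w∈) (inj₂ (p , p′)) (inj₁ q) = inj₂ (p , via-trans ws w∈ p′ q)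
    via-trans (_ ∷ ws) (there w∈) (inj₂ (p , _)) (inj₂ (_ , q′)) = inj₂ (p , q′)

    via⇒star : ∀ ws {u v} → Via ws u v → Star R u v
    via⇒star []       (inj₁ refl)    = ε
    via⇒star []       (inj₂ r)       = r ◅ ε
    via⇒star (w ∷ ws) (inj₁ p)       = via⇒star ws p
    via⇒star (w ∷ ws) (inj₂ (p , q)) = via⇒star ws p ◅◅ via⇒star ws q

    star⇒via : ∀ {u v} → Star R u v → Via (List.allFin N) u v
    star⇒via ε       = via-base (List.allFin N) (inj₁ refl)
    star⇒via (r ◅ s) = via-trans (List.allFin N) (∈-allFin _)
                         (via-base (List.allFin N) (inj₂ r)) (star⇒via s)

  star? : Decidable (Star R)
  star? u v = map′ (via⇒star _) star⇒via (via? (List.allFin N) u v)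

-- A hypergraph with vertex set Fin N and n hyperedges.  The hyperedges are
-- listed in some order, but isomorphism compares only the sets of hyperedges.
Hypergraph : (N n : ℕ) → Set
Hypergraph N n = Vec (Subset N) n

_≟ˢ_ : DecidableEquality (Subset N)
_≟ˢ_ = ≡-dec Bool._≟_

Joined : Hypergraph N n → Rel (Fin N) _
Joined T u v = Any (λ e → u ∈ˢ e × v ∈ˢ e) T

Connected : Hypergraph N n → Set
Connected T = ∀ u v → Star (Joined T) u v

-- (r+1)-uniform hypertrees with n hyperedges on the vertex set Fin (rn+1).
IsHypertree : (r n : ℕ) → Hypergraph (suc (r ℕ.* n)) n → Set
IsHypertree r n T = Unique T × All (λ e → ∣ e ∣ ≡ suc r) T × Connected T

isHypertree? : ∀ r n → Unary.Decidable (IsHypertree r n)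
isHypertree? r n T =
  allPairs? (λ d e → ¬? (d ≟ˢ e)) T
  ×-dec All.all? (λ e → ∣ e ∣ ℕ.≟ suc r) T
  ×-dec Fin.all? λ u → Fin.all? λ v →
    star? (λ u v → Any.any? (λ e → (u ∈ˢ? e) ×-dec (v ∈ˢ? e)) T) u v

hypergraphs : (N n : ℕ) → List (Hypergraph N n)
hypergraphs N n = vectors (vectors (inside ∷ outside ∷ []) N) n

-- Permutations σ of Fin N are in one-line notation: the vector
-- σ(0), …, σ(N-1), with distinct entries.  The direct image of e under σ:
_⟦_⟧ : Vec (Fin N) N → Subset N → Subset N
σ ⟦ e ⟧ = tabulate λ w → does (Fin.any? λ u → (u ∈ˢ? e) ×-dec (lookup σ u Fin.≟ w))

IsIso : Hypergraph N n → Hypergraph N n → Vec (Fin N) N → Set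
IsIso S T σ = Unique σ
            × All (λ e → σ ⟦ e ⟧ ∈ T) S
            × All (λ e → e ∈ Vec.map (σ ⟦_⟧) S) T

isIso? : (S T : Hypergraph N n) → Unary.Decidable (IsIso S T)
isIso? S T σ =
  allPairs? (λ u v → ¬? (u Fin.≟ v)) σ
  ×-dec All.all? (λ e → Any.any? (σ ⟦ e ⟧ ≟ˢ_) T) S
  ×-dec All.all? (λ e → Any.any? (e ≟ˢ_) (Vec.map (σ ⟦_⟧) S)) T

_≅_ : Rel (Hypergraph N n) _
S ≅ T = ∃ (IsIso S T)

_≅?_ : Decidable (_≅_ {N} {n})
_≅?_ {N} S T = map′ ListAny.satisfied
  (λ (σ , iso) → lose (∈-vectors ∈-allFin σ) iso)
  (ListAny.any? (isIso? S T) (vectors (List.allFin N) N))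

-- One representative of each isomorphism class of hypertrees.
ℋ : (r n : ℕ) → List (Hypergraph (suc (r ℕ.* n)) n)
ℋ r n = List.deduplicate _≅?_
          (List.filter (isHypertree? r n) (hypergraphs (suc (r ℕ.* n)) n))

Γ : Hypergraph N n → List (Vec (Fin N) N)
Γ {N} T = List.filter (isIso? T T) (vectors (List.allFin N) N)

∣Γ∣ : Hypergraph N n → ℕ
∣Γ∣ T = List.length (Γ T)

private
  id-image : (e : Subset N) → Vec.allFin N ⟦ e ⟧ ≡ e
  id-image {N} e = ⊆-antisym to from
    where
    P? : ∀ w → Dec (∃ λ u → u ∈ˢ e × lookup (Vec.allFin N) u ≡ w)
    P? w = Fin.any? λ u → (u ∈ˢ? e) ×-dec (lookup (Vec.allFin N) u Fin.≟ w)
    witness : ∀ {a} {A : Set a} (A? : Dec A) → does A? ≡ inside → A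
    witness (yes p) _ = p
    to : ∀ {w} → w ∈ˢ Vec.allFin N ⟦ e ⟧ → w ∈ˢ e
    to {w} w∈ with witness (P? w)
      (trans (sym (lookup∘tabulate (does ∘ P?) w)) ([]=⇒lookup w∈))
    ... | u , u∈e , eq = subst (_∈ˢ e) (trans (sym (lookup-allFin u)) eq) u∈e
    from : ∀ {w} → w ∈ˢ e → w ∈ˢ Vec.allFin N ⟦ e ⟧
    from {w} w∈ = lookup⇒[]= w _
      (trans (lookup∘tabulate (does ∘ P?) w)
             (dec-true (P? w) (w , w∈ , lookup-allFin w)))

  all∈ : (T : Vec A n) → All (_∈ T) T
  all∈ []      = All.[]
  all∈ (x ∷ T) = Any.here refl All.∷ All.map Any.there (all∈ T)

  id-iso : (T : Hypergraph N n) → IsIso T T (Vec.allFin N)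
  id-iso T = tabulate⁺ id
           , All.map (λ {e} → subst (_∈ T) (sym (id-image e))) (all∈ T)
           , subst (λ S → All (_∈ S) T)
               (sym (trans (map-cong id-image T) (map-id T))) (all∈ T)

∣Γ∣≢0 : (T : Hypergraph N n) → NonZero (∣Γ∣ T)
∣Γ∣≢0 {N} T = ℕ.>-nonZero (∈-length
  (∈-filter⁺ (isIso? T T) (∈-vectors ∈-allFin (Vec.allFin N)) (id-iso T)))

-- Black vertices are inj₁ u, with u a vertex of the hypergraph; white vertices
-- are inj₂ i, with i the index of a hyperedge.
Vertex : (N n : ℕ) → Set
Vertex N n = Fin N ⊎ Fin n

pattern black u = inj₁ u
pattern white i = inj₂ i

_≟ᵛ_ : DecidableEquality (Vertex N n)
_≟ᵛ_ = Sum.≡-dec Fin._≟_ Fin._≟_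

Adjacent : Hypergraph N n → Rel (Vertex N n) _
Adjacent T (black u) (white i) = u ∈ˢ lookup T i
Adjacent T (white i) (black u) = u ∈ˢ lookup T i
Adjacent T (black _) (black _) = ⊥
Adjacent T (white _) (white _) = ⊥

adjacent? : (T : Hypergraph N n) → Decidable (Adjacent T)
adjacent? T (black u) (white i) = u ∈ˢ? lookup T i
adjacent? T (white i) (black u) = u ∈ˢ? lookup T i
adjacent? T (black _) (black _) = no λ ()
adjacent? T (white _) (white _) = no λ ()

-- The number of steps from x to y in a walk given as its list of vertices.
traversals : (x y : Vertex N n) → List (Vertex N n) → ℕ
traversals x y w =
  List.length (List.filter (Product.≡-dec _≟ᵛ_ _≟ᵛ_ (x , y)) (List.zip w (List.drop 1 w)))

-- For an edge of the tree rooted at v, one of its two directions leads away from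
-- v and the other one back towards v.  So the requirement of m steps away and m
-- steps back says that each direction is used exactly m times.
record IsWalk (T : Hypergraph N n) (m : ℕ) (v : Fin N) (w : List (Vertex N n)) : Set where
  constructor mkWalk
  field
    adjacent   : Linked (Adjacent T) w
    starts     : List.head w ≡ just (black v)
    ends       : List.last w ≡ just (black v)
    edges      : ∀ u i → u ∈ˢ lookup T i →
                 traversals (black u) (white i) w ≡ m × traversals (white i) (black u) w ≡ m
    no-return  : ∀ u i → ¬ Infix _≡_ (black u ∷ white i ∷ black u ∷ []) w

isWalk? : (T : Hypergraph N n) (m : ℕ) (v : Fin N) → Unary.Decidable (IsWalk T m v)
isWalk? T m v w = map′
  (λ (a , s , e , t , b) → mkWalk a s e t b)
  (λ (mkWalk a s e t b) → a , s , e , t , b)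
  (linked? (adjacent? T) w
   ×-dec Maybe.≡-dec _≟ᵛ_ (List.head w) (just (black v))
   ×-dec Maybe.≡-dec _≟ᵛ_ (List.last w) (just (black v))
   ×-dec (Fin.all? λ u → Fin.all? λ i → (u ∈ˢ? lookup T i)
            →-dec ((traversals (black u) (white i) w ℕ.≟ m)
                   ×-dec (traversals (white i) (black u) w ℕ.≟ m)))
   ×-dec (Fin.all? λ u → Fin.all? λ i →
            ¬? (infix? _≟ᵛ_ (black u ∷ white i ∷ black u ∷ []) w)))

vertices : (N n : ℕ) → List (Vertex N n)
vertices N n = List.map inj₁ (List.allFin N) List.++ List.map inj₂ (List.allFin n)

-- The number of walks for an (r+1)-uniform T.  The associated graph has
-- (r+1)n edges, each used 2m times, so all walks have 2m(r+1)n steps and it is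
-- enough to search the vertex sequences of that length.
walkCount : (r m : ℕ) (T : Hypergraph N n) → Fin N → ℕ
walkCount {N} {n} r m T v = List.length (List.filter (isWalk? T m v)
  (List.map Vec.toList (vectors (vertices N n) (suc (2 ℕ.* m ℕ.* (suc r ℕ.* n))))))

walkRatio : (r m : ℕ) (T : Hypergraph N n) → Fin N → ℚ
walkRatio r m T v = ℤ.+ walkCount r m T v ℚ./ ∣Γ∣ T
  where instance _ = ∣Γ∣≢0 T

FC : (r m n : ℕ) → ℚ
FC r m n = List.foldr _+_ 0ℚ (List.map (λ T → sum λ v → walkRatio r m T v) (ℋ r n))

F : (r m : ℕ) → Series
F r m = x· FC r m

{-# OPTIONS --safe #-}
module Submission where

-- A closed walk of the required kind is determined, at every vertex, by the order
-- in which it leaves towards the neighbours, the last exit being the one to the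
-- parent (as in the BEST theorem).  So we count the pairs of a labelled hypertree
-- and a walk by building the walk letter by letter: the number of completions of
-- a partial walk is the coefficient of x^k (k hyperedges being unseen), up to the
-- factorials of the numbers of unseen vertices and hyperedges, in a product of
-- one power series for each vertex of the tree.  A black vertex with q remaining
-- exits to known neighbours contributes essentially
--   B q = Σ_d (q + dm)! / ((m!)^d d!) G^d,
-- where d is the number of new hyperedges at this vertex and G = x κ λ^r, with
-- λ = B (m - 1) / (m - 1)! = ℓ_m(G), counts one of them: κ is the number of
-- sequences of exits from a hyperedge in which no vertex is chosen twice in a row,
-- up to relabelling of its vertices, and there is a factor λ for each of its r
-- other vertices.  These products satisfy the recurrence given by the next letter.
-- For the initial walk the product is B 0 = h_m(G), and orbit counting turns the
-- weights 1/|Γ(T)| into labelled hypertrees.  Finally G = f(κ x), and comparing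
-- coefficients of x gives κ = FC_1.

open import Defs
open import Algebra.Bundles using (CommutativeMonoid; CommutativeRing; CommutativeSemiring)
import Algebra.Properties.CommutativeMonoid.Sum as MonoidSum
import Algebra.Properties.CommutativeSemigroup as CSemigroup
import Algebra.Properties.Semiring.Mult as SemiringMult
import Algebra.Properties.Semiring.Sum as SemiringSum
open import Algebra.Structures.Biased using (isCommutativeMonoidˡ; isCommutativeSemiringˡ)
open import Data.Bool.Base using (Bool; true; false; if_then_else_)
open import Data.Empty using (⊥; ⊥-elim)
open import Data.Fin.Base using (Fin; zero; suc; toℕ; fromℕ<)
open import Data.Fin.Properties as Fin using (toℕ≤pred[n])
open import Data.Fin.Subset using (Subset; inside; outside; ∣_∣) renaming (_∈_ to _∈ˢ_)
open import Data.Integer.Base as ℤ using (ℤ)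
import Data.Integer.Properties as ℤ
open import Data.List.Base as List using (List; []; _∷_; _++_)
open import Data.List.Membership.Propositional using () renaming (_∈_ to _∈ˡ_; _∉_ to _∉ˡ_)
open import Data.List.Properties using (++-assoc)
import Data.List.Relation.Binary.Infix.Heterogeneous as Infix
open import Data.List.Relation.Binary.Prefix.Heterogeneous using ([]; _∷_)
import Data.List.Relation.Unary.All as ListAll
import Data.List.Relation.Unary.All.Properties as ListAll
open import Data.List.Relation.Unary.Any using (here; there)
open import Data.List.Relation.Unary.Linked as Linked using (Linked; []; [-]; _∷_)
open import Data.Maybe.Base using (Maybe; just; nothing)
open import Data.Maybe.Properties using (just-injective)
open import Data.Nat.Base as ℕ using (ℕ; zero; suc; _+_; _*_; _∸_; _≤_; _<_; z≤n; s≤s; NonZero; _!; _/_)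
open import Data.Nat.Combinatorics using (_C_; k![n∸k]!∣n!; nCk≡n!/k![n-k]!)
import Data.Nat.DivMod as ℕ
open import Data.Nat.Properties as ℕ using (≤-trans; m∸n≤m; m+[n∸m]≡n; ≤-refl; ≤-reflexive; _!≢0)
open import Data.Product.Base using (∃; _×_; _,_; proj₁; proj₂)
open import Data.Rational.Base as ℚ using (ℚ; 0ℚ; 1ℚ)
open import Data.Rational.Properties as ℚ using (+-*-commutativeRing)
import Data.Rational.Unnormalised.Base as ℚᵘ
import Data.Rational.Unnormalised.Properties as ℚᵘ
open import Data.Sum.Base using (_⊎_; inj₁; inj₂)
open import Data.Sum.Properties using (inj₁-injective; inj₂-injective)
open import Data.Vec.Base as Vec using (Vec; []; _∷_; lookup)
open import Data.Vec.Properties using (∷-injective)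
open import Function.Base using (id; _∘_)
open import Level using (0ℓ)
import Relation.Binary.PropositionalEquality as ≡
import Relation.Binary.Reasoning.Setoid as SetoidReasoning
open import Relation.Binary.Structures using (IsEquivalence)
open import Relation.Nullary using (Dec; yes; no; does; ¬_; contradiction)
open import Relation.Nullary.Decidable using (dec-true; dec-false; _×-dec_; ¬?)
open ≡ using (_≡_; _≢_)
open import Algebra.Properties.Semiring.Exp (CommutativeRing.semiring +-*-commutativeRing) using (^-homo-*) renaming (_^_ to _^ℚ_)

-- A full word determines the labelled hypertree and the root, so pairs of a tree and a walk are
-- counted as words, and no tree is carried through the induction. The price is that the recurrence
-- must hold for every partial word that is consistent with its own explored tree, also for those
-- that cannot be completed: there the product has to vanish by itself. This shapes the weights. `Q`
-- is 0 once a hyperedge has too many vertices, was left too often, or has used up its exits to the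
-- parent while others remain; `block 0 (suc E)` is 0 because a vertex cannot take its last exit to
-- the parent while exits to children remain. Two boundary cases need a global count: no vertex is
-- left for a discovery (`capacity`), and the root would end the walk too early (`root-vanish`).
--
-- The names of vertices and hyperedges enter only through factorials: the choice of one among K
-- unseen names turns (K - 1)! into K!, so the local series may number everything in order of
-- discovery. The condition on consecutive letters concerns only the exits from one hyperedge, which
-- is why it is absorbed into the single integer κ.

module Walks where

  open import Data.Fin.Subset.Properties using (⊆-antisym) renaming (_∈?_ to _∈ˢ?_)
  open import Data.List.Membership.Propositional.Properties using (∈-++⁺ʳ)
  open import Data.List.Relation.Binary.Infix.Heterogeneous using (Infix)
  open import Data.Nat.Properties using (+-*-commutativeSemiring; +-commutativeSemigroup; +-assoc; +-comm; +-identityʳ; +-mono-≤; *-distribˡ-+; *-zeroʳ; *-identityʳ; m≤m+n; m≤n+m)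
  open import Data.Unit.Base using (⊤; tt)
  open import Data.Vec.Base using (here; there)
  open import Data.Vec.Properties using (lookup∘tabulate; []=⇒lookup; lookup⇒[]=)
  open import Data.Vec.Relation.Unary.All as All using (All)
  open import Data.Vec.Relation.Unary.Any as Any using (Any; here; there)
  open import Data.Vec.Relation.Unary.Unique.Propositional.Properties using (tabulate⁺)
  open import Relation.Binary.Construct.Closure.ReflexiveTransitive using (Star; ε; _◅_; _◅◅_; reverse)
  open import Relation.Binary.PropositionalEquality
  import Relation.Unary as Unary
  open import Algebra.Properties.CommutativeSemigroup +-commutativeSemigroup using (interchange)
  open import Algebra.Properties.Semiring.Sum (CommutativeSemiring.semiring +-*-commutativeSemiring) public using (sum; sum-cong-≗; ∑-distrib-+; ∑-comm; ∑-permute)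
  import Data.List.Relation.Unary.Any as ListAny
  import Data.Maybe.Properties as Maybe
  import Data.Product.Properties as Product
  import Data.Product.Base as Product
  import Data.Vec.Relation.Unary.All.Properties as All

  -- Counting by sums of indicators.

  ind : ∀ {p} {P : Set p} → Dec P → ℕ
  ind d = if does d then 1 else 0

  ind-yes : ∀ {p} {P : Set p} (d : Dec P) → P → ind d ≡ 1
  ind-yes (yes _) _ = refl
  ind-yes (no ¬p) p = contradiction p ¬p

  ind-no : ∀ {p} {P : Set p} (d : Dec P) → ¬ P → ind d ≡ 0
  ind-no (yes p) ¬p = contradiction p ¬p
  ind-no (no _)  _  = refl

  ind-mono : ∀ {p q} {P : Set p} {Q : Set q} (d : Dec P) (e : Dec Q) → (P → Q) → ind d ≤ ind e
  ind-mono (no _)  e       f = z≤n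
  ind-mono (yes p) (yes _) f = ≤-refl
  ind-mono (yes p) (no ¬q) f = contradiction (f p) ¬q

  ind-cong : ∀ {p q} {P : Set p} {Q : Set q} (d : Dec P) (e : Dec Q) →
             (P → Q) → (Q → P) → ind d ≡ ind e
  ind-cong (yes p) e f g = sym (ind-yes e (f p))
  ind-cong (no ¬p) e f g = sym (ind-no e (¬p ∘ g))

  module _ {a} {A : Set a} where

    lsum : List A → (A → ℕ) → ℕ
    lsum []       f = 0
    lsum (x ∷ xs) f = f x + lsum xs f

    lsum-cong : ∀ xs {f g : A → ℕ} → (∀ x → f x ≡ g x) → lsum xs f ≡ lsum xs g
    lsum-cong []       eq = refl
    lsum-cong (x ∷ xs) eq = cong₂ _+_ (eq x) (lsum-cong xs eq)

    lsum-0 : ∀ xs → lsum xs (λ _ → 0) ≡ 0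
    lsum-0 []       = refl
    lsum-0 (x ∷ xs) = lsum-0 xs

    lsum-++ : ∀ xs ys (f : A → ℕ) → lsum (xs ++ ys) f ≡ lsum xs f + lsum ys f
    lsum-++ []       ys f = refl
    lsum-++ (x ∷ xs) ys f = trans (cong (f x +_) (lsum-++ xs ys f)) (sym (+-assoc (f x) _ _))

    lsum-+ : ∀ xs (f g : A → ℕ) → lsum xs (λ x → f x + g x) ≡ lsum xs f + lsum xs g
    lsum-+ []       f g = refl
    lsum-+ (x ∷ xs) f g =
      trans (cong (f x + g x +_) (lsum-+ xs f g)) (interchange (f x) (g x) _ _)

    lsum-*ˡ : ∀ c xs (f : A → ℕ) → lsum xs (λ x → c * f x) ≡ c * lsum xs f
    lsum-*ˡ c []       f = sym (*-zeroʳ c)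
    lsum-*ˡ c (x ∷ xs) f rewrite lsum-*ˡ c xs f = sym (*-distribˡ-+ c (f x) _)

    length-filter : ∀ {p} {P : A → Set p} (P? : Unary.Decidable P) xs →
                    List.length (List.filter P? xs) ≡ lsum xs (ind ∘ P?)
    length-filter P? [] = refl
    length-filter P? (x ∷ xs) with P? x
    ... | yes p = cong suc (length-filter P? xs)
    ... | no ¬p = length-filter P? xs

    lsum-filter : ∀ {p} {P : A → Set p} (P? : Unary.Decidable P) xs (f : A → ℕ) →
                  lsum (List.filter P? xs) f ≡ lsum xs (λ x → ind (P? x) * f x)
    lsum-filter P? [] f = refl
    lsum-filter P? (x ∷ xs) f with P? x
    ... | yes p = cong₂ _+_ (sym (+-identityʳ (f x))) (lsum-filter P? xs f)
    ... | no ¬p = lsum-filter P? xs f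

  module _ {a b} {A : Set a} {B : Set b} where

    lsum-map : ∀ (g : B → A) xs (f : A → ℕ) → lsum (List.map g xs) f ≡ lsum xs (f ∘ g)
    lsum-map g []       f = refl
    lsum-map g (x ∷ xs) f = cong (f (g x) +_) (lsum-map g xs f)

    lsum-swap : ∀ (xs : List A) (ys : List B) (f : A → B → ℕ) →
                lsum xs (λ x → lsum ys (f x)) ≡ lsum ys (λ y → lsum xs (λ x → f x y))
    lsum-swap []       ys f = sym (lsum-0 ys)
    lsum-swap (x ∷ xs) ys f = trans (cong (lsum ys (f x) +_) (lsum-swap xs ys f))
                                    (sym (lsum-+ ys (f x) _))

  lsum-tabulate : ∀ {a} {A : Set a} {k} (g : Fin k → A) (f : A → ℕ) →
                  lsum (List.tabulate g) f ≡ sum (f ∘ g)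
  lsum-tabulate {k = zero}  g f = refl
  lsum-tabulate {k = suc k} g f = cong (f (g zero) +_) (lsum-tabulate (g ∘ suc) f)

  lsum-allFin : ∀ k (f : Fin k → ℕ) → lsum (List.allFin k) f ≡ sum f
  lsum-allFin k f = lsum-tabulate id f

  lsum-vectors : ∀ {a} {A : Set a} (xs : List A) k (f : Vec A (suc k) → ℕ) →
                 lsum (vectors xs (suc k)) f ≡ lsum xs (λ x → lsum (vectors xs k) (λ v → f (x ∷ v)))
  lsum-vectors {A = A} xs k f = go xs
    where
    ys = vectors xs k
    go : ∀ zs → lsum (List.cartesianProductWith (_∷_ {n = k}) zs ys) f
              ≡ lsum zs (λ x → lsum ys (λ v → f (x ∷ v)))
    go []       = refl
    go (z ∷ zs) = trans (lsum-++ (List.map (z ∷_) ys) _ f)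
                        (cong₂ _+_ (lsum-map (z ∷_) ys f) (go zs))

  sum-mono : ∀ {k} {f g : Fin k → ℕ} → (∀ i → f i ≤ g i) → sum f ≤ sum g
  sum-mono {zero}  le = z≤n
  sum-mono {suc k} le = +-mono-≤ (le zero) (sum-mono (le ∘ suc))

  sum-0 : ∀ {k} {f : Fin k → ℕ} → (∀ i → f i ≡ 0) → sum f ≡ 0
  sum-0 {zero}  eq = refl
  sum-0 {suc k} eq rewrite eq zero = sum-0 (eq ∘ suc)

  sum-const : ∀ k c → sum {k} (λ _ → c) ≡ k * c
  sum-const zero    c = refl
  sum-const (suc k) c = cong (c +_) (sum-const k c)

  sum-single : ∀ {k} (x : Fin k) (f : Fin k → ℕ) → (∀ y → y ≢ x → f y ≡ 0) → sum f ≡ f x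
  sum-single zero    f z = trans (cong (f zero +_) (sum-0 λ i → z (suc i) λ ())) (+-identityʳ _)
  sum-single (suc x) f z rewrite z zero (λ ()) = sum-single x (f ∘ suc) λ y ne → z (suc y) (ne ∘ Fin.suc-injective)

  sum-suc : ∀ {k} {f g : Fin k → ℕ} x → f x ≡ suc (g x) → (∀ y → y ≢ x → f y ≡ g y) → sum f ≡ suc (sum g)
  sum-suc {suc k} zero    e eq = cong₂ _+_ e (sum-cong-≗ λ y → eq (suc y) λ ())
  sum-suc {suc k} {f} {g} (suc x) e eq = trans
    (cong₂ _+_ (eq zero λ ()) (sum-suc x e λ y ne → eq (suc y) (ne ∘ Fin.suc-injective))) (ℕ.+-suc (g zero) _)

  sum-ind≡ : ∀ {k} (x : Fin k) → sum (λ y → ind (y Fin.≟ x)) ≡ 1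
  sum-ind≡ x = trans (sum-single x _ λ y ne → ind-no (y Fin.≟ x) ne) (ind-yes (x Fin.≟ x) refl)

  f≤sum : ∀ {k} (f : Fin k → ℕ) x → f x ≤ sum f
  f≤sum f zero    = m≤m+n _ _
  f≤sum f (suc x) = ≤-trans (f≤sum (f ∘ suc) x) (m≤n+m _ _)

  -- No slack in the total leaves no slack in a term. Every passage from a global count (edges of a
  -- hypertree, exits of a walk, children of all hyperedges) to a statement about a single edge or
  -- hyperedge goes through this.
  sum-squeeze : ∀ {k} {f g : Fin k → ℕ} → (∀ i → f i ≤ g i) → sum g ≤ sum f → ∀ i → f i ≡ g i
  sum-squeeze {suc k} {f} {g} le eq i = go i
    where
    open import Data.Nat.Properties using (≤-antisym; +-cancelˡ-≤; +-cancelʳ-≤; +-monoʳ-≤; +-monoˡ-≤)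
    rest = sum-mono (le ∘ suc)
    go : ∀ i → f i ≡ g i
    go zero = ≤-antisym (le zero)
      (+-cancelʳ-≤ (sum (g ∘ suc)) _ _ (≤-trans eq (+-monoʳ-≤ (f zero) rest)))
    go (suc i) = sum-squeeze (le ∘ suc)
      (+-cancelˡ-≤ (g zero) _ _ (≤-trans eq (+-monoˡ-≤ _ (le zero)))) i

  vsum : ∀ {N n} → (Vertex N n → ℕ) → ℕ
  vsum f = sum (f ∘ inj₁) + sum (f ∘ inj₂)

  vsum-cong : ∀ {N n} {f g : Vertex N n → ℕ} → (∀ x → f x ≡ g x) → vsum f ≡ vsum g
  vsum-cong eq = cong₂ _+_ (sum-cong-≗ (eq ∘ inj₁)) (sum-cong-≗ (eq ∘ inj₂))

  lsum-vertices : ∀ N n (f : Vertex N n → ℕ) → lsum (vertices N n) f ≡ vsum f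
  lsum-vertices N n f = trans (lsum-++ (List.map inj₁ (List.allFin N)) _ f)
    (cong₂ _+_ (trans (lsum-map inj₁ (List.allFin N) f) (lsum-allFin N _))
               (trans (lsum-map inj₂ (List.allFin n) f) (lsum-allFin n _)))

  module _ {N n : ℕ} where

    -- Defined by recursion on the length rather than as a sum over a list of vectors, so that a
    -- letter can be split off at either end.
    wordSum : ℕ → (List (Vertex N n) → ℕ) → ℕ
    wordSum zero    f = f []
    wordSum (suc k) f = vsum λ y → wordSum k (f ∘ (y ∷_))

    wordSum-cong : ∀ k {f g} → (∀ p → f p ≡ g p) → wordSum k f ≡ wordSum k g
    wordSum-cong zero    eq = eq []
    wordSum-cong (suc k) eq = vsum-cong λ y → wordSum-cong k (eq ∘ (y ∷_))

    wordSum-0 : ∀ k {f} → (∀ p → f p ≡ 0) → wordSum k f ≡ 0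
    wordSum-0 zero    eq = eq []
    wordSum-0 (suc k) eq = cong₂ _+_ (sum-0 λ u → wordSum-0 k (eq ∘ (inj₁ u ∷_)))
                                     (sum-0 λ i → wordSum-0 k (eq ∘ (inj₂ i ∷_)))

    -- A partial walk is the tail of the word and grows at its front; the next letter to be added is
    -- therefore the last letter of the missing prefix.
    wordSum-snoc : ∀ k f → wordSum (suc k) f ≡ vsum λ y → wordSum k λ p → f (p ++ y ∷ [])
    wordSum-snoc zero    f = refl
    wordSum-snoc (suc k) f = begin
      vsum (λ x → wordSum (suc k) (f ∘ (x ∷_)))
        ≡⟨ vsum-cong (λ x → wordSum-snoc k (f ∘ (x ∷_))) ⟩
      vsum (λ x → vsum λ y → wordSum k λ p → f (x ∷ p ++ y ∷ []))
        ≡⟨ vsum-swap (λ x y → wordSum k λ p → f (x ∷ p ++ y ∷ [])) ⟩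
      vsum (λ y → vsum λ x → wordSum k λ p → f (x ∷ p ++ y ∷ [])) ∎
      where
      open ≡-Reasoning
      vsum-swap : (g : Vertex N n → Vertex N n → ℕ) →
                  vsum (λ x → vsum (g x)) ≡ vsum (λ y → vsum (λ x → g x y))
      vsum-swap g = begin
        vsum (λ x → vsum (g x))                             ≡⟨ lsum-vertices N n _ ⟨
        lsum vs (λ x → vsum (g x))                          ≡⟨ lsum-cong vs (λ x → lsum-vertices N n _) ⟨
        lsum vs (λ x → lsum vs (g x))                       ≡⟨ lsum-swap vs vs g ⟩
        lsum vs (λ y → lsum vs (λ x → g x y))               ≡⟨ lsum-cong vs (λ x → lsum-vertices N n _) ⟩
        lsum vs (λ y → vsum (λ x → g x y))                  ≡⟨ lsum-vertices N n _ ⟩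
        vsum (λ y → vsum (λ x → g x y))                     ∎
        where vs = vertices N n

    lsum-words : ∀ k f → lsum (vectors (vertices N n) k) (f ∘ Vec.toList) ≡ wordSum k f
    lsum-words zero    f = +-identityʳ _
    lsum-words (suc k) f = begin
      lsum (vectors vs (suc k)) (f ∘ Vec.toList)
        ≡⟨ lsum-vectors vs k _ ⟩
      lsum vs (λ y → lsum (vectors vs k) (f ∘ (y ∷_) ∘ Vec.toList))
        ≡⟨ lsum-cong vs (λ y → lsum-words k (f ∘ (y ∷_))) ⟩
      lsum vs (λ y → wordSum k (f ∘ (y ∷_)))
        ≡⟨ lsum-vertices N n _ ⟩
      wordSum (suc k) f ∎
      where
      open ≡-Reasoning
      vs = vertices N n

  -- Predecessors and crossings in a list of vertices read from its end

  ∣∣≡sum : ∀ {N} (e : Subset N) → ∣ e ∣ ≡ sum (λ u → ind (u ∈ˢ? e))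
  ∣∣≡sum []            = refl
  ∣∣≡sum (true  ∷ e) = cong suc (trans (∣∣≡sum e) (sum-cong-≗ λ u → ind-cong (u ∈ˢ? e) (suc u ∈ˢ? (true ∷ e)) there λ { (there p) → p }))
  ∣∣≡sum (false ∷ e) = trans (∣∣≡sum e) (sum-cong-≗ λ u → ind-cong (u ∈ˢ? e) (suc u ∈ˢ? (false ∷ e)) there λ { (there p) → p })

  sum-pos : ∀ {k} (f : Fin k → ℕ) → 0 < sum f → ∃ λ i → 0 < f i
  sum-pos {suc k} f lt with f zero in eq
  ... | suc _ = zero , subst (0 <_) (sym eq) (s≤s z≤n)
  ... | zero  with sum-pos (f ∘ suc) lt
  ... | i , p = suc i , p

  ind-pos : ∀ {p} {P : Set p} (d : Dec P) → 0 < ind d → P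
  ind-pos (yes p) _ = p

  module _ {N n : ℕ} where

    infix 4 _∈?_ _∈ʷ_
    _∈ʷ_ : Vertex N n → List (Vertex N n) → Set
    _∈ʷ_ = _∈ˡ_

    _∈?_ : (x : Vertex N n) (w : List (Vertex N n)) → Dec (x ∈ˡ w)
    x ∈? w = ListAny.any? (x ≟ᵛ_) w

    -- The steps from x to y when w is read from its last entry.
    steps : List (Vertex N n) → (x y : Vertex N n) → ℕ
    steps w x y = traversals y x w

    steps-hit : ∀ y x w → steps (y ∷ x ∷ w) x y ≡ suc (steps (x ∷ w) x y)
    steps-hit y x w rewrite dec-true (Product.≡-dec _≟ᵛ_ _≟ᵛ_ (y , x) (y , x)) refl = refl

    steps-miss : ∀ y x w {a b} → (a ≢ x ⊎ b ≢ y) → steps (y ∷ x ∷ w) a b ≡ steps (x ∷ w) a b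
    steps-miss y x w {a} {b} ne
      with Product.≡-dec _≟ᵛ_ _≟ᵛ_ (b , a) (y , x) | differ
      where
      differ : (a ≢ x ⊎ b ≢ y) → (b , a) ≢ (y , x)
      differ (inj₁ a≢x) refl = a≢x refl
      differ (inj₂ b≢y) refl = b≢y refl
    ... | yes p | differ = contradiction p (differ ne)
    ... | no _  | _      = refl

    step? : ∀ (x y a b : Vertex N n) → (a ≡ x × b ≡ y) ⊎ (a ≢ x ⊎ b ≢ y)
    step? x y a b with a ≟ᵛ x | b ≟ᵛ y
    ... | yes p | yes q = inj₁ (p , q)
    ... | yes _ | no ¬q = inj₂ (inj₂ ¬q)
    ... | no ¬p | _     = inj₂ (inj₁ ¬p)

    steps-≤ : ∀ y x w a b → steps (x ∷ w) a b ≤ steps (y ∷ x ∷ w) a b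
    steps-≤ y x w a b with step? x y a b
    ... | inj₁ (refl , refl) = ≤-trans (ℕ.n≤1+n _) (≤-reflexive (sym (steps-hit y x w)))
    ... | inj₂ ne = ≤-reflexive (sym (steps-miss y x w ne))

    steps-++ : ∀ p w a b → steps w a b ≤ steps (p ++ w) a b
    steps-++ [] w a b = ≤-refl
    steps-++ (y ∷ p) w a b with p ++ w in eq
    ... | [] = subst (λ l → steps w a b ≤ steps l a b) eq (steps-++ p w a b) 
    ... | x ∷ q = ≤-trans (subst (λ l → steps w a b ≤ steps l a b) eq (steps-++ p w a b)) (steps-≤ y x q a b)

    steps⇒∈ : ∀ w a b → 0 < steps w a b → (a ∈ˡ w) × (b ∈ˡ w)
    steps⇒∈ (y ∷ w′@(x ∷ w)) a b lt with step? x y a b | steps⇒∈ w′ a b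
    ... | inj₁ (refl , refl) | _ = there (here refl) , here refl
    ... | inj₂ ne | rec = Product.map there there (rec (subst (0 <_) (steps-miss y x w ne) lt))

    steps⇒linked : ∀ {R : Vertex N n → Vertex N n → Set} {w} → Linked R w → ∀ a b → 0 < steps w a b → R b a
    steps⇒linked {w = y ∷ x ∷ w} (r ∷ l) a b lt with step? x y a b | steps⇒linked l a b
    ... | inj₁ (refl , refl) | _ = r
    ... | inj₂ ne | rec = rec (subst (0 <_) (steps-miss y x w ne) lt)

    -- The vertex from which x is entered for the first time.
    par : List (Vertex N n) → Vertex N n → Maybe (Vertex N n)
    par []          x = nothing
    par (y ∷ [])    x = nothing
    par (y ∷ z ∷ w) x = if does (x ∈? (z ∷ w)) then par (z ∷ w) x
                        else if does (x ≟ᵛ y) then just z else nothing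

    par-old : ∀ y z w {x} → x ∈ˡ z ∷ w → par (y ∷ z ∷ w) x ≡ par (z ∷ w) x
    par-old y z w {x} x∈ rewrite dec-true (x ∈? (z ∷ w)) x∈ = refl

    par-new : ∀ y z w → y ∉ˡ z ∷ w → par (y ∷ z ∷ w) y ≡ just z
    par-new y z w y∉ rewrite dec-false (y ∈? (z ∷ w)) y∉ | dec-true (y ≟ᵛ y) refl = refl

    data ParView (y z : Vertex N n) (w : List (Vertex N n)) (x : Vertex N n) : Set where
      old  : x ∈ˡ z ∷ w → par (y ∷ z ∷ w) x ≡ par (z ∷ w) x → ParView y z w x
      new  : x ∉ˡ z ∷ w → x ≡ y → par (y ∷ z ∷ w) x ≡ just z → ParView y z w x
      absent : x ∉ˡ y ∷ z ∷ w → par (y ∷ z ∷ w) x ≡ nothing → ParView y z w x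

    par-view : ∀ y z w x → ParView y z w x
    par-view y z w x = go (x ∈? (z ∷ w)) (x ≟ᵛ y)
      where
      go : Dec (x ∈ˡ z ∷ w) → Dec (x ≡ y) → ParView y z w x
      go (yes x∈) _          = old x∈ (par-old y z w x∈)
      go (no x∉)  (yes refl) = new x∉ refl (par-new y z w x∉)
      go (no x∉)  (no x≢y)   = absent (λ { (here p) → x≢y p ; (there p) → x∉ p })
        (trans (cong (λ b → if b then par (z ∷ w) x else _) (dec-false (x ∈? (z ∷ w)) x∉))
               (cong (λ b → if b then just z else nothing) (dec-false (x ≟ᵛ y) x≢y)))

    par⇒∈ : ∀ w {x z} → par w x ≡ just z → (x ∈ˡ w) × (z ∈ˡ w)
    par⇒∈ (y ∷ w′@(z ∷ w)) {x} eq with par-view y z w x | par⇒∈ w′ {x}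
    ... | old x∈ e   | rec = Product.map there there (rec (trans (sym e) eq))
    ... | new _ p e  | _   = here p , there (here (sym (just-injective (trans (sym e) eq))))
    ... | absent _ e   | _ with () ← trans (sym e) eq

    par-∷ : ∀ y w {x} → x ∈ˡ w → par (y ∷ w) x ≡ par w x
    par-∷ y (z ∷ w) x∈ = par-old y z w x∈

    par-++ : ∀ p w {x} → x ∈ˡ w → par (p ++ w) x ≡ par w x
    par-++ []      w x∈ = refl
    par-++ (y ∷ p) w x∈ = trans (par-∷ y (p ++ w) (∈-++⁺ʳ p x∈)) (par-++ p w x∈)

    par-nothing : ∀ w {x v} → x ∈ˡ w → List.last w ≡ just v → par w x ≡ nothing → x ≡ v
    par-nothing (y ∷ [])    (here refl) refl eq = refl
    par-nothing (y ∷ w′@(z ∷ w)) {x} {v} x∈ l eq with par-view y z w x | par-nothing w′ {x} {v}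
    ... | old x∈′ e | rec = rec x∈′ l (trans (sym e) eq)
    ... | new _ _ e | _ with () ← trans (sym e) eq
    ... | absent x∉ _ | _ = contradiction x∈ x∉

    par-last : ∀ w {v} → List.last w ≡ just v → par w v ≡ nothing
    par-last (y ∷ [])    l = refl
    par-last (y ∷ z ∷ w) l = trans (par-old y z w (last∈ (z ∷ w) l)) (par-last (z ∷ w) l)
      where
      last∈ : ∀ w {v} → List.last w ≡ just v → v ∈ˡ w
      last∈ (y ∷ [])    refl = here refl
      last∈ (y ∷ z ∷ w) l    = there (last∈ (z ∷ w) l)

    -- A vertex is seen later than its parent, so induction on the list is induction from the root
    -- downwards.
    par-ind : ∀ w (P : Vertex N n → Set) → (∀ x → x ∈ˡ w → par w x ≡ nothing → P x) →
              (∀ x z → par w x ≡ just z → P z → P x) → ∀ x → x ∈ˡ w → P x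
    par-ind (y ∷ []) P base step x x∈ = base x x∈ refl
    par-ind (y ∷ w′@(z ∷ w)) P base step = extend (y ∈? (z ∷ w)) (par-ind w′ P
        (λ x x∈ eq → base x (there x∈) (trans (par-old y z w x∈) eq))
        (λ x z′ eq → step x z′ (trans (par-old y z w (proj₁ (par⇒∈ (z ∷ w) eq))) eq)))
      where
      extend : Dec (y ∈ˡ z ∷ w) → (∀ x → x ∈ˡ z ∷ w → P x) → ∀ x → x ∈ˡ y ∷ z ∷ w → P x
      extend _        ih x (there x∈)  = ih x x∈
      extend (yes y∈) ih x (here refl) = ih x y∈
      extend (no y∉)  ih x (here refl) = step x z (par-new x z w y∉) (ih z (here refl))

    -- A cycle through x can be read as a cycle through its parent, so induction from the root
    -- pushes it up to the root, which has no parent. Length four is what two hyperedges with the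
    -- same vertices would produce; a cycle of length two is one of length four run through twice.
    par-acyclic₄ : ∀ w {x y z t} → par w x ≡ just y → par w y ≡ just z →
                   par w z ≡ just t → par w t ≡ just x → ⊥
    par-acyclic₄ w {x} {y} {z} {t} p q r s = par-ind w
      (λ x → ∀ y z t → par w x ≡ just y → par w y ≡ just z → par w z ≡ just t → par w t ≡ just x → ⊥)
      (λ x _ e y z t p _ _ _ → case-j (trans (sym e) p))
      (λ x y′ e P y z t p q r s → P z t x (trans (cong (par w) (just-injective (trans (sym e) p))) q) r s
         (trans p (cong just (sym (just-injective (trans (sym e) p))))))
      x (proj₁ (par⇒∈ w p)) y z t p q r s
      where
      case-j : ∀ {y : Vertex N n} → nothing ≡ just y → ⊥
      case-j ()

    par-acyclic₂ : ∀ w {x y} → par w x ≡ just y → par w y ≡ just x → ⊥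
    par-acyclic₂ w p q = par-acyclic₄ w p q p q

    par⇒linked : ∀ {R : Vertex N n → Vertex N n → Set} {w} → Linked R w → ∀ {x z} → par w x ≡ just z → R x z
    par⇒linked {R = R} {w = y ∷ z ∷ w} (r ∷ l) {x} eq with par-view y z w x
    ... | old x∈ e = par⇒linked l (trans (sym e) eq)
    ... | new _ refl e = subst (R x) (just-injective (trans (sym e) eq)) r
    ... | absent _ e with () ← trans (sym e) eq

    _≟ᴹ_ : (p q : Maybe (Vertex N n)) → Dec (p ≡ q)
    _≟ᴹ_ = Maybe.≡-dec _≟ᵛ_

  Any-∈⇒lookup : ∀ {N n} {P : Subset N → Set} {T : Vec (Subset N) n} → Any P T → ∃ λ i → P (lookup T i)
  Any-∈⇒lookup (here p)  = zero , p
  Any-∈⇒lookup (there a) = let i , p = Any-∈⇒lookup a in suc i , p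

  All-lookup : ∀ {N n} {P : Subset N → Set} {T : Vec (Subset N) n} → All P T → ∀ i → P (lookup T i)
  All-lookup (p All.∷ ps) zero    = p
  All-lookup (p All.∷ ps) (suc i) = All-lookup ps i

  -- A walk on a hypertree explores all of it, and every edge joins a vertex to its parent.

  module HypertreeWalk (r m n : ℕ) {T : Hypergraph (suc (r * n)) n} (hyp : IsHypertree r n T)
    {v : Fin (suc (r * n))} {w : List (Vertex (suc (r * n)) n)} (walk : IsWalk T (suc m) v w) where

    open IsWalk walk

    private
      uniform : ∀ i → ∣ lookup T i ∣ ≡ suc r
      uniform = All-lookup (proj₁ (proj₂ hyp))

    edge⇒∈ : ∀ u i → u ∈ˢ lookup T i → (black u ∈ʷ w) × (white i ∈ʷ w)
    edge⇒∈ u i u∈ = let p , q = steps⇒∈ w (white i) (black u) (subst (0 <_) (sym (proj₁ (edges u i u∈))) (s≤s z≤n)) in q , p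

    all-visited : ∀ x → x ∈ʷ w
    all-visited (white i) with sum-pos (λ u → ind (u ∈ˢ? lookup T i)) (subst (0 <_) (trans (sym (uniform i)) (∣∣≡sum (lookup T i))) (s≤s z≤n))
    ... | u , lt = proj₂ (edge⇒∈ u i (ind-pos (u ∈ˢ? lookup T i) lt))
    all-visited (black u) = go (proj₂ (proj₂ hyp) u v)
      where
      head∈ : ∀ (w : List (Vertex (suc (r * n)) n)) {x} → List.head w ≡ just x → x ∈ʷ w
      head∈ (y ∷ w) refl = here refl
      go : Star (Joined T) u v → black u ∈ʷ w
      go ε        = head∈ w starts
      go (j ◅ _)  = let i , (u∈ , _) = Any-∈⇒lookup j in proj₁ (edge⇒∈ u i u∈)

    private

      up dn ed : Fin n → Fin (suc (r * n)) → ℕ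
      up i u = ind (par w (black u) ≟ᴹ just (white i))
      dn i u = ind (par w (white i) ≟ᴹ just (black u))
      ed i u = ind (u ∈ˢ? lookup T i)

      termwise : ∀ i u → up i u + dn i u ≤ ed i u
      termwise i u with par w (black u) ≟ᴹ just (white i) | par w (white i) ≟ᴹ just (black u)
      ... | yes p | yes q = ⊥-elim (par-acyclic₂ w p q)
      ... | yes p | no ¬q = ≤-reflexive (sym (ind-yes (u ∈ˢ? lookup T i) (par⇒linked {R = Adjacent T} adjacent p)))
      ... | no ¬p | yes q = ≤-reflexive (sym (ind-yes (u ∈ˢ? lookup T i) (par⇒linked {R = Adjacent T} adjacent q)))
      ... | no ¬p | no ¬q = z≤n

      par-black : ∀ u → 1 ≤ sum (λ i → up i u) + ind (u Fin.≟ v)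
      par-black u with par w (black u) in eq
      ... | nothing = ≤-trans (≤-reflexive (sym (ind-yes (u Fin.≟ v) (inj₁-injective (par-nothing w (all-visited (black u)) ends eq))))) (ℕ.m≤n+m _ _)
      ... | just (black u′) = ⊥-elim (par⇒linked {R = Adjacent T} adjacent eq)
      ... | just (white i)  = ≤-trans (≤-trans (≤-reflexive (sym (ind-yes (_≟ᴹ_ {suc (r * n)} {n} (just (white i)) (just (white i))) refl)))
                                (f≤sum (λ i′ → ind (_≟ᴹ_ {suc (r * n)} {n} (just (white i)) (just (white i′)))) i)) (ℕ.m≤m+n _ _)

      par-white : ∀ i → 1 ≤ sum (λ u → dn i u)
      par-white i with par w (white i) in eq
      ... | nothing with () ← par-nothing w (all-visited (white i)) ends eq
      ... | just (white _) = ⊥-elim (par⇒linked {R = Adjacent T} adjacent eq)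
      ... | just (black u) = ≤-trans (≤-reflexive (sym (ind-yes (_≟ᴹ_ {suc (r * n)} {n} (just (black u)) (just (black u))) refl)))
                               (f≤sum (λ u′ → ind (_≟ᴹ_ {suc (r * n)} {n} (just (black u)) (just (black u′)))) u)

      Σup : r * n ≤ sum (λ i → sum (up i))
      Σup = ℕ.≤-pred (begin
        suc (r * n)                                                      ≡⟨ ℕ.*-identityʳ _ ⟨
        suc (r * n) * 1                                                  ≡⟨ sum-const (suc (r * n)) 1 ⟨
        sum {suc (r * n)} (λ _ → 1)                                      ≤⟨ sum-mono par-black ⟩
        sum (λ u → sum (λ i → up i u) + ind (u Fin.≟ v))                 ≡⟨ ∑-distrib-+ (λ u → sum (λ i → up i u)) (λ u → ind (u Fin.≟ v)) ⟩
        sum (λ u → sum (λ i → up i u)) + sum (λ u → ind (u Fin.≟ v))     ≡⟨ cong₂ _+_ (∑-comm (λ u i → up i u)) (sum-ind≡ v) ⟩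
        sum (λ i → sum (up i)) + 1                                       ≡⟨ ℕ.+-comm _ 1 ⟩
        suc (sum (λ i → sum (up i)))                                     ∎)
        where open ℕ.≤-Reasoning

      Σed≤ : sum (λ i → sum (ed i)) ≤ sum (λ i → sum (λ u → up i u + dn i u))
      Σed≤ = begin
        sum (λ i → sum (ed i))                                       ≡⟨ sum-cong-≗ (λ i → trans (sym (∣∣≡sum (lookup T i))) (uniform i)) ⟩
        sum {n} (λ _ → suc r)                                        ≡⟨ sum-const n (suc r) ⟩
        n * suc r                                                    ≡⟨ trans (ℕ.*-comm n (suc r)) (ℕ.+-comm n (r * n)) ⟩
        r * n + n                                                    ≤⟨ ℕ.+-mono-≤ Σup (ℕ.≤-trans (≤-reflexive (trans (sym (ℕ.*-identityʳ n)) (sym (sum-const n 1)))) (sum-mono par-white)) ⟩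
        sum (λ i → sum (up i)) + sum (λ i → sum (dn i))              ≡⟨ ∑-distrib-+ (λ i → sum (up i)) (λ i → sum (dn i)) ⟨
        sum (λ i → sum (up i) + sum (dn i))                          ≡⟨ sum-cong-≗ (λ i → ∑-distrib-+ (up i) (dn i)) ⟨
        sum (λ i → sum (λ u → up i u + dn i u))                      ∎
        where open ℕ.≤-Reasoning

    -- A count takes the place of acyclicity. The associated graph has n(r + 1) edges. The rn black
    -- vertices other than v and the n white vertices each have an edge to their parent, and these
    -- rn + n edges are distinct because no two vertices are each other's parent. So there are no
    -- further edges.
    edge⇒par : ∀ u i → u ∈ˢ lookup T i → par w (black u) ≡ just (white i) ⊎ par w (white i) ≡ just (black u)
    edge⇒par u i u∈ with par w (black u) ≟ᴹ just (white i) | par w (white i) ≟ᴹ just (black u) | eq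
      where
      eq : up i u + dn i u ≡ ed i u
      eq = sum-squeeze (termwise i) (ℕ.≤-reflexive (sym
             (sum-squeeze (λ i → sum-mono (termwise i)) Σed≤ i))) u
    ... | yes p | _     | _ = inj₁ p
    ... | no _  | yes q | _ = inj₂ q
    ... | no _  | no _  | e with () ← trans e (ind-yes (u ∈ˢ? lookup T i) u∈)

  true≢false : ∀ {b} → b ≡ true → b ≢ false
  true≢false refl ()

  -- The tree explored by a partial walk.

  module _ {N n : ℕ} where

    infixl 9 _[_≔_]
    abstract

      _[_≔_] : ∀ {A : Set} → (Vertex N n → A) → Vertex N n → A → Vertex N n → A
      (f [ y ≔ a ]) x = if does (x ≟ᵛ y) then a else f x

      ≔-hit : ∀ {A : Set} (f : Vertex N n → A) y {a} → (f [ y ≔ a ]) y ≡ a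
      ≔-hit f y rewrite dec-true (y ≟ᵛ y) refl = refl

      ≔-miss : ∀ {A : Set} (f : Vertex N n → A) {y a x} → x ≢ y → (f [ y ≔ a ]) x ≡ f x
      ≔-miss f {y} {a} {x} ne rewrite dec-false (x ≟ᵛ y) ne = refl

    ≔-true : (f : Vertex N n → Bool) → ∀ {x y} → f x ≡ true → (f [ y ≔ true ]) x ≡ true
    ≔-true f {x} {y} o with x ≟ᵛ y
    ... | yes refl = ≔-hit f x
    ... | no ne    = trans (≔-miss f ne) o

    ≔-false⁻¹ : (f : Vertex N n → Bool) → ∀ {x y} → (f [ y ≔ false ]) x ≡ true → x ≢ y × f x ≡ true
    ≔-false⁻¹ f {x} {y} o with x ≟ᵛ y
    ... | yes refl with () ← trans (sym o) (≔-hit f x)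
    ... | no ne    = ne , trans (sym (≔-miss f ne)) o

    ≔-true⁻¹ : (f : Vertex N n → Bool) → ∀ {x y} → (f [ y ≔ true ]) x ≡ false → f x ≡ false
    ≔-true⁻¹ f {x} {y} o with x ≟ᵛ y
    ... | yes refl with () ← trans (sym o) (≔-hit f x)
    ... | no ne    = trans (sym (≔-miss f ne)) o

    bit : Bool → ℕ
    bit b = if b then 1 else 0

    -- A walk, read from its last entry, has explored the tree given by par; on
    -- marks the vertices on the path from the root to the current vertex.
    record Tree (m : ℕ) (cur : Vertex N n) (w : List (Vertex N n)) (on : Vertex N n → Bool) : Set where
      field
        cur-on    : on cur ≡ true
        on-par    : ∀ {x z} → on x ≡ true → par (cur ∷ w) x ≡ just z → on z ≡ true
        on-unique : ∀ {x x′ z} → on x ≡ true → on x′ ≡ true →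
                    par (cur ∷ w) x ≡ just z → par (cur ∷ w) x′ ≡ just z → x ≡ x′
        cur-top   : ∀ {x} → on x ≡ true → par (cur ∷ w) x ≢ just cur
        on-seen   : ∀ {x} → on x ≡ true → x ∈ˡ cur ∷ w
        -- An edge of the explored tree is crossed alternately downwards and upwards, and the walk
        -- is below it exactly when its lower end x is marked.
        balance   : ∀ {x z} → par (cur ∷ w) x ≡ just z →
                    steps (cur ∷ w) z x ≡ bit (on x) + steps (cur ∷ w) x z
        tree-edge : ∀ {x y} → 0 < steps (cur ∷ w) x y →
                    par (cur ∷ w) y ≡ just x ⊎ par (cur ∷ w) x ≡ just y
        cap       : ∀ x y → steps (cur ∷ w) x y ≤ m

    module _ {m cur w on} (t : Tree m cur w on) where
      open Tree t

      private
        ws : List (Vertex N n)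
        ws = cur ∷ w

        steps-unseen : ∀ {a b} → (a ∉ˡ ws ⊎ b ∉ˡ ws) → steps ws a b ≡ 0
        steps-unseen {a} {b} un with steps ws a b in eq
        ... | zero  = refl
        ... | suc _ with steps⇒∈ ws a b (subst (0 <_) (sym eq) (s≤s z≤n)) | un
        ... | a∈ , b∈ | inj₁ a∉ = contradiction a∈ a∉
        ... | a∈ , b∈ | inj₂ b∉ = contradiction b∈ b∉

        cap-step : ∀ y → steps ws cur y < m → ∀ a b → steps (y ∷ ws) a b ≤ m
        cap-step y lt a b with step? cur y a b
        ... | inj₁ (refl , refl) = ≤-trans (≤-reflexive (steps-hit y cur w)) lt
        ... | inj₂ ne = ≤-trans (≤-reflexive (steps-miss y cur w ne)) (cap a b)

        edge-step : ∀ y → (par (y ∷ ws) y ≡ just cur ⊎ par (y ∷ ws) cur ≡ just y) →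
                    ∀ {a b} → 0 < steps (y ∷ ws) a b → par (y ∷ ws) b ≡ just a ⊎ par (y ∷ ws) a ≡ just b
        edge-step y e {a} {b} lt with step? cur y a b
        ... | inj₁ (refl , refl) = e
        ... | inj₂ ne with subst (0 <_) (steps-miss y cur w ne) lt
        ... | lt′ with tree-edge lt′ | steps⇒∈ ws a b lt′
        ... | inj₁ p | a∈ , b∈ = inj₁ (trans (par-old y cur w b∈) p)
        ... | inj₂ p | a∈ , b∈ = inj₂ (trans (par-old y cur w a∈) p)

      bit-on : ∀ {x z} → par ws x ≡ just z → on x ≡ true → steps ws z x ≡ suc (steps ws x z)
      bit-on p o = trans (balance p) (cong (λ b → bit b + _) o)

      bit-off : ∀ {x z} → par ws x ≡ just z → on x ≡ false → steps ws z x ≡ steps ws x z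
      bit-off p o = trans (balance p) (cong (λ b → bit b + _) o)

      child-off : ∀ {x} → par ws x ≡ just cur → on x ≡ false
      child-off {x} p with on x in eq
      ... | true  = contradiction p (cur-top eq)
      ... | false = refl

      -- The walk is below the edge from `cur` to its parent, so this edge was crossed once more
      -- downwards than upwards; the bound on the downward crossings leaves room for a step up.
      up-room : ∀ {z} → par ws cur ≡ just z → steps ws cur z < m
      up-room {z} p = ≤-trans (≤-reflexive (sym (bit-on p cur-on))) (cap z cur)

      tree-down : ∀ {y} → par ws y ≡ just cur → steps ws cur y < m → Tree m y ws (on [ y ≔ true ])
      tree-down {y} p lt = record
        { cur-on = ≔-hit on y
        ; on-par = λ {x} {z} o q → ≔-true on (on-par′ x z o (trans (sym (same q)) q))
        ; on-unique = λ {x} {x′} o o′ q q′ → unique x x′ (x ≟ᵛ y) (x′ ≟ᵛ y) o o′ (trans (sym (same q)) q) (trans (sym (same q′)) q′)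
        ; cur-top = λ {x} o q → top x (x ≟ᵛ y) o (trans (sym (same q)) q)
        ; on-seen = λ {x} o → there (seen x (x ≟ᵛ y) o)
        ; balance = λ {x} {z} q → bal x z (x ≟ᵛ y) (trans (sym (same q)) q)
        ; tree-edge = edge-step y (inj₁ (trans (par-old y cur w y∈) p))
        ; cap = cap-step y lt
        }
        where
        y∈ = proj₁ (par⇒∈ ws p)
        y≢cur : y ≢ cur
        y≢cur refl = par-acyclic₂ ws p p
        same : ∀ {x z} → par (y ∷ ws) x ≡ just z → par (y ∷ ws) x ≡ par ws x
        same {x} q with par-view y cur w x
        ... | old _ e = e
        ... | new y∉ refl _ = contradiction y∈ y∉
        ... | absent _ e with () ← trans (sym e) q
        on-par′ : ∀ x z → (on [ y ≔ true ]) x ≡ true → par ws x ≡ just z → on z ≡ true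
        on-par′ x z o q with x ≟ᵛ y
        ... | no ne    = on-par (trans (sym (≔-miss on ne)) o) q
        ... | yes refl = trans (cong on (just-injective (trans (sym q) p))) cur-on
        unique : ∀ x x′ {z} → Dec (x ≡ y) → Dec (x′ ≡ y) → (on [ y ≔ true ]) x ≡ true → (on [ y ≔ true ]) x′ ≡ true →
                 par ws x ≡ just z → par ws x′ ≡ just z → x ≡ x′
        unique x x′ (yes p) (yes q) _ _ _ _ = trans p (sym q)
        unique x x′ (yes refl) (no ne) o o′ q q′ = contradiction (trans q′ (trans (sym q) p)) (cur-top (trans (sym (≔-miss on ne)) o′))
        unique x x′ (no ne) (yes refl) o o′ q q′ = contradiction (trans q (trans (sym q′) p)) (cur-top (trans (sym (≔-miss on ne)) o))
        unique x x′ (no ne) (no ne′) o o′ q q′ = on-unique (trans (sym (≔-miss on ne)) o) (trans (sym (≔-miss on ne′)) o′) q q′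
        top : ∀ x → Dec (x ≡ y) → (on [ y ≔ true ]) x ≡ true → par ws x ≢ just y
        top x (yes refl) o q = par-acyclic₂ ws q q
        top x (no ne) o q = true≢false (on-par (trans (sym (≔-miss on ne)) o) q) (child-off p)
        seen : ∀ x → Dec (x ≡ y) → (on [ y ≔ true ]) x ≡ true → x ∈ˡ ws
        seen x (yes refl) o = y∈
        seen x (no ne) o = on-seen (trans (sym (≔-miss on ne)) o)
        bal : ∀ x z → Dec (x ≡ y) → par ws x ≡ just z →
              steps (y ∷ ws) z x ≡ bit ((on [ y ≔ true ]) x) + steps (y ∷ ws) x z
        bal x z (yes refl) q with just-injective (trans (sym q) p)
        ... | refl = trans (steps-hit y cur w) (trans (cong suc (bit-off p (child-off p)))
                       (sym (cong₂ (λ b k → bit b + k) (≔-hit on y) (steps-miss y cur w (inj₁ y≢cur)))))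
        bal x z (no ne) q = trans (steps-miss y cur w (inj₂ ne)) (trans (balance q)
                       (sym (cong₂ (λ b k → bit b + k) (≔-miss on ne) (steps-miss y cur w back))))
          where
          back : x ≢ cur ⊎ z ≢ y
          back with x ≟ᵛ cur
          ... | no ne = inj₁ ne
          ... | yes refl = inj₂ λ { refl → par-acyclic₂ ws p q }

      tree-new : ∀ {y} → y ∉ˡ ws → 1 ≤ m → Tree m y ws (on [ y ≔ true ])
      tree-new {y} y∉ 1≤m = record
        { cur-on = ≔-hit on y
        ; on-par = λ {x} {z} o q → ≔-true on (on-par′ x z o (view q))
        ; on-unique = λ {x} {x′} o o′ q q′ → unique x x′ o o′ (view q) (view q′)
        ; cur-top = λ {x} o q → top x (view q)
        ; on-seen = λ {x} o → seen x (x ≟ᵛ y) o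
        ; balance = λ {x} {z} q → bal x z (view q)
        ; tree-edge = edge-step y (inj₁ (par-new y cur w y∉))
        ; cap = cap-step y (≤-trans (≤-reflexive (cong suc (steps-unseen (inj₂ y∉)))) 1≤m)
        }
        where
        Fresh : ∀ x z → Set
        Fresh x z = (x ≡ y × z ≡ cur) ⊎ (x ≢ y × z ≢ y × par ws x ≡ just z)
        view : ∀ {x z} → par (y ∷ ws) x ≡ just z → Fresh x z
        view {x} q with par-view y cur w x
        ... | old x∈ e = let q′ = trans (sym e) q in inj₂ ((λ { refl → y∉ x∈ }) , (λ { refl → y∉ (proj₂ (par⇒∈ ws q′)) }) , q′)
        ... | new _ refl e = inj₁ (refl , sym (just-injective (trans (sym e) q)))
        ... | absent _ e with () ← trans (sym e) q
        y≢cur : y ≢ cur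
        y≢cur refl = y∉ (here refl)
        on-par′ : ∀ x z → (on [ y ≔ true ]) x ≡ true → Fresh x z → on z ≡ true
        on-par′ x z o (inj₁ (_ , refl))     = cur-on
        on-par′ x z o (inj₂ (ne , _ , q)) = on-par (trans (sym (≔-miss on ne)) o) q
        unique : ∀ x x′ {z} → (on [ y ≔ true ]) x ≡ true → (on [ y ≔ true ]) x′ ≡ true → Fresh x z → Fresh x′ z → x ≡ x′
        unique x x′ o o′ (inj₁ (p , _)) (inj₁ (q , _)) = trans p (sym q)
        unique x x′ o o′ (inj₁ (p , refl)) (inj₂ (ne , _ , q)) = contradiction q (cur-top (trans (sym (≔-miss on ne)) o′))
        unique x x′ o o′ (inj₂ (ne , _ , q)) (inj₁ (p , refl)) = contradiction q (cur-top (trans (sym (≔-miss on ne)) o))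
        unique x x′ o o′ (inj₂ (ne , _ , q)) (inj₂ (ne′ , _ , q′)) = on-unique (trans (sym (≔-miss on ne)) o) (trans (sym (≔-miss on ne′)) o′) q q′
        top : ∀ x → Fresh x y → ⊥
        top x (inj₁ (_ , e)) = y≢cur e
        top x (inj₂ (_ , ne , _)) = ne refl
        seen : ∀ x → Dec (x ≡ y) → (on [ y ≔ true ]) x ≡ true → x ∈ˡ y ∷ ws
        seen x (yes p) o = here p
        seen x (no ne) o = there (on-seen (trans (sym (≔-miss on ne)) o))
        bal : ∀ x z → Fresh x z → steps (y ∷ ws) z x ≡ bit ((on [ y ≔ true ]) x) + steps (y ∷ ws) x z
        bal x z (inj₁ (refl , refl)) = trans (steps-hit y cur w) (trans (cong suc (trans (steps-unseen {cur} {y} (inj₂ y∉)) (sym (steps-unseen {y} {cur} (inj₁ y∉)))))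
                       (sym (cong₂ (λ b k → bit b + k) (≔-hit on y) (steps-miss y cur w {y} {cur} (inj₁ y≢cur)))))
        bal x z (inj₂ (ne , ne′ , q)) = trans (steps-miss y cur w (inj₂ ne)) (trans (balance q)
                       (sym (cong₂ (λ b k → bit b + k) (≔-miss on ne) (steps-miss y cur w (inj₂ ne′)))))

      tree-up : ∀ {y} → par ws cur ≡ just y → Tree m y ws (on [ cur ≔ false ])
      tree-up {y} p = record
        { cur-on = trans (≔-miss on y≢cur) (on-par cur-on p)
        ; on-par = λ {x} {z} o q → let q = trans (sym (same q)) q ; ne , o = off⁻¹ x o in
                    trans (≔-miss on (λ { refl → cur-top o q })) (on-par o q)
        ; on-unique = λ {x} {x′} o o′ q q′ → on-unique (proj₂ (off⁻¹ x o)) (proj₂ (off⁻¹ x′ o′)) (trans (sym (same q)) q) (trans (sym (same q′)) q′)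
        ; cur-top = λ {x} o q → let ne , o = off⁻¹ x o in ne (on-unique o cur-on (trans (sym (same q)) q) p)
        ; on-seen = λ {x} o → there (on-seen (proj₂ (off⁻¹ x o)))
        ; balance = λ {x} {z} q → bal x z (x ≟ᵛ cur) (trans (sym (same q)) q)
        ; tree-edge = edge-step y (inj₂ (trans (par-old y cur w (here refl)) p))
        ; cap = cap-step y (up-room p)
        }
        where
        y∈ = proj₂ (par⇒∈ ws p)
        y≢cur : y ≢ cur
        y≢cur refl = par-acyclic₂ ws p p
        same : ∀ {x z} → par (y ∷ ws) x ≡ just z → par (y ∷ ws) x ≡ par ws x
        same {x} q with par-view y cur w x
        ... | old _ e = e
        ... | new y∉ refl _ = contradiction y∈ y∉
        ... | absent _ e with () ← trans (sym e) q
        off⁻¹ : ∀ x → (on [ cur ≔ false ]) x ≡ true → x ≢ cur × on x ≡ true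
        off⁻¹ x = ≔-false⁻¹ on
        bal : ∀ x z → Dec (x ≡ cur) → par ws x ≡ just z →
              steps (y ∷ ws) z x ≡ bit ((on [ cur ≔ false ]) x) + steps (y ∷ ws) x z
        bal x z (yes refl) q with just-injective (trans (sym q) p)
        ... | refl = trans (steps-miss y cur w (inj₁ y≢cur)) (trans (bit-on p cur-on)
                       (sym (cong₂ (λ b k → bit b + k) (≔-hit on cur) (steps-hit y cur w))))
        bal x z (no ne) q = trans (steps-miss y cur w back) (trans (balance q)
                       (sym (cong₂ (λ b k → bit b + k) (≔-miss on ne) (steps-miss y cur w (inj₁ ne)))))
          where
          back : z ≢ cur ⊎ x ≢ y
          back with z ≟ᵛ cur
          ... | no ne = inj₁ ne
          ... | yes refl = inj₂ λ { refl → par-acyclic₂ ws p q }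

  _[_≔ᴺ_] : ∀ {A : Set} → (ℕ → A) → ℕ → A → ℕ → A
  (f [ a ≔ᴺ x ]) b = if does (b ℕ.≟ a) then x else f b

  ≔ᴺ-hit : ∀ {A : Set} (f : ℕ → A) a {x} → (f [ a ≔ᴺ x ]) a ≡ x
  ≔ᴺ-hit f a rewrite dec-true (a ℕ.≟ a) refl = refl

  ≔ᴺ-miss : ∀ {A : Set} (f : ℕ → A) {a x b} → b ≢ a → (f [ a ≔ᴺ x ]) b ≡ f b
  ≔ᴺ-miss f {a} {x} {b} ne rewrite dec-false (b ℕ.≟ a) ne = refl

  infixl 9 _[_≔ˢ_]
  _[_≔ˢ_] : ∀ {A : Set} {n} → (Fin n → A) → Fin n → A → Fin n → A
  (f [ i ≔ˢ a ]) i′ = if does (i′ Fin.≟ i) then a else f i′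

  ≔ˢ-hit : ∀ {A : Set} {n} (f : Fin n → A) i {a} → (f [ i ≔ˢ a ]) i ≡ a
  ≔ˢ-hit f i rewrite dec-true (i Fin.≟ i) refl = refl

  ≔ˢ-miss : ∀ {A : Set} {n} (f : Fin n → A) {i a i′} → i′ ≢ i → (f [ i ≔ˢ a ]) i′ ≡ f i′
  ≔ˢ-miss f {i} {a} {i′} ne rewrite dec-false (i′ Fin.≟ i) ne = refl

  -- Exploration of the hyperedges and the invariant of a partial walk.

  module _ {N n : ℕ} where

    -- Exploration of the hyperedge i: label lists its known vertices in order of
    -- discovery (label 0 is the parent, count is their number) and last is the
    -- index of the vertex to which i was left, or from which it was first entered.
    record Slots : Set where
      constructor slots
      field
        count last : ℕ
        label      : ℕ → Fin N
    open Slots public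

    Alternate : Vertex N n → Vertex N n → Set
    Alternate (black _) (white _) = ⊤
    Alternate (white _) (black _) = ⊤
    Alternate (black _) (black _) = ⊥
    Alternate (white _) (white _) = ⊥

    record SlotsInv (ws : List (Vertex N n)) (on : Vertex N n → Bool) (i : Fin n) (s : Slots) : Set where
      field
        last<       : last s < count s
        parent      : par ws (white i) ≡ just (black (label s 0))
        child       : ∀ a → suc a < count s → par ws (black (label s (suc a))) ≡ just (white i)
        children    : ∀ u → par ws (black u) ≡ just (white i) → ∃ λ a → suc a < count s × label s (suc a) ≡ u
        label-inj   : ∀ {a b} → a < count s → b < count s → label s a ≡ label s b → a ≡ b
        -- If the walk is not below i, it last left i to the parent; if it is below a child, it last
        -- left i to that child. In the remaining case it stands at i, and `last` tells where it
        -- came from.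
        last-off    : on (white i) ≡ false → last s ≡ 0
        last-on     : ∀ a → suc a < count s → on (black (label s (suc a))) ≡ true → last s ≡ suc a

      label-seen : ∀ a → a < count s → black (label s a) ∈ˡ ws
      label-seen zero    lt = proj₂ (par⇒∈ ws parent)
      label-seen (suc a) lt = proj₁ (par⇒∈ ws (child a lt))

    record Inv (m : ℕ) (v : Fin N) (cur : Vertex N n) (w : List (Vertex N n))
               (on : Vertex N n → Bool) (loc : Fin n → Slots) : Set where
      field
        tree     : Tree m cur w on
        ends     : List.last (cur ∷ w) ≡ just (black v)
        alt      : Linked Alternate (cur ∷ w)
        slotsInv : ∀ i → white i ∈ˡ cur ∷ w → SlotsInv (cur ∷ w) on i (loc i)
        -- The walk returns to a hyperedge from the vertex to which it last left it, so the
        -- forbidden pattern is precisely an exit to the index `last`.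
        at-white : ∀ i → cur ≡ white i → ∃ λ w′ → w ≡ black (label (loc i) (last (loc i))) ∷ w′

    black≢white : ∀ {u : Fin N} {i : Fin n} → black u ≢ white i
    black≢white ()

    slots-keep : ∀ {cur w on on′ i s y} → let ws = cur ∷ w in
      SlotsInv ws on i s →
      (∀ u → par (y ∷ ws) (black u) ≡ just (white i) → par ws (black u) ≡ just (white i)) →
      (on′ (white i) ≡ false → last s ≡ 0) →
      (∀ a → suc a < count s → on′ (black (label s (suc a))) ≡ true → last s ≡ suc a) →
      SlotsInv (y ∷ ws) on′ i s
    slots-keep {cur} {w} {y = y} si kids offs ons = record
      { last<     = last<
      ; parent    = trans (par-old y cur w (proj₁ (par⇒∈ (cur ∷ w) parent))) parent
      ; child     = λ a lt → trans (par-old y cur w (proj₁ (par⇒∈ (cur ∷ w) (child a lt)))) (child a lt)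
      ; children  = λ u p → children u (kids u p)
      ; label-inj = label-inj
      ; last-off  = offs
      ; last-on   = ons
      } where open SlotsInv si

    -- The invariant survives each of six moves. `loc` changes only when a hyperedge is discovered
    -- or left; entering a known one keeps it, because its `last` already points at the vertex from
    -- which the walk comes.
    module Moves {m v cur w on loc} (inv : Inv (suc m) v cur w on loc) where
      open Inv inv
      open Tree tree

      private
        ws : List (Vertex N n)
        ws = cur ∷ w

      kids-seen : ∀ {y} → y ∈ˡ ws → ∀ {x z} → par (y ∷ ws) x ≡ just z → par ws x ≡ just z
      kids-seen {y} y∈ {x} q with par-view y cur w x
      ... | old _ e = trans (sym e) q
      ... | new y∉ refl _ = contradiction y∈ y∉
      ... | absent _ e with () ← trans (sym e) q

      kids-other : ∀ {y x z} → x ≢ y → par (y ∷ ws) x ≡ just z → par ws x ≡ just z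
      kids-other {y} {x} x≢y q with par-view y cur w x
      ... | old _ e = trans (sym e) q
      ... | new _ e _ = contradiction e x≢y
      ... | absent _ e with () ← trans (sym e) q

      seen-tail : ∀ {x y} → x ≢ y → x ∈ˡ y ∷ ws → x ∈ˡ ws
      seen-tail x≢y (here p)   = contradiction p x≢y
      seen-tail x≢y (there x∈) = x∈

      module _ {u} (cur≡ : cur ≡ black u) where

        new-white : ∀ {i} → white i ∉ˡ ws → Inv (suc m) v (white i) ws (on [ white i ≔ true ]) (loc [ i ≔ˢ slots 1 0 (λ _ → u) ])
        new-white {i} i∉ = record
          { tree = tree-new tree i∉ (s≤s z≤n)
          ; ends = ends
          ; alt  = subst (Alternate (white i)) (sym cur≡) tt ∷ alt
          ; slotsInv = si
          ; at-white = λ { _ refl → w , cong₂ _∷_ (trans cur≡ (cong (λ s → black (label s (last s))) (sym (≔ˢ-hit loc i)))) refl }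
          }
          where
          si : ∀ i′ → white i′ ∈ˡ white i ∷ ws → SlotsInv (white i ∷ ws) (on [ white i ≔ true ]) i′ ((loc [ i ≔ˢ slots 1 0 (λ _ → u) ]) i′)
          si i′ i′∈ with i′ Fin.≟ i
          ... | yes refl = record
            { last< = s≤s z≤n
            ; parent = trans (par-new (white i) cur w i∉) (cong just cur≡)
            ; child = λ { a (s≤s ()) }
            ; children = λ u p → contradiction (proj₂ (par⇒∈ ws (kids-other {white i} black≢white p))) i∉
            ; label-inj = λ { (s≤s z≤n) (s≤s z≤n) _ → refl }
            ; last-off = λ _ → refl
            ; last-on = λ { a (s≤s ()) }
            }
          ... | no ne = slots-keep (slotsInv i′ (seen-tail (ne ∘ inj₂-injective) i′∈))
            (λ u → kids-other {white i} black≢white)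
            (λ o → SlotsInv.last-off (slotsInv i′ (seen-tail (ne ∘ inj₂-injective) i′∈)) (trans (sym (≔-miss on (ne ∘ inj₂-injective))) o))
            (λ a lt o → SlotsInv.last-on (slotsInv i′ (seen-tail (ne ∘ inj₂-injective) i′∈)) a lt (trans (sym (≔-miss on black≢white)) o))

        down-white : ∀ {i} → par ws (white i) ≡ just (black u) → steps ws (black u) (white i) < suc m →
                     Inv (suc m) v (white i) ws (on [ white i ≔ true ]) loc
        down-white {i} p lt = record
          { tree = tree-down tree p′ (subst (λ x → steps ws x (white i) < suc m) (sym cur≡) lt)
          ; ends = ends
          ; alt  = subst (Alternate (white i)) (sym cur≡) tt ∷ alt
          ; slotsInv = λ i′ i′∈ → let i∈′ = seen i′∈ in slots-keep (slotsInv i′ i∈′) (λ u → kids-other {white i} black≢white)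
              (λ o → SlotsInv.last-off (slotsInv i′ i∈′) (offs i′ o))
              (λ a lt o → SlotsInv.last-on (slotsInv i′ i∈′) a lt (trans (sym (≔-miss on black≢white)) o))
          -- Before this step i was off the path, so it had last been left to its parent: `last` is
          -- 0, the index of u.
          ; at-white = λ { _ refl → w , cong (_∷ w) (trans cur≡ (trans (sym (just-injective (trans (sym (SlotsInv.parent (slotsInv i i∈))) p)))
              (cong (λ a → black (label (loc i) a)) (sym (SlotsInv.last-off (slotsInv i i∈) (child-off tree p′)))))) }
          }
          where
          p′ = trans p (cong just (sym cur≡))
          i∈ = proj₁ (par⇒∈ ws p)
          seen : ∀ {x} → x ∈ˡ white i ∷ ws → x ∈ˡ ws
          seen (here refl) = i∈
          seen (there x∈)  = x∈
          offs : ∀ i′ → (on [ white i ≔ true ]) (white i′) ≡ false → on (white i′) ≡ false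
          offs i′ = ≔-true⁻¹ on

        up-white : ∀ {i} → par ws (black u) ≡ just (white i) → Inv (suc m) v (white i) ws (on [ black u ≔ false ]) loc
        up-white {i} p = record
          { tree = subst (λ x → Tree (suc m) (white i) ws (on [ x ≔ false ])) cur≡ (tree-up tree (trans (cong (par ws) cur≡) p))
          ; ends = ends
          ; alt  = subst (Alternate (white i)) (sym cur≡) tt ∷ alt
          ; slotsInv = λ i′ i′∈ → let i∈′ = seen i′∈ in slots-keep (slotsInv i′ i∈′) (λ u → kids-other {white i} black≢white)
              (λ o → SlotsInv.last-off (slotsInv i′ i∈′) (trans (sym (≔-miss on (black≢white ∘ sym))) o))
              (λ a lt o → SlotsInv.last-on (slotsInv i′ i∈′) a lt (ons _ o))
          ; at-white = λ { _ refl → let a , lt , e = SlotsInv.children (slotsInv i i∈) u p in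
              w , cong (_∷ w) (trans cur≡ (cong inj₁ (trans (sym e) (cong (label (loc i))
                (sym (SlotsInv.last-on (slotsInv i i∈) a lt (subst (λ x → on x ≡ true) (trans cur≡ (cong inj₁ (sym e))) cur-on))))))) }
          }
          where
          i∈ = proj₂ (par⇒∈ ws p)
          seen : ∀ {x} → x ∈ˡ white i ∷ ws → x ∈ˡ ws
          seen (here refl) = i∈
          seen (there x∈)  = x∈
          ons : ∀ x → (on [ inj₁ u ≔ false ]) x ≡ true → on x ≡ true
          ons x = proj₂ ∘ ≔-false⁻¹ on

      module _ {i} (cur≡ : cur ≡ white i) where

        private
          s  = loc i
          i∈ : white i ∈ˡ ws
          i∈ = here (sym cur≡)
          open SlotsInv (slotsInv i i∈)
          child-not-on : ∀ a → suc a < count s → on (black (label s (suc a))) ≢ true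
          child-not-on a lt o = cur-top o (trans (child a lt) (cong just (sym cur≡)))

        new-black : ∀ {u} → black u ∉ˡ ws →
          Inv (suc m) v (black u) ws (on [ black u ≔ true ]) (loc [ i ≔ˢ slots (suc (count s)) (count s) (label s [ count s ≔ᴺ u ]) ])
        new-black {u} u∉ = record
          { tree = tree-new tree u∉ (s≤s z≤n)
          ; ends = ends
          ; alt  = subst (Alternate (black u)) (sym cur≡) tt ∷ alt
          ; slotsInv = si
          ; at-white = λ { _ () }
          }
          where
          lab = label s [ count s ≔ᴺ u ]
          lab-old : ∀ {a} → a < count s → lab a ≡ label s a
          lab-old {a} lt rewrite dec-false (a ℕ.≟ count s) (ℕ.<⇒≢ lt) = refl
          lab-new : lab (count s) ≡ u
          lab-new rewrite dec-true (count s ℕ.≟ count s) refl = refl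
          view : ∀ {a} → a < suc (count s) → a ≡ count s ⊎ a < count s
          view (s≤s le) with ℕ.m≤n⇒m<n∨m≡n le
          ... | inj₁ lt = inj₂ lt
          ... | inj₂ e  = inj₁ e
          label≢u : ∀ {a} → a < count s → label s a ≢ u
          label≢u lt e = u∉ (subst (λ x → black x ∈ˡ ws) e (label-seen _ lt))
          pos : ∃ λ k → suc k ≡ count s
          pos with count s | last<
          ... | suc k | _ = k , refl
          si : ∀ i′ → white i′ ∈ˡ black u ∷ ws → SlotsInv (black u ∷ ws) (on [ black u ≔ true ]) i′ ((loc [ i ≔ˢ slots (suc (count s)) (count s) lab ]) i′)
          si i′ (there i′∈) with i′ Fin.≟ i
          ... | no ne = slots-keep (slotsInv i′ i′∈) kids
            (λ o → SlotsInv.last-off (slotsInv i′ i′∈) (trans (sym (≔-miss on (black≢white ∘ sym))) o))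
            (λ a lt o → SlotsInv.last-on (slotsInv i′ i′∈) a lt (trans (sym (≔-miss on
               λ { refl → u∉ (SlotsInv.label-seen (slotsInv i′ i′∈) (suc a) lt) })) o))
            where
            kids : ∀ u′ → par (black u ∷ ws) (black u′) ≡ just (white i′) → par ws (black u′) ≡ just (white i′)
            kids u′ q with par-view (black u) cur w (black u′)
            ... | old _ e = trans (sym e) q
            ... | new _ refl e = contradiction (inj₂-injective (trans (just-injective (trans (sym q) e)) cur≡)) ne
            ... | absent _ e with () ← trans (sym e) q
          ... | yes refl = record
            { last< = ≤-refl
            ; parent = trans (par-old (black u) cur w i∈) (trans parent (cong (just ∘ inj₁) (sym (lab-old (≤-trans (s≤s z≤n) last<)))))
            ; child = kid
            ; children = kids
            ; label-inj = λ lt lt′ → inj (view lt) (view lt′)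
            ; last-off = λ o → contradiction (trans (sym (≔-miss on (black≢white ∘ sym))) o) (true≢false (trans (cong on (sym cur≡)) cur-on))
            ; last-on = ons
            }
            where
            kid : ∀ a → suc a < suc (count s) → par (black u ∷ ws) (black (lab (suc a))) ≡ just (white i)
            kid a lt with view lt
            ... | inj₁ e  = trans (cong (par (black u ∷ ws) ∘ inj₁) (trans (cong lab e) lab-new)) (trans (par-new (black u) cur w u∉) (cong just cur≡))
            ... | inj₂ lt′ = trans (cong (par (black u ∷ ws) ∘ inj₁) (lab-old lt′)) (trans (par-old (black u) cur w (label-seen _ lt′)) (child a lt′))
            kids : ∀ u′ → par (black u ∷ ws) (black u′) ≡ just (white i) → ∃ λ a → suc a < suc (count s) × lab (suc a) ≡ u′
            kids u′ q with par-view (black u) cur w (black u′)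
            ... | old _ e = let a , lt , e′ = children u′ (trans (sym e) q) in a , ℕ.m<n⇒m<1+n lt , trans (lab-old lt) e′
            ... | new _ refl e = proj₁ pos , s≤s (≤-reflexive (proj₂ pos)) , trans (cong lab (proj₂ pos)) lab-new
            ... | absent _ e with () ← trans (sym e) q
            inj : ∀ {a b} → a ≡ count s ⊎ a < count s → b ≡ count s ⊎ b < count s → lab a ≡ lab b → a ≡ b
            inj (inj₁ p) (inj₁ q) e = trans p (sym q)
            inj (inj₁ p) (inj₂ q) e = contradiction (trans (sym (lab-old q)) (trans (sym e) (trans (cong lab p) lab-new))) (label≢u q)
            inj (inj₂ p) (inj₁ q) e = contradiction (trans (sym (lab-old p)) (trans e (trans (cong lab q) lab-new))) (label≢u p)
            inj (inj₂ p) (inj₂ q) e = label-inj p q (trans (sym (lab-old p)) (trans e (lab-old q)))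
            ons : ∀ a → suc a < suc (count s) → (on [ black u ≔ true ]) (black (lab (suc a))) ≡ true → count s ≡ suc a
            ons a lt o with view lt
            ... | inj₁ e = sym e
            ... | inj₂ lt′ = contradiction (trans (sym (≔-miss on (λ e → label≢u lt′ (trans (sym (lab-old lt′)) (inj₁-injective e))))) o)
                               (λ o′ → child-not-on a lt′ (trans (cong (on ∘ inj₁) (sym (lab-old lt′))) o′))

        child-black : ∀ a → suc a < count s → steps ws (white i) (black (label s (suc a))) < suc m →
          Inv (suc m) v (black (label s (suc a))) ws (on [ black (label s (suc a)) ≔ true ]) (loc [ i ≔ˢ slots (count s) (suc a) (label s) ])
        child-black a lt room = record
          { tree = tree-down tree (trans (child a lt) (cong just (sym cur≡))) (subst (λ x → steps ws x y < suc m) (sym cur≡) room)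
          ; ends = ends
          ; alt  = subst (Alternate y) (sym cur≡) tt ∷ alt
          ; slotsInv = si
          ; at-white = λ { _ () }
          }
          where
          y = black (label s (suc a))
          y∈ = label-seen (suc a) lt
          si : ∀ i′ → white i′ ∈ˡ y ∷ ws → SlotsInv (y ∷ ws) (on [ y ≔ true ]) i′ ((loc [ i ≔ˢ slots (count s) (suc a) (label s) ]) i′)
          si i′ (there i′∈) with i′ Fin.≟ i
          ... | no ne = slots-keep (slotsInv i′ i′∈) (λ u → kids-seen y∈)
            (λ o → SlotsInv.last-off (slotsInv i′ i′∈) (trans (sym (≔-miss on (black≢white ∘ sym))) o))
            (λ b lt′ o → SlotsInv.last-on (slotsInv i′ i′∈) b lt′ (trans (sym (≔-miss on λ e → ne (inj₂-injective (just-injective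
               (trans (sym (SlotsInv.child (slotsInv i′ i′∈) b lt′)) (trans (cong (par ws) e) (child a lt))))))) o))
          ... | yes refl = record
            { last< = lt
            ; parent = trans (par-old y cur w i∈) parent
            ; child = λ b lt′ → trans (par-old y cur w (label-seen _ lt′)) (child b lt′)
            ; children = λ u q → children u (kids-seen y∈ q)
            ; label-inj = label-inj
            ; last-off = λ o → contradiction (trans (sym (≔-miss on (black≢white ∘ sym))) o) (true≢false (trans (cong on (sym cur≡)) cur-on))
            ; last-on = ons
            }
            where
            ons : ∀ b → suc b < count s → (on [ y ≔ true ]) (black (label s (suc b))) ≡ true → suc a ≡ suc b
            ons b lt′ o with suc a ℕ.≟ suc b
            ... | yes e = e
            ... | no ne = contradiction (trans (sym (≔-miss on (λ e → ne (sym (label-inj lt′ lt (inj₁-injective e)))))) o) (child-not-on b lt′)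

        parent-black : Inv (suc m) v (black (label s 0)) ws (on [ white i ≔ false ]) (loc [ i ≔ˢ slots (count s) 0 (label s) ])
        parent-black = record
          { tree = subst (λ x → Tree (suc m) y ws (on [ x ≔ false ])) cur≡ (tree-up tree (trans (cong (par ws) cur≡) parent))
          ; ends = ends
          ; alt  = subst (Alternate y) (sym cur≡) tt ∷ alt
          ; slotsInv = si
          ; at-white = λ { _ () }
          }
          where
          y = black (label s 0)
          y∈ = label-seen 0 (≤-trans (s≤s z≤n) last<)
          ons : ∀ x → (on [ white i ≔ false ]) x ≡ true → on x ≡ true
          ons x = proj₂ ∘ ≔-false⁻¹ on
          si : ∀ i′ → white i′ ∈ˡ y ∷ ws → SlotsInv (y ∷ ws) (on [ white i ≔ false ]) i′ ((loc [ i ≔ˢ slots (count s) 0 (label s) ]) i′)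
          si i′ (there i′∈) with i′ Fin.≟ i
          ... | no ne = slots-keep (slotsInv i′ i′∈) (λ u → kids-seen y∈)
            (λ o → SlotsInv.last-off (slotsInv i′ i′∈) (trans (sym (≔-miss on (ne ∘ inj₂-injective))) o))
            (λ b lt′ o → SlotsInv.last-on (slotsInv i′ i′∈) b lt′ (ons _ o))
          ... | yes refl = record
            { last< = ≤-trans (s≤s z≤n) last<
            ; parent = trans (par-old y cur w i∈) parent
            ; child = λ b lt′ → trans (par-old y cur w (label-seen _ lt′)) (child b lt′)
            ; children = λ u q → children u (kids-seen y∈ q)
            ; label-inj = label-inj
            ; last-off = λ _ → refl
            ; last-on = λ b lt′ o → contradiction (ons _ o) (child-not-on b lt′)
            }

  -- Counting exits

  bump : (ℕ → ℕ) → ℕ → ℕ → ℕ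
  bump es a b = if does (b ℕ.≟ a) then suc (es b) else es b

  bump-hit : ∀ es a → bump es a a ≡ suc (es a)
  bump-hit es a rewrite dec-true (a ℕ.≟ a) refl = refl

  bump-miss : ∀ es {a b} → b ≢ a → bump es a b ≡ es b
  bump-miss es {a} {b} ne rewrite dec-false (b ℕ.≟ a) ne = refl

  -- The black vertices of a hyperedge are numbered in the order of their
  -- discovery, the parent being 0.  Q k j l es counts the ways to continue the
  -- sequence of exits from the hyperedge by k - 1 exits, when j vertices are known,
  -- the last exit was to l and vertex a has been left to es a times.
  module LocalCount (r m : ℕ) where

    Final : (j l : ℕ) → (ℕ → ℕ) → Set
    Final j l es = (l ≡ 0) × (j ≡ suc r) × (∀ (a : Fin j) → es (toℕ a) ≡ m)

    final? : ∀ j l es → Dec (Final j l es)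
    final? j l es = (l ℕ.≟ 0) ×-dec (j ℕ.≟ suc r) ×-dec Fin.all? λ a → es (toℕ a) ℕ.≟ m

    legal? : ∀ (l : ℕ) (es : ℕ → ℕ) a → Dec (a ≢ l × es a < m)
    legal? l es a = ¬? (a ℕ.≟ l) ×-dec (es a ℕ.<? m)

    Q : ℕ → (j l : ℕ) → (ℕ → ℕ) → ℕ
    Qknown : ℕ → (j l : ℕ) → (ℕ → ℕ) → ℕ → ℕ
    -- The shift by one reserves the value 0 for a hyperedge that was left too often, where the
    -- truncated number of remaining exits would otherwise look like the end.
    Q zero          j l es = 0
    Q (suc zero)    j l es = ind (final? j l es)
    Q (suc (suc k)) j l es = sum {j} (λ a → Qknown (suc k) j l es (toℕ a))
                             -- A discovery counts once, whichever vertex is discovered: its name is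
                             -- accounted for by the factorial of the number of unseen vertices.
                             + Q (suc k) (suc j) j (es [ j ≔ᴺ 1 ])
    Qknown k j l es a = ind (legal? l es a) * Q k j a (bump es a)

    Q-cong : ∀ k j l {es es′} → (∀ a → a < j → es a ≡ es′ a) → Q k j l es ≡ Q k j l es′
    Q-cong zero j l eq = refl
    Q-cong (suc zero) j l {es} {es′} eq = ind-cong (final? j l es) (final? j l es′)
      (λ (p , q , f) → p , q , λ a → trans (sym (eq (toℕ a) (Fin.toℕ<n a))) (f a))
      (λ (p , q , f) → p , q , λ a → trans (eq (toℕ a) (Fin.toℕ<n a)) (f a))
    Q-cong (suc (suc k)) j l {es} {es′} eq = cong₂ _+_
      (sum-cong-≗ {j} λ a → cong₂ _*_
        (ind-cong (legal? l es (toℕ a)) (legal? l es′ (toℕ a))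
          (λ (p , q) → p , subst (_< m) (eq (toℕ a) (Fin.toℕ<n a)) q)
          (λ (p , q) → p , subst (_< m) (sym (eq (toℕ a) (Fin.toℕ<n a))) q))
        (Q-cong (suc k) j (toℕ a) λ b lt → bump-cong (toℕ a) b (eq b lt)))
      (Q-cong (suc k) (suc j) j set-cong)
      where
      bump-cong : ∀ a b → es b ≡ es′ b → bump es a b ≡ bump es′ a b
      bump-cong a b e with b ℕ.≟ a
      ... | yes refl = trans (bump-hit es a) (trans (cong suc e) (sym (bump-hit es′ a)))
      ... | no ne    = trans (bump-miss es ne) (trans e (sym (bump-miss es′ ne)))
      set-cong : ∀ a → a < suc j → (es [ j ≔ᴺ 1 ]) a ≡ (es′ [ j ≔ᴺ 1 ]) a
      set-cong a (s≤s le) with ℕ.m≤n⇒m<n∨m≡n le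
      ... | inj₂ refl rewrite dec-true (a ℕ.≟ a) refl = refl
      ... | inj₁ lt rewrite dec-false (a ℕ.≟ j) (ℕ.<⇒≢ lt) = eq a lt

    -- If no exits remain, both sides are 0 unless the sequence is final. This extends the
    -- recurrence to every hyperedge at which the walk stands, since an exit to the parent is still
    -- due there.
    Q-unfold : ∀ k j l es → (k ≡ 1 → ¬ Final j l es) →
               Q k j l es ≡ sum {j} (λ a → Qknown (k ∸ 1) j l es (toℕ a)) + Q (k ∸ 1) (suc j) j (es [ j ≔ᴺ 1 ])
    Q-unfold zero j l es nf = sym (trans (ℕ.+-identityʳ _) (sum-0 {j} λ a → ℕ.*-zeroʳ (ind (legal? l es (toℕ a)))))
    Q-unfold (suc zero) j l es nf = trans (ind-no (final? j l es) (nf refl))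
      (sym (trans (ℕ.+-identityʳ _) (sum-0 {j} λ a → ℕ.*-zeroʳ (ind (legal? l es (toℕ a))))))
    Q-unfold (suc (suc k)) j l es nf = refl

    -- The number of known vertices never decreases, and a final sequence has exactly r + 1.
    Q-overfull : ∀ k j l es → suc r < j → Q k j l es ≡ 0
    Q-overfull zero j l es lt = refl
    Q-overfull (suc zero) j l es lt = ind-no (final? j l es) λ (_ , e , _) → ℕ.<⇒≢ lt (sym e)
    Q-overfull (suc (suc k)) j l es lt = cong₂ _+_
      (sum-0 {j} λ a → trans (cong (ind (legal? l es (toℕ a)) *_) (Q-overfull (suc k) j (toℕ a) _ lt)) (ℕ.*-zeroʳ (ind (legal? l es (toℕ a)))))
      (Q-overfull (suc k) (suc j) j _ (ℕ.m<n⇒m<1+n lt))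

    -- A sequence of exits must end with an exit to the parent.
    Q-parent-exhausted : ∀ k j l es → 0 < j → es 0 ≡ m → l ≢ 0 ⊎ k ≢ 1 → Q k j l es ≡ 0
    Q-parent-exhausted zero j l es pos e n = refl
    Q-parent-exhausted (suc zero) j l es pos e (inj₁ l≢0) = ind-no (final? j l es) λ (p , _) → l≢0 p
    Q-parent-exhausted (suc zero) j l es pos e (inj₂ ne) = contradiction refl ne
    Q-parent-exhausted (suc (suc k)) j l es pos e n = cong₂ _+_
      (sum-0 {j} λ a → known (λ b → Q-parent-exhausted (suc k) j (suc b) (bump es (suc b)) pos e (inj₁ λ ())) (toℕ a))
      (Q-parent-exhausted (suc k) (suc j) j _ (s≤s z≤n) set (inj₁ (ℕ.>⇒≢ pos)))
      where
      set : (es [ j ≔ᴺ 1 ]) 0 ≡ m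
      set rewrite dec-false (0 ℕ.≟ j) (ℕ.<⇒≢ pos) = e
      known : (∀ b → Q (suc k) j (suc b) (bump es (suc b)) ≡ 0) → ∀ a → Qknown (suc k) j l es a ≡ 0
      known ih zero = cong (_* Q (suc k) j 0 (bump es 0)) (ind-no (legal? l es 0) λ (_ , lt) → ℕ.<⇒≢ lt e)
      known ih (suc a) = trans (cong (ind (legal? l es (suc a)) *_) (ih a)) (ℕ.*-zeroʳ (ind (legal? l es (suc a))))

  -- Remaining crossings, and how one step changes them.

  module _ {N n : ℕ} where


    -- The current vertex, at the head of the list, has not been left yet; therefore the head is not
    -- counted.
    exits : List (Vertex N n) → Fin n → ℕ
    exits []          i = 0
    exits (y ∷ [])    i = 0
    exits (y ∷ x ∷ w) i = ind (x ≟ᵛ white i) + exits (x ∷ w) i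

    exitsTo : List (Vertex N n) → Fin n → Slots {N} {n} → ℕ → ℕ
    exitsTo ws i s a = steps ws (white i) (black (label s a))

    module Residuals (m : ℕ) where

      -- The number of steps from u to its parent that remain, the root having a
      -- fictitious one that ends the walk.
      abstract

        ups : List (Vertex N n) → Fin N → ℕ
        ups ws u with par ws (black u)
        ... | nothing = 1
        ... | just z  = m ∸ steps ws (black u) z

        downs : List (Vertex N n) → Fin N → Fin n → ℕ
        downs ws u i = ind (par ws (white i) ≟ᴹ just (black u)) * (m ∸ steps ws (black u) (white i))

        ups-root : ∀ {ws u} → par ws (black u) ≡ nothing → ups ws u ≡ 1
        ups-root e rewrite e = refl

        ups-just : ∀ {ws u z} → par ws (black u) ≡ just z → ups ws u ≡ m ∸ steps ws (black u) z
        ups-just e rewrite e = refl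

        downs-yes : ∀ {ws u i} → par ws (white i) ≡ just (black u) → downs ws u i ≡ m ∸ steps ws (black u) (white i)
        downs-yes {ws} {u} {i} p = trans (cong (_* (m ∸ steps ws (black u) (white i))) (ind-yes (par ws (white i) ≟ᴹ just (black u)) p)) (ℕ.*-identityˡ (m ∸ steps ws (black u) (white i)))

        downs-no : ∀ {ws u i} → par ws (white i) ≢ just (black u) → downs ws u i ≡ 0
        downs-no {ws} {u} {i} p = cong (_* (m ∸ steps ws (black u) (white i))) (ind-no (par ws (white i) ≟ᴹ just (black u)) p)

      ups-cong : ∀ {ws ws′ u} → par ws (black u) ≡ par ws′ (black u) →
                 (∀ z → par ws (black u) ≡ just z → steps ws (black u) z ≡ steps ws′ (black u) z) → ups ws u ≡ ups ws′ u
      ups-cong {ws} {ws′} {u} e f = go (par ws (black u)) refl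
        where
        go : ∀ q → par ws (black u) ≡ q → ups ws u ≡ ups ws′ u
        go nothing  p = trans (ups-root p) (sym (ups-root (trans (sym e) p)))
        go (just z) p = trans (ups-just p) (trans (cong (m ∸_) (f z p)) (sym (ups-just (trans (sym e) p))))

      downs-cong : ∀ {ws ws′ u i} → (par ws (white i) ≡ just (black u) → par ws′ (white i) ≡ just (black u)) →
                   (par ws′ (white i) ≡ just (black u) → par ws (white i) ≡ just (black u)) →
                   (par ws (white i) ≡ just (black u) → steps ws (black u) (white i) ≡ steps ws′ (black u) (white i)) →
                   downs ws u i ≡ downs ws′ u i
      downs-cong {ws} {ws′} {u} {i} f g h = go (par ws (white i) ≟ᴹ just (black u))
        where
        go : Dec (par ws (white i) ≡ just (black u)) → downs ws u i ≡ downs ws′ u i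
        go (yes p) = trans (downs-yes p) (trans (cong (m ∸_) (h p)) (sym (downs-yes (f p))))
        go (no ¬p) = trans (downs-no ¬p) (sym (downs-no (¬p ∘ g)))

      module Step (x : Vertex N n) (w : List (Vertex N n)) (y : Vertex N n) where

        private
          ws : List (Vertex N n)
          ws = x ∷ w

        par-back : ∀ {p z} → z ≢ x → par (y ∷ ws) p ≡ just z → par ws p ≡ just z
        par-back {p} z≢x q with par-view y x w p
        ... | old _ e    = trans (sym e) q
        ... | new _ _ e  = contradiction (just-injective (trans (sym q) e)) z≢x
        ... | absent _ e with () ← trans (sym e) q

        par-forth : ∀ {p z} → par ws p ≡ just z → par (y ∷ ws) p ≡ just z
        par-forth q = trans (par-old y x w (proj₁ (par⇒∈ ws q))) q

        ups-keep : ∀ {u} → black u ∈ˡ ws → black u ≢ x → ups (y ∷ ws) u ≡ ups ws u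
        ups-keep u∈ u≢x = ups-cong {y ∷ ws} {ws} (par-old y x w u∈) λ z _ → steps-miss y x w (inj₁ u≢x)

        downs-keep : ∀ {u i} → black u ≢ x → downs (y ∷ ws) u i ≡ downs ws u i
        downs-keep {u} {i} u≢x = downs-cong {y ∷ ws} {ws} (par-back u≢x) par-forth
          λ _ → steps-miss y x w (inj₁ u≢x)

        exits-keep : ∀ {i} → x ≢ white i → exits (y ∷ ws) i ≡ exits ws i
        exits-keep {i} ne = cong (_+ exits ws i) (ind-no (x ≟ᵛ white i) ne)

        exits-step : ∀ {i} → x ≡ white i → exits (y ∷ ws) i ≡ suc (exits ws i)
        exits-step {i} e = cong (_+ exits ws i) (ind-yes (x ≟ᵛ white i) e)

        par-keep : ∀ {p} → p ≢ y → par (y ∷ ws) p ≡ par ws p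
        par-keep {p} p≢y with par-view y x w p
        ... | old _ e = e
        ... | new _ e _ = contradiction e p≢y
        ... | absent p∉ e = trans e (sym (unseen p (p∉ ∘ there)))
          where
          unseen : ∀ p → ¬ p ∈ˡ ws → par ws p ≡ nothing
          unseen p p∉ with par ws p in eq
          ... | nothing = refl
          ... | just _  = contradiction (proj₁ (par⇒∈ ws eq)) p∉

      module BlackStep (u : Fin N) (w : List (Vertex N n)) (i : Fin n) where

        private
          ws ws′ : List (Vertex N n)
          ws  = black u ∷ w
          ws′ = white i ∷ ws

        downs-other : ∀ {i′} → i′ ≢ i → downs ws′ u i′ ≡ downs ws u i′
        downs-other {i′} ne = downs-cong {ws′} {ws} (trans (sym e)) (trans e)
          λ _ → steps-miss (white i) (black u) w (inj₂ (ne ∘ inj₂-injective))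
          where
          e = Step.par-keep (black u) w (white i) {white i′} (ne ∘ inj₂-injective)

        par-u : par ws′ (black u) ≡ par ws (black u)
        par-u = Step.par-keep (black u) w (white i) λ ()

        ups-other : par ws (black u) ≢ just (white i) → ups ws′ u ≡ ups ws u
        ups-other ne = ups-cong {ws′} {ws} par-u λ z p → steps-miss (white i) (black u) w
          (inj₂ λ { refl → ne (trans (sym par-u) p) })

        module Up (p : par ws (black u) ≡ just (white i)) (room : steps ws (black u) (white i) < m) where

          ups-up : ups ws u ≡ suc (ups ws′ u)
          ups-up = begin
            ups ws u                                  ≡⟨ ups-just {ws} p ⟩
            m ∸ steps ws (black u) (white i)          ≡⟨ ℕ.+-∸-assoc 1 room ⟩
            suc (m ∸ suc (steps ws (black u) (white i))) ≡⟨ cong (λ k → suc (m ∸ k)) (steps-hit (white i) (black u) w) ⟨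
            suc (m ∸ steps ws′ (black u) (white i))   ≡⟨ cong suc (ups-just {ws′} (trans par-u p)) ⟨
            suc (ups ws′ u)                           ∎
            where open ≡-Reasoning

          downs-up : ∀ i′ → downs ws′ u i′ ≡ downs ws u i′
          downs-up i′ = go (i′ Fin.≟ i)
            where
            go : Dec (i′ ≡ i) → downs ws′ u i′ ≡ downs ws u i′
            go (no ne)    = downs-other ne
            go (yes refl) = trans (downs-no {ws′} λ q → par-acyclic₂ ws′ (trans par-u p) q)
                                  (sym (downs-no {ws} λ q → par-acyclic₂ ws p q))

        module Down (p : par ws (white i) ≡ just (black u)) (room : steps ws (black u) (white i) < m) where

          downs-down : downs ws u i ≡ suc (downs ws′ u i)
          downs-down = begin
            downs ws u i                              ≡⟨ downs-yes {ws} p ⟩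
            m ∸ steps ws (black u) (white i)          ≡⟨ ℕ.+-∸-assoc 1 room ⟩
            suc (m ∸ suc (steps ws (black u) (white i))) ≡⟨ cong (λ k → suc (m ∸ k)) (steps-hit (white i) (black u) w) ⟨
            suc (m ∸ steps ws′ (black u) (white i))   ≡⟨ cong suc (downs-yes {ws′} (Step.par-forth (black u) w (white i) p)) ⟨
            suc (downs ws′ u i)                       ∎
            where open ≡-Reasoning

          ups-down : ups ws′ u ≡ ups ws u
          ups-down = ups-other λ q → par-acyclic₂ ws p q

        module New (i∉ : white i ∉ˡ ws) where

          private
            unseen-steps : ∀ {a} → steps ws a (white i) ≡ 0
            unseen-steps {a} with steps ws a (white i) in eq
            ... | zero  = refl
            ... | suc _ = contradiction (proj₂ (steps⇒∈ ws a (white i) (subst (0 <_) (sym eq) (s≤s z≤n)))) i∉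

          -- The step that discovers i is already the first of its m entries from u.
          downs-new : downs ws′ u i ≡ m ∸ 1
          downs-new = trans (downs-yes {ws′} (par-new (white i) (black u) w i∉))
            (cong (m ∸_) (trans (steps-hit (white i) (black u) w) (cong suc unseen-steps)))

          downs-before : downs ws u i ≡ 0
          downs-before = downs-no {ws} λ q → i∉ (proj₁ (par⇒∈ ws q))

          ups-new : ups ws′ u ≡ ups ws u
          ups-new = ups-other λ q → i∉ (proj₂ (par⇒∈ ws q))

    exits-unseen : ∀ ws {i} → white i ∉ˡ ws → exits ws i ≡ 0
    exits-unseen [] i∉ = refl
    exits-unseen (y ∷ []) i∉ = refl
    exits-unseen (y ∷ x ∷ w) {i} i∉ = cong₂ _+_ (ind-no (x ≟ᵛ white i) λ { refl → i∉ (there (here refl)) }) (exits-unseen (x ∷ w) (i∉ ∘ there))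

    abstract

      unseen : List (Vertex N n) → Vertex N n → ℕ
      unseen ws x = ind (¬? (x ∈? ws))

      unseen-∉ : ∀ {ws x} → x ∉ˡ ws → unseen ws x ≡ 1
      unseen-∉ {ws} {x} = ind-yes (¬? (x ∈? ws))

      unseen-∈ : ∀ {ws x} → x ∈ˡ ws → unseen ws x ≡ 0
      unseen-∈ {ws} {x} x∈ = ind-no (¬? (x ∈? ws)) λ x∉ → x∉ x∈

    unseen-keep : ∀ {ws x y} → (x ≢ y ⊎ y ∈ˡ ws) → unseen (y ∷ ws) x ≡ unseen ws x
    unseen-keep {ws} {x} {y} h with x ∈? ws
    ... | yes x∈ = trans (unseen-∈ (there x∈)) (sym (unseen-∈ x∈))
    ... | no x∉  = trans (unseen-∉ (λ { (here refl) → not h ; (there x∈) → x∉ x∈ })) (sym (unseen-∉ x∉))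
      where
      not : ¬ (x ≢ x ⊎ x ∈ˡ ws)
      not (inj₁ ne) = ne refl
      not (inj₂ x∈) = x∉ x∈

    unseen-new : ∀ {ws x} → x ∉ˡ ws → unseen ws x ≡ suc (unseen (x ∷ ws) x)
    unseen-new {ws} {x} x∉ = trans (unseen-∉ x∉) (cong suc (sym (unseen-∈ {x ∷ ws} (here refl))))

  Fin-choice : ∀ {k} {Z : Set} {P : Fin k → Set} → (∀ i → Z ⊎ P i) → Z ⊎ (∀ i → P i)
  Fin-choice {zero}  f = inj₂ λ ()
  Fin-choice {suc k} f with f zero | Fin-choice (f ∘ suc)
  ... | inj₁ z | _      = inj₁ z
  ... | inj₂ _ | inj₁ z = inj₁ z
  ... | inj₂ p | inj₂ q = inj₂ λ { zero → p ; (suc i) → q i }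

  toWitness-does : ∀ {p} {P : Set p} (d : Dec P) → does d ≡ true → P
  toWitness-does (yes p) _ = p

  count-labels : ∀ {N p} {P : Fin N → Set p} (P? : ∀ u → Dec (P u)) (f : ℕ → Fin N) k →
    (∀ {a b} → a < k → b < k → f a ≡ f b → a ≡ b) →
    (∀ u → P u → ∃ λ a → a < k × f a ≡ u) → (∀ a → a < k → P (f a)) → sum (λ u → ind (P? u)) ≡ k
  count-labels {N} {P = P} P? f k inj to from = begin
    sum (λ u → ind (P? u))                                    ≡⟨ sum-cong-≗ point ⟩
    sum (λ u → sum {k} λ a → ind (f (toℕ a) Fin.≟ u))         ≡⟨ ∑-comm {N} {k} (λ u a → ind (f (toℕ a) Fin.≟ u)) ⟩
    sum {k} (λ a → sum λ u → ind (f (toℕ a) Fin.≟ u))         ≡⟨ sum-cong-≗ {k} (λ a → trans (sum-single (f (toℕ a)) (λ u → ind (f (toℕ a) Fin.≟ u))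
                                                                   λ u ne → ind-no (f (toℕ a) Fin.≟ u) (ne ∘ sym)) (ind-yes (f (toℕ a) Fin.≟ f (toℕ a)) refl)) ⟩
    sum {k} (λ _ → 1)                                         ≡⟨ trans (sum-const k 1) (ℕ.*-identityʳ k) ⟩
    k                                                         ∎
    where
    open ≡-Reasoning
    point : ∀ u → ind (P? u) ≡ sum {k} λ a → ind (f (toℕ a) Fin.≟ u)
    point u = go (P? u)
      where
      go : (d : Dec (P u)) → ind d ≡ sum {k} λ a → ind (f (toℕ a) Fin.≟ u)
      go (no ¬p) = sym (sum-0 {k} λ a → ind-no (f (toℕ a) Fin.≟ u) λ { refl → ¬p (from (toℕ a) (Fin.toℕ<n a)) })
      go (yes p) with to u p
      ... | a , lt , refl = sym (trans (sum-single (fromℕ< lt) (λ b → ind (f (toℕ b) Fin.≟ f a))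
              λ b ne → ind-no (f (toℕ b) Fin.≟ f a) λ e → ne (Fin.toℕ-injective (trans (inj (Fin.toℕ<n b) lt e) (sym (Fin.toℕ-fromℕ< lt)))))
            (ind-yes (f (toℕ (fromℕ< lt)) Fin.≟ f a) (cong f (Fin.toℕ-fromℕ< lt))))

  -- Consequences of the invariant for lengths, exits and marks.

  module _ {N n : ℕ} where

    _≟ⱽ_ : (x y : Vertex N n) → Dec (x ≡ y)
    _≟ⱽ_ = _≟ᵛ_

    suffix-linked : ∀ {R : Vertex N n → Vertex N n → Set} p {w} → Linked R (p ++ w) → Linked R w
    suffix-linked [] l = l
    suffix-linked (x ∷ p) l = suffix-linked p (Linked.tail l)

    steps⇒Linked : ∀ {R : Vertex N n → Vertex N n → Set} w → (∀ a b → 0 < steps w a b → R b a) → Linked R w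
    steps⇒Linked [] f = []
    steps⇒Linked (x ∷ []) f = [-]
    steps⇒Linked (y ∷ x ∷ w) f = f x y (subst (0 <_) (sym (steps-hit y x w)) (s≤s z≤n))
      ∷ steps⇒Linked (x ∷ w) λ a b lt → f a b (≤-trans lt (steps-≤ y x w a b))

    NoReturn : List (Vertex N n) → Set
    NoReturn w = ∀ u i → ¬ Infix _≡_ (black u ∷ white i ∷ black u ∷ []) w

    suffix-infix : ∀ p {as w : List (Vertex N n)} → Infix _≡_ as w → Infix _≡_ as (p ++ w)
    suffix-infix []      i = i
    suffix-infix (x ∷ p) i = Infix.there (suffix-infix p i)

    noReturn-white : ∀ {i ws} → NoReturn ws → NoReturn (white i ∷ ws)
    noReturn-white nr u i (Infix.here (() ∷ _))
    noReturn-white nr u i (Infix.there p) = nr u i p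

    noReturn-black : ∀ {u i x w} → x ≢ black u → NoReturn (white i ∷ x ∷ w) → NoReturn (black u ∷ white i ∷ x ∷ w)
    noReturn-black ne nr u i (Infix.here (refl ∷ refl ∷ refl ∷ _)) = ne refl
    noReturn-black ne nr u i (Infix.there p) = nr u i p

    Σexits : List (Vertex N n) → ℕ
    Σexits ws = sum (exits ws)

    -- The colours alternate and every white letter but the current one is an exit. So the length of
    -- the word measures the total number of exits, and its parity is tied to the colour of the
    -- current vertex.
    length-exits : ∀ {y w v} → Linked Alternate (y ∷ w) → List.last (y ∷ w) ≡ just (black v) →
                   (∀ u → y ≡ black u → List.length (y ∷ w) ≡ 1 + (Σexits (y ∷ w) + Σexits (y ∷ w))) ×
                   (∀ i → y ≡ white i → List.length (y ∷ w) ≡ 2 + (Σexits (y ∷ w) + Σexits (y ∷ w)))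
    length-exits {y} {[]} l refl = (λ u _ → sym (cong (λ k → suc (k + k)) (sum-0 {n} λ _ → refl))) , λ { i () }
    length-exits {black u} {white i ∷ w} (_ ∷ l) e with proj₂ (length-exits l e) i refl
    ... | len = (λ _ _ → trans (cong suc len) (sym (cong suc (trans (cong₂ _+_ step step) (cong suc (ℕ.+-suc _ _)))))) , λ { _ () }
      where
      step : Σexits (black u ∷ white i ∷ w) ≡ suc (Σexits (white i ∷ w))
      step = trans (∑-distrib-+ (λ i′ → ind (white i ≟ⱽ white i′)) (exits (white i ∷ w)))
        (cong (_+ Σexits (white i ∷ w)) (trans (sum-single i (λ i′ → ind (white i ≟ⱽ white i′))
          λ i′ ne → ind-no (white i ≟ⱽ white i′) (ne ∘ sym ∘ inj₂-injective)) (ind-yes (white i ≟ⱽ white i) refl)))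
    length-exits {white i} {black u ∷ w} (_ ∷ l) e with proj₁ (length-exits l e) u refl
    ... | len = (λ { _ () }) , λ _ _ → trans (cong suc len) (cong (λ k → 2 + (k + k)) (sum-cong-≗ {n} λ i′ → refl))

    exits-sum : ∀ {w} → Linked Alternate w → ∀ i → exits w i ≡ sum (λ u → steps w (white i) (black u))
    exits-sum {[]} l i = sym (sum-0 {N} λ u → refl)
    exits-sum {y ∷ []} l i = sym (sum-0 {N} λ u → refl)
    exits-sum {white i′ ∷ black u′ ∷ w} (_ ∷ l) i = trans (exits-sum l i)
      (sum-cong-≗ {N} λ u → sym (steps-miss (white i′) (black u′) w {white i} {black u} (inj₁ λ ())))
    exits-sum {black u′ ∷ white i′ ∷ w} (_ ∷ l) i = go (i′ Fin.≟ i)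
      where
      go : Dec (i′ ≡ i) → exits (black u′ ∷ white i′ ∷ w) i ≡ sum (λ u → steps (black u′ ∷ white i′ ∷ w) (white i) (black u))
      go (yes refl) = trans (cong₂ _+_ (ind-yes (white i ≟ⱽ white i) refl) (exits-sum l i))
        (sym (sum-suc u′ (steps-hit (black u′) (white i) w) λ u ne → steps-miss (black u′) (white i) w (inj₂ (ne ∘ inj₁-injective))))
      go (no ne) = trans (cong₂ _+_ (ind-no (white i′ ≟ⱽ white i) (ne ∘ inj₂-injective)) (exits-sum l i))
        (sum-cong-≗ {N} λ u → sym (steps-miss (black u′) (white i′) w (inj₁ (ne ∘ sym ∘ inj₂-injective))))

    exits>0⇒∈ : ∀ (w : List (Vertex N n)) i → 0 < exits w i → white i ∈ˡ w
    exits>0⇒∈ w i lt with white i ∈? w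
    ... | yes p = p
    ... | no ¬p with () ← subst (0 <_) (exits-unseen w ¬p) lt

    module Facts {m} {v : Fin N} {cur : Vertex N n} {w on loc} (inv : Inv (suc m) v cur w on loc) where
      open Inv inv
      open Tree tree

      private
        ws : List (Vertex N n)
        ws = cur ∷ w

      v-root : ∀ {x} → x ∈ˡ ws → par ws x ≡ nothing → x ≡ black v
      v-root x∈ e = par-nothing ws x∈ ends e

      kids : Fin n → ℕ
      kids i = sum λ u → ind (par ws (black u) ≟ᴹ just (white i))

      kids-seen : ∀ i → white i ∈ˡ ws → kids i ≡ count (loc i) ∸ 1
      kids-seen i i∈ = count-labels (λ u → par ws (black u) ≟ᴹ just (white i)) (label (loc i) ∘ suc) (count (loc i) ∸ 1)
        (λ lt lt′ e → ℕ.suc-injective (label-inj (up lt) (up lt′) e))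
        (λ u p → let a , lt , e = children u p in a , down lt , e)
        (λ a lt → child a (up lt))
        where
        open SlotsInv (slotsInv i i∈)
        up : ∀ {a k} → a < k ∸ 1 → suc a < k
        up {k = suc k} lt = s≤s lt
        down : ∀ {a k} → suc a < k → a < k ∸ 1
        down (s≤s lt) = lt

      kids-unseen : ∀ i → white i ∉ˡ ws → kids i ≡ 0
      kids-unseen i i∉ = sum-0 λ u → ind-no (par ws (black u) ≟ᴹ just (white i)) λ q → i∉ (proj₂ (par⇒∈ ws q))

      -- Each black vertex is unseen, or the root v, or the child of exactly one hyperedge.
      count-black : sum (λ u → unseen ws (black u)) + (1 + sum kids) ≡ N
      count-black = begin
        sum (λ u → unseen ws (black u)) + (1 + sum kids)
          ≡⟨ cong (λ k → sum (λ u → unseen ws (black u)) + k) (cong₂ _+_ (sym (sum-ind≡ v)) (∑-comm {n} {N} (λ i u → ind (par ws (black u) ≟ᴹ just (white i))))) ⟩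
        sum (λ u → unseen ws (black u)) + (sum (λ u → ind (u Fin.≟ v)) + sum ups)
          ≡⟨ trans (∑-distrib-+ (λ u → unseen ws (black u)) _) (cong (sum (λ u → unseen ws (black u)) +_) (∑-distrib-+ (λ u → ind (u Fin.≟ v)) ups)) ⟨
        sum (λ u → unseen ws (black u) + (ind (u Fin.≟ v) + ups u))
          ≡⟨ sum-cong-≗ point ⟩
        sum {N} (λ _ → 1)
          ≡⟨ trans (sum-const N 1) (ℕ.*-identityʳ N) ⟩
        N ∎
        where
        open ≡-Reasoning
        ups : Fin N → ℕ
        ups u = sum {n} λ i → ind (par ws (black u) ≟ᴹ just (white i))
        v∈ : ∀ w → List.last w ≡ just (black v) → black v ∈ˡ w
        v∈ (x ∷ [])    refl = here refl
        v∈ (x ∷ y ∷ w) e    = there (v∈ (y ∷ w) e)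
        point : ∀ u → unseen ws (black u) + (ind (u Fin.≟ v) + ups u) ≡ 1
        point u = go (black u ∈? ws) (par ws (black u)) refl
          where
          ups-nothing : par ws (black u) ≡ nothing → ups u ≡ 0
          ups-nothing q = sum-0 {n} λ i → ind-no (par ws (black u) ≟ᴹ just (white i)) λ q′ → case (trans (sym q) q′)
            where
            case : ∀ {x : Vertex N n} → nothing ≢ just x
            case ()
          go : Dec (black u ∈ˡ ws) → ∀ q → par ws (black u) ≡ q → unseen ws (black u) + (ind (u Fin.≟ v) + ups u) ≡ 1
          go (no u∉) nothing q = cong₂ _+_ (unseen-∉ u∉) (cong₂ _+_ (ind-no (u Fin.≟ v) (λ { refl → u∉ (v∈ ws ends) })) (ups-nothing q))
          go (no u∉) (just x) q = contradiction (proj₁ (par⇒∈ ws q)) u∉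
          go (yes u∈) nothing q = cong₂ _+_ (unseen-∈ u∈) (cong₂ _+_ (ind-yes (u Fin.≟ v) (inj₁-injective (v-root u∈ q))) (ups-nothing q))
          go (yes u∈) (just (black x)) q = ⊥-elim (par⇒linked alt q)
          go (yes u∈) (just (white i)) q = cong₂ _+_ (unseen-∈ u∈) (cong₂ _+_ (ind-no (u Fin.≟ v) λ { refl → case (trans (sym q) (par-last ws ends)) })
            (trans (sum-single i (λ i′ → ind (par ws (black u) ≟ᴹ just (white i′))) λ i′ ne → ind-no (par ws (black u) ≟ᴹ just (white i′))
                λ q′ → ne (inj₂-injective (just-injective (trans (sym q′) q))))
              (ind-yes (par ws (black u) ≟ᴹ just (white i)) q)))
            where
            case : ∀ {x : Vertex N n} → just x ≢ nothing
            case ()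

      -- A mark propagates to the parent. At the root nothing below it is marked, hence by induction
      -- nothing else at all, and every edge has been crossed equally often in both directions.
      on-path : ∀ {u} → cur ≡ black u → par ws (black u) ≡ nothing → ∀ {x z} → par ws x ≡ just z → on x ≡ false
      on-path {u} refl q {x} {z} p with off x (proj₁ (par⇒∈ ws p))
        where
        off : ∀ x → x ∈ˡ ws → x ≡ cur ⊎ on x ≡ false
        off = par-ind ws (λ x → x ≡ cur ⊎ on x ≡ false)
          (λ x x∈ e → inj₁ (trans (v-root x∈ e) (sym (v-root (here refl) q))))
          λ { x z e (inj₁ refl) → inj₂ (child-off tree e)
            ; x z e (inj₂ o) → inj₂ (up x z e o) }
          where
          up : ∀ x z → par ws x ≡ just z → on z ≡ false → on x ≡ false
          up x z e o with on x in eq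
          ... | false = refl
          ... | true  = contradiction o (true≢false (on-par eq e))
      ... | inj₂ o = o
      ... | inj₁ refl with () ← trans (sym q) p

  -- Words that are complete at every hyperedge are the walks on hypertrees.

  module Validity (r m′ n : ℕ) where

    private
      N m full : ℕ
      N = suc (r * n)
      m = suc m′
      full = suc r * m

    open LocalCount r m
    open Residuals {N} {n} m

    Remaining : List (Vertex N n) → Fin n → ℕ
    Remaining ws i = suc full ∸ exits ws i

    Complete : List (Vertex N n) → (Fin n → Slots) → Fin n → Set
    Complete ws loc i = exits ws i ≡ full × Final (count (loc i)) (last (loc i)) (exitsTo ws i (loc i))

    complete-at : ∀ ws loc i → Complete ws loc i → ∀ {a} → a < count (loc i) → exitsTo ws i (loc i) a ≡ m
    complete-at ws loc i (_ , _ , _ , f) lt = trans (cong (exitsTo ws i (loc i)) (sym (Fin.toℕ-fromℕ< lt))) (f (fromℕ< lt))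

    module AtRoot {v u : Fin N} {w : List (Vertex N n)} {on loc} (inv : Inv m v (black u) w on loc) (root : par (black u ∷ w) (black u) ≡ nothing) where
      open Inv inv
      open Tree tree
      open Facts inv

      private
        ws : List (Vertex N n)
        ws = black u ∷ w

      off : ∀ {x z} → par ws x ≡ just z → on x ≡ false
      off = on-path refl root

      up-white : ∀ {u′ z} → par ws (black u′) ≡ just z → ∃ λ i → z ≡ white i
      up-white {z = black _} q = ⊥-elim (par⇒linked alt q)
      up-white {z = white i} q = i , refl

      complete⇒ups : ∀ {u′ i} → Complete ws loc i → par ws (black u′) ≡ just (white i) → ups ws u′ ≡ 0
      complete⇒ups {u′} {i} complete q with SlotsInv.children (slotsInv i (proj₂ (par⇒∈ ws q))) u′ q
      ... | a , lt , refl = trans (ups-just q) (trans (cong (m ∸_) (trans (sym (bit-off tree q (off q))) (complete-at ws loc i complete lt))) (ℕ.n∸n≡0 m))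

      complete⇒downs : ∀ {u′ i} → Complete ws loc i → par ws (white i) ≡ just (black u′) → downs ws u′ i ≡ 0
      complete⇒downs {u′} {i} complete q = trans (downs-yes q) (trans (cong (m ∸_) (trans (bit-off tree q (off q))
          (trans (cong (λ x → steps ws (white i) x) (just-injective (trans (sym q) parent))) (complete-at ws loc i complete (≤-trans (s≤s z≤n) last<)))))
          (ℕ.n∸n≡0 m))
        where
        open SlotsInv (slotsInv i (proj₁ (par⇒∈ ws q)))

      -- The two ways in which a factor other than that of the root can vanish: a hyperedge whose
      -- exits cannot be continued, or a vertex without a further exit to its parent that still has
      -- exits to children to make.
      data Dead : Set where
        dead-white : ∀ i → white i ∈ˡ ws → Q (Remaining ws i) (count (loc i)) (last (loc i)) (exitsTo ws i (loc i)) ≡ 0 → Dead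
        dead-black : ∀ u′ → u′ ≢ u → black u′ ∈ˡ ws → ups ws u′ ≡ 0 → sum (downs ws u′) ≢ 0 → Dead

      remaining-1 : ∀ {e} → suc full ∸ e ≡ 1 → e ≡ full
      remaining-1 {e} p with e ℕ.≤? full
      ... | yes le = ℕ.≤-antisym le (ℕ.m∸n≡0⇒m≤n (ℕ.suc-injective (trans (sym (ℕ.+-∸-assoc 1 le)) p)))
      ... | no gt with () ← trans (sym p) (ℕ.m≤n⇒m∸n≡0 (ℕ.≰⇒> gt))

      -- The hyperedges are treated from the root downwards along par.
      dead-or-complete : (∀ i → downs ws u i ≡ 0) → Dead ⊎ (∀ i → white i ∈ˡ ws → Complete ws loc i)
      dead-or-complete spent = Fin-choice {P = λ i → white i ∈ˡ ws → Complete ws loc i} each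
        where
        State : Vertex N n → Set
        State (black u′) = ∀ i → downs ws u′ i ≡ 0
        State (white i)  = Complete ws loc i
        base : ∀ x → x ∈ˡ ws → par ws x ≡ nothing → Dead ⊎ State x
        base x x∈ e with trans (v-root x∈ e) (sym (v-root (here refl) root))
        ... | refl = inj₂ spent
        white-step : ∀ u′ i → par ws (white i) ≡ just (black u′) → State (black u′) → Dead ⊎ State (white i)
        white-step u′ i q zero-downs = go (Remaining ws i ℕ.≟ 1) (final? (count s) (last s) (exitsTo ws i s))
          where
          i∈ = proj₁ (par⇒∈ ws q)
          s = loc i
          open SlotsInv (slotsInv i i∈)
          pos = ≤-trans (s≤s z≤n) last<
          -- No exit from u′ to i remains, so i was entered m times from its parent. As the walk is
          -- at the root, it was also left m times to the parent.
          full-steps : steps ws (black u′) (white i) ≡ m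
          full-steps = ℕ.≤-antisym (cap _ _) (ℕ.m∸n≡0⇒m≤n (trans (sym (downs-yes q)) (zero-downs i)))
          exhausted : exitsTo ws i s 0 ≡ m
          exhausted = trans (cong (steps ws (white i)) (just-injective (trans (sym parent) q)))
                            (trans (sym (bit-off tree q (off q))) full-steps)
          go : Dec (Remaining ws i ≡ 1) → Dec (Final (count s) (last s) (exitsTo ws i s)) → Dead ⊎ Complete ws loc i
          go (yes one) (yes fin) = inj₂ (remaining-1 one , fin)
          go (yes one) (no ¬fin) = inj₁ (dead-white i i∈ (trans (cong (λ k → Q k (count s) (last s) (exitsTo ws i s)) one)
                                           (ind-no (final? (count s) (last s) (exitsTo ws i s)) ¬fin)))
          go (no more) _ = inj₁ (dead-white i i∈ (Q-parent-exhausted (Remaining ws i) (count s) (last s) (exitsTo ws i s) pos exhausted (inj₂ more)))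
        black-step : ∀ u′ i → par ws (black u′) ≡ just (white i) → State (white i) → Dead ⊎ State (black u′)
        black-step u′ i q complete with sum (downs ws u′) ℕ.≟ 0
        ... | yes z = inj₂ λ i′ → ℕ.n≤0⇒n≡0 (≤-trans (f≤sum (downs ws u′) i′) (≤-reflexive z))
        ... | no nz = inj₁ (dead-black u′ (λ { refl → case (trans (sym root) q) }) (proj₁ (par⇒∈ ws q)) (complete⇒ups complete q) nz)
          where
          case : ∀ {x : Vertex N n} → nothing ≢ just x
          case ()
        step : ∀ x z → par ws x ≡ just z → Dead ⊎ State z → Dead ⊎ State x
        step x z q (inj₁ d) = inj₁ d
        step (white i) (black u′) q (inj₂ st) = white-step u′ i q st
        step (black u′) (white i) q (inj₂ st) = black-step u′ i q st
        step (white _) (white _) q _ = ⊥-elim (par⇒linked alt q)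
        step (black _) (black _) q _ = ⊥-elim (par⇒linked alt q)
        each : ∀ i → Dead ⊎ (white i ∈ˡ ws → Complete ws loc i)
        each i with white i ∈? ws
        ... | no i∉ = inj₂ λ i∈ → contradiction i∈ i∉
        ... | yes i∈ with par-ind ws (λ x → Dead ⊎ State x) base step (white i) i∈
        ... | inj₁ d = inj₁ d
        ... | inj₂ c = inj₂ λ _ → c

    length-even : ∀ k l → suc (k + k) ≢ l + l
    length-even zero    (suc l) e with () ← trans (ℕ.suc-injective e) (ℕ.+-suc l l)
    length-even (suc k) (suc l) e = length-even k l (ℕ.suc-injective (trans (trans (cong suc (sym (ℕ.+-suc k k))) (ℕ.suc-injective e)) (ℕ.+-suc l l)))

    module _ {T : Hypergraph N n} (hyp : IsHypertree r n T) {v′ : Fin N} where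

      -- Here x is the current vertex, y the next letter and p the part still to come. The
      -- conditions on the whole walk restrict y; this is how letters outside the recurrence are
      -- seen to have no completion.
      module Suffix p {y x w} (walk : IsWalk T m v′ (p ++ y ∷ x ∷ w)) where
        open HypertreeWalk r m′ n hyp walk
        open IsWalk walk

        private
          whole : List (Vertex N n)
          whole = p ++ y ∷ x ∷ w

        adjacent-step : Adjacent T y x
        adjacent-step = Linked.head (suffix-linked p adjacent)

        step-bound : ∀ u i → u ∈ˢ lookup T i → (x ≡ black u × y ≡ white i ⊎ x ≡ white i × y ≡ black u) → steps (x ∷ w) x y < m
        step-bound u i u∈ h = ≤-trans (≤-reflexive (sym (steps-hit y x w))) (≤-trans (steps-++ p (y ∷ x ∷ w) x y) (≤-reflexive (go h)))
          where
          go : (x ≡ black u × y ≡ white i ⊎ x ≡ white i × y ≡ black u) → steps whole x y ≡ m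
          go (inj₁ (refl , refl)) = proj₂ (edges u i u∈)
          go (inj₂ (refl , refl)) = proj₁ (edges u i u∈)

        par-suffix : ∀ {z} → z ∈ˡ x ∷ w → par whole z ≡ par (x ∷ w) z
        par-suffix {z} z∈ = trans (par-++ p (y ∷ x ∷ w) (there z∈)) (par-∷ y (x ∷ w) z∈)

        edge-seen : ∀ u i → u ∈ˢ lookup T i → black u ∈ˡ x ∷ w → white i ∈ˡ x ∷ w →
                    par (x ∷ w) (black u) ≡ just (white i) ⊎ par (x ∷ w) (white i) ≡ just (black u)
        edge-seen u i u∈ b∈ w∈ with edge⇒par u i u∈
        ... | inj₁ q = inj₁ (trans (sym (par-suffix b∈)) q)
        ... | inj₂ q = inj₂ (trans (sym (par-suffix w∈)) q)

        not-returning : ∀ u i w′ → y ≡ black u → x ≡ white i → w ≢ black u ∷ w′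
        not-returning u i w′ refl refl refl = no-return u i (suffix-infix p (Infix.here (refl ∷ refl ∷ refl ∷ [])))

    -- Necessity. The labels found at a hyperedge are exactly its vertices, so its exits form a
    -- final sequence; the tree can be read off from the word, which gives uniqueness later.
    module Whole {v u : Fin N} {w : List (Vertex N n)} {on loc} (inv : Inv m v (black u) w on loc)
      {T : Hypergraph N n} (hyp : IsHypertree r n T) {v′ : Fin N} (walk : IsWalk T m v′ (black u ∷ w)) where

      open HypertreeWalk r m′ n hyp walk
      open IsWalk walk
      open Inv inv using (slotsInv; alt) renaming (ends to inv-ends)
      open Facts inv

      private
        ws : List (Vertex N n)
        ws = black u ∷ w

      start≡ : u ≡ v′
      start≡ = inj₁-injective (just-injective starts)

      root : par ws (black u) ≡ nothing
      root = trans (cong (par ws ∘ inj₁) start≡) (par-last ws ends)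

      label⇒edge : ∀ i a → a < count (loc i) → label (loc i) a ∈ˢ lookup T i
      label⇒edge i zero    lt = par⇒linked {R = Adjacent T} adjacent (SlotsInv.parent (slotsInv i (all-visited (white i))))
      label⇒edge i (suc a) lt = par⇒linked {R = Adjacent T} adjacent (SlotsInv.child (slotsInv i (all-visited (white i))) a lt)

      edge⇒label : ∀ i u′ → u′ ∈ˢ lookup T i → ∃ λ a → a < count (loc i) × label (loc i) a ≡ u′
      edge⇒label i u′ u∈ with edge⇒par u′ i u∈
      ... | inj₁ q = let a , lt , e = SlotsInv.children (slotsInv i (all-visited (white i))) u′ q in suc a , lt , e
      ... | inj₂ q = 0 , ≤-trans (s≤s z≤n) (SlotsInv.last< si) , inj₁-injective (just-injective (trans (sym (SlotsInv.parent si)) q))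
        where si = slotsInv i (all-visited (white i))

      count≡ : ∀ i → count (loc i) ≡ suc r
      count≡ i = trans (sym (count-labels (λ u′ → u′ ∈ˢ? lookup T i) (label (loc i)) (count (loc i))
        (SlotsInv.label-inj (slotsInv i (all-visited (white i)))) (edge⇒label i) (label⇒edge i)))
        (trans (sym (∣∣≡sum (lookup T i))) (All-lookup (proj₁ (proj₂ hyp)) i))

      exits≡ : ∀ i → exits ws i ≡ full
      exits≡ i = begin
        exits ws i                                       ≡⟨ exits-sum alt i ⟩
        sum (λ u′ → steps ws (white i) (black u′))       ≡⟨ sum-cong-≗ (λ u′ → point u′ (u′ ∈ˢ? lookup T i)) ⟩
        sum (λ u′ → m * ind (u′ ∈ˢ? lookup T i))         ≡⟨ trans (sym (lsum-allFin N (λ u′ → m * member u′))) (trans (lsum-*ˡ m (List.allFin N) member) (cong (m *_) (lsum-allFin N member))) ⟩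
        m * sum (λ u′ → ind (u′ ∈ˢ? lookup T i))         ≡⟨ cong (m *_) (trans (sym (∣∣≡sum (lookup T i))) (All-lookup (proj₁ (proj₂ hyp)) i)) ⟩
        m * suc r                                        ≡⟨ ℕ.*-comm m (suc r) ⟩
        full                                             ∎
        where
        open ≡-Reasoning
        member : Fin N → ℕ
        member u′ = ind (u′ ∈ˢ? lookup T i)
        point : ∀ u′ (d : Dec (u′ ∈ˢ lookup T i)) → steps ws (white i) (black u′) ≡ m * ind d
        point u′ (yes p) = trans (proj₁ (edges u′ i p)) (sym (ℕ.*-identityʳ m))
        point u′ (no ¬p) with steps ws (white i) (black u′) in eq
        ... | zero  = sym (ℕ.*-zeroʳ m)
        ... | suc _ = contradiction (steps⇒linked adjacent (white i) (black u′) (subst (0 <_) (sym eq) (s≤s z≤n))) ¬p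

      complete : ∀ i → Complete ws loc i
      complete i = exits≡ i , SlotsInv.last-off si (AtRoot.off inv root (SlotsInv.parent si)) , count≡ i ,
        λ a → proj₁ (edges (label (loc i) (toℕ a)) i (label⇒edge i (toℕ a) (Fin.toℕ<n a)))
        where si = slotsInv i (all-visited (white i))

    -- Sufficiency. The hypertree is rebuilt from the word: its hyperedges are the sets of labels.
    module Determined {v u : Fin N} {w : List (Vertex N n)} {on loc} (inv : Inv m v (black u) w on loc) (nr : NoReturn (black u ∷ w)) (r>0 : 0 < r)
      (root : par (black u ∷ w) (black u) ≡ nothing)
      (seen : ∀ i → white i ∈ˡ black u ∷ w) (complete : ∀ i → Complete (black u ∷ w) loc i) where

      open Inv inv
      open Tree tree
      open Facts inv
      open AtRoot inv root using (off)

      private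
        ws : List (Vertex N n)
        ws = black u ∷ w
        module SI i = SlotsInv (slotsInv i (seen i))

        count≡ : ∀ i → count (loc i) ≡ suc r
        count≡ i = proj₁ (proj₂ (proj₂ (complete i)))

        pos : ∀ i → 0 < count (loc i)
        pos i = ≤-trans (s≤s z≤n) (SI.last< i)

        labelled? : ∀ i u′ → Dec (∃ λ (a : Fin (count (loc i))) → label (loc i) (toℕ a) ≡ u′)
        labelled? i u′ = Fin.any? λ a → label (loc i) (toℕ a) Fin.≟ u′

        indicator : Fin n → Fin N → Bool
        indicator i u′ = does (labelled? i u′)

      tree-of : Hypergraph N n
      tree-of = Vec.tabulate λ i → Vec.tabulate (indicator i)

      lookup-tree : ∀ i → lookup tree-of i ≡ Vec.tabulate (indicator i)
      lookup-tree = lookup∘tabulate λ i → Vec.tabulate (indicator i)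

      ∈⇒label : ∀ i u′ → u′ ∈ˢ lookup tree-of i → ∃ λ a → a < count (loc i) × label (loc i) a ≡ u′
      ∈⇒label i u′ u∈ with toWitness-does (labelled? i u′) (trans (sym (lookup∘tabulate (indicator i) u′))
        ([]=⇒lookup (subst (u′ ∈ˢ_) (lookup-tree i) u∈)))
      ... | a , e = toℕ a , Fin.toℕ<n a , e

      label⇒∈ : ∀ i a → a < count (loc i) → label (loc i) a ∈ˢ lookup tree-of i
      label⇒∈ i a lt = subst (label (loc i) a ∈ˢ_) (sym (lookup-tree i)) (lookup⇒[]= _ _ (trans (lookup∘tabulate (indicator i) (label (loc i) a))
        (dec-true (labelled? i (label (loc i) a)) (fromℕ< lt , cong (label (loc i)) (Fin.toℕ-fromℕ< lt)))))

      ∈⇒par : ∀ i u′ → u′ ∈ˢ lookup tree-of i → par ws (black u′) ≡ just (white i) ⊎ par ws (white i) ≡ just (black u′)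
      ∈⇒par i u′ u∈ with ∈⇒label i u′ u∈
      ... | zero  , lt , refl = inj₂ (SI.parent i)
      ... | suc a , lt , refl = inj₁ (SI.child i a lt)

      child⇒∈ : ∀ i u′ → par ws (black u′) ≡ just (white i) → u′ ∈ˢ lookup tree-of i
      child⇒∈ i u′ q with SI.children i u′ q
      ... | a , lt , refl = label⇒∈ i (suc a) lt

      parent⇒∈ : ∀ i u′ → par ws (white i) ≡ just (black u′) → u′ ∈ˢ lookup tree-of i
      parent⇒∈ i u′ q = subst (_∈ˢ lookup tree-of i) (inj₁-injective (just-injective (trans (sym (SI.parent i)) q))) (label⇒∈ i 0 (pos i))

      -- Each of the n hyperedges has r children; together with the root this exhausts all rn + 1
      -- vertices.
      all-black : ∀ u′ → black u′ ∈ˡ ws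
      all-black u′ with black u′ ∈? ws
      ... | yes p = p
      ... | no ¬p = contradiction (≤-trans (≤-reflexive (sym (unseen-∉ ¬p))) (≤-trans (f≤sum (λ u → unseen ws (black u)) u′) (≤-reflexive none-unseen))) λ ()
        where
        none-unseen : sum (λ u → unseen ws (black u)) ≡ 0
        none-unseen = ℕ.+-cancelʳ-≡ (suc (r * n)) _ 0 (trans (cong (λ k → sum (λ u → unseen ws (black u)) + suc k)
          (trans (ℕ.*-comm r n) (sym (trans (sum-cong-≗ λ i → trans (kids-seen i (seen i)) (cong (_∸ 1) (count≡ i))) (sum-const n r))))) count-black)

      -- Let x be the parent and y the first child of i. If y is also a child of j, then i = j.
      -- Otherwise y is the parent of j; then x, which differs from y, is a child of j, and y, i, x,
      -- j form a cycle of parents.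
      distinct : ∀ {i j} → lookup tree-of i ≡ lookup tree-of j → i ≡ j
      distinct {i} {j} eq = go (∈⇒par j y (subst (y ∈ˢ_) eq (child⇒∈ i y y-par))) (∈⇒par j x (subst (x ∈ˢ_) eq (label⇒∈ i 0 (pos i))))
        where
        1<count : 1 < count (loc i)
        1<count = ≤-trans (s≤s r>0) (≤-reflexive (sym (count≡ i)))
        x = label (loc i) 0
        y = label (loc i) 1
        y-par = SI.child i 0 1<count
        go : par ws (black y) ≡ just (white j) ⊎ par ws (white j) ≡ just (black y) →
             par ws (black x) ≡ just (white j) ⊎ par ws (white j) ≡ just (black x) → i ≡ j
        go (inj₁ q) _ = inj₂-injective (just-injective (trans (sym y-par) q))
        go (inj₂ q) (inj₂ q′) with () ← SI.label-inj i 1<count (pos i) (inj₁-injective (just-injective (trans (sym q) q′)))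
        go (inj₂ q) (inj₁ q′) = ⊥-elim (par-acyclic₄ ws y-par (SI.parent i) q′ q)

      connected : Connected tree-of
      connected a b = to-root a ◅◅ reverse (λ {x} {y} → symmetric {x} {y}) (to-root b)
        where
        symmetric : ∀ {x y} → Joined tree-of x y → Joined tree-of y x
        symmetric = Any.map λ (p , q) → q , p
        join : ∀ {k} {S : Vec (Subset N) k} i {x y} → x ∈ˢ lookup S i → y ∈ˢ lookup S i → Any.Any (λ e → x ∈ˢ e × y ∈ˢ e) S
        join {S = _ ∷ _} zero    p q = Any.here (p , q)
        join {S = _ ∷ _} (suc i) p q = Any.there (join i p q)
        Reach : Vertex N n → Set
        Reach (black x) = Star (Joined tree-of) x v
        Reach (white i) = ∀ x → x ∈ˢ lookup tree-of i → Star (Joined tree-of) x v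
        base : ∀ x → x ∈ˡ ws → par ws x ≡ nothing → Reach x
        base x x∈ e with v-root x∈ e
        ... | refl = ε
        step : ∀ x z → par ws x ≡ just z → Reach z → Reach x
        step (white i) (black y) q st x x∈ = join i x∈ (parent⇒∈ i y q) ◅ st
        step (black x) (white i) q st = st x (child⇒∈ i x q)
        step (white _) (white _) q _ = ⊥-elim (par⇒linked alt q)
        step (black _) (black _) q _ = ⊥-elim (par⇒linked alt q)
        to-root : ∀ x → Star (Joined tree-of) x v
        to-root x = par-ind ws Reach base step (black x) (all-black x)

      hypertree : IsHypertree r n tree-of
      hypertree = tabulate⁺ (λ {i} {j} e → distinct (trans (lookup-tree i) (trans e (sym (lookup-tree j)))))
        , All.tabulate⁺ (λ i → trans (cong ∣_∣ (sym (lookup∘tabulate _ i))) (size i))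
        , connected
        where
        size : ∀ i → ∣ lookup tree-of i ∣ ≡ suc r
        size i = trans (∣∣≡sum (lookup tree-of i)) (trans (count-labels (λ u′ → u′ ∈ˢ? lookup tree-of i) (label (loc i)) (count (loc i))
          (SI.label-inj i) (∈⇒label i) (label⇒∈ i)) (count≡ i))

      walk : IsWalk tree-of m v ws
      walk = mkWalk (steps⇒Linked ws adjacent) (cong just (v-root (here refl) root)) ends edges nr
        where
        adjacent : ∀ a b → 0 < steps ws a b → Adjacent tree-of b a
        adjacent a b lt with tree-edge lt | steps⇒linked alt a b lt
        adjacent (black x) (white i) lt | inj₁ q | _ = parent⇒∈ i x q
        adjacent (black x) (white i) lt | inj₂ q | _ = child⇒∈ i x q
        adjacent (white i) (black x) lt | inj₁ q | _ = child⇒∈ i x q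
        adjacent (white i) (black x) lt | inj₂ q | _ = parent⇒∈ i x q
        edges : ∀ x i → x ∈ˢ lookup tree-of i → steps ws (white i) (black x) ≡ m × steps ws (black x) (white i) ≡ m
        edges x i x∈ with ∈⇒label i x x∈
        ... | a , lt , refl = down , trans (balanced (∈⇒par i _ x∈)) down
          where
          down = complete-at ws loc i (complete i) lt
          balanced : ∀ {x} → par ws (black x) ≡ just (white i) ⊎ par ws (white i) ≡ just (black x) → steps ws (black x) (white i) ≡ steps ws (white i) (black x)
          balanced (inj₁ q) = sym (bit-off tree q (off q))
          balanced (inj₂ q) = bit-off tree q (off q)

      unique : ∀ {T v′} → IsHypertree r n T → IsWalk T m v′ ws → T ≡ tree-of × v′ ≡ v
      unique {T} {v′} hyp walk′ = lookup-ext same , trans (sym start≡) (inj₁-injective (v-root (here refl) root))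
        where
        open Whole inv hyp walk′ using (start≡; label⇒edge; edge⇒label)
        same : ∀ i → lookup T i ≡ lookup tree-of i
        same i = ⊆-antisym (λ {x} x∈ → let a , lt , e = edge⇒label i x x∈ in subst (_∈ˢ lookup tree-of i) e (label⇒∈ i a lt))
                           (λ {x} x∈ → let a , lt , e = ∈⇒label i x x∈ in subst (_∈ˢ lookup T i) e (label⇒edge i a lt))
        lookup-ext : ∀ {k} {S S′ : Vec (Subset N) k} → (∀ i → lookup S i ≡ lookup S′ i) → S ≡ S′
        lookup-ext {S = []}    {[]}    e = refl
        lookup-ext {S = _ ∷ _} {_ ∷ _} e = cong₂ _∷_ (e zero) (lookup-ext (e ∘ suc))

open Walks

-- Power series

module PowerSeries (R : CommutativeSemiring 0ℓ 0ℓ) where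

  open CommutativeSemiring R using (Carrier; 0#; 1#; refl; sym; trans; reflexive; +-cong; +-congˡ; +-congʳ; *-cong; *-congˡ; *-congʳ;
    +-identityˡ; +-identityʳ; *-identityˡ; *-identityʳ; +-comm; +-assoc; *-comm; *-assoc; distribˡ; distribʳ; zeroˡ; zeroʳ;
    setoid; *-commutativeSemigroup)
    renaming (_+_ to infixl 6 _⊕_; _*_ to infixl 7 _⊗_; _≈_ to infix 4 _≋_) public
  open SemiringSum (CommutativeSemiring.semiring R) public
    using (sum-cong-≋; *-distribˡ-sum; *-distribʳ-sum) renaming
    (sum to Σᴿ; ∑-distrib-+ to Σᴿ-⊕; ∑-comm to Σᴿ-comm; sum-replicate-zero to Σᴿ-replicate-0)
  open CSemigroup *-commutativeSemigroup public using (x∙yz≈y∙xz; interchange)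

  PS : Set
  PS = ℕ → Carrier

  infix 4 _≃_
  -- A record instead of a function type, so that the two series can be inferred from a proof of
  -- their equality.
  record _≃_ (f g : PS) : Set where
    constructor mk
    field at : ∀ k → f k ≋ g k
  open _≃_ public

  infixl 6 _⊞_
  _⊞_ : PS → PS → PS
  (f ⊞ g) k = f k ⊕ g k

  infixl 7 _⊠_
  abstract

    _⊠_ : PS → PS → PS
    (f ⊠ g) k = Σᴿ {suc k} λ i → f (toℕ i) ⊗ g (k ∸ toℕ i)

    ⊠-def : ∀ f g k → (f ⊠ g) k ≡ Σᴿ {suc k} λ i → f (toℕ i) ⊗ g (k ∸ toℕ i)
    ⊠-def f g k = ≡.refl

  infixr 8 _∙_
  _∙_ : Carrier → PS → PS
  (c ∙ f) k = c ⊗ f k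

  𝟘 𝟙 : PS
  𝟘 _ = 0#
  𝟙 zero    = 1#
  𝟙 (suc _) = 0#

  shift tail : PS → PS
  shift f zero    = 0#
  shift f (suc k) = f k
  tail f k = f (suc k)

  infixr 8 _↑_
  _↑_ : PS → ℕ → PS
  f ↑ zero  = 𝟙
  f ↑ suc d = f ⊠ (f ↑ d)

  _∘ˢ_ : PS → PS → PS
  (g ∘ˢ f) k = Σᴿ {suc k} λ d → g (toℕ d) ⊗ (f ↑ toℕ d) k

  ≃-isEquivalence : IsEquivalence _≃_
  ≃-isEquivalence = record
    { refl = mk λ k → refl ; sym = λ e → mk λ k → sym (at e k) ; trans = λ e e′ → mk λ k → trans (at e k) (at e′ k) }

  private
    module ≃ = IsEquivalence ≃-isEquivalence

  Σᴿ-0 : ∀ k {a : Fin k → Carrier} → (∀ i → a i ≋ 0#) → Σᴿ a ≋ 0#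
  Σᴿ-0 k e = trans (sum-cong-≋ e) (Σᴿ-replicate-0 k)

  ⊞-cong : ∀ {f f′ g g′} → f ≃ f′ → g ≃ g′ → f ⊞ g ≃ f′ ⊞ g′
  ⊞-cong e e′ = mk λ k → +-cong (at e k) (at e′ k)

  ∙-congˢ : ∀ c {f g} → f ≃ g → c ∙ f ≃ c ∙ g
  ∙-congˢ c e = mk λ k → *-congˡ (at e k)

  abstract

    ⊠-cong : ∀ {f f′ g g′} → f ≃ f′ → g ≃ g′ → f ⊠ g ≃ f′ ⊠ g′
    ⊠-cong e e′ = mk λ k → sum-cong-≋ {suc k} λ i → *-cong (at e (toℕ i)) (at e′ (k ∸ toℕ i))

    ⊠-distribʳ : ∀ h f g → (f ⊞ g) ⊠ h ≃ f ⊠ h ⊞ g ⊠ h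
    ⊠-distribʳ h f g = mk λ k → trans
      (sum-cong-≋ {suc k} λ i → distribʳ (h (k ∸ toℕ i)) (f (toℕ i)) (g (toℕ i)))
      (Σᴿ-⊕ {suc k} (λ i → f (toℕ i) ⊗ h (k ∸ toℕ i)) (λ i → g (toℕ i) ⊗ h (k ∸ toℕ i)))

    ∙-⊠ : ∀ c f g → (c ∙ f) ⊠ g ≃ c ∙ (f ⊠ g)
    ∙-⊠ c f g = mk λ k → trans
      (sum-cong-≋ {suc k} λ i → *-assoc c (f (toℕ i)) (g (k ∸ toℕ i)))
      (sym (*-distribˡ-sum {suc k} c λ i → f (toℕ i) ⊗ g (k ∸ toℕ i)))

    ⊠-zeroˡ : ∀ f → 𝟘 ⊠ f ≃ 𝟘
    ⊠-zeroˡ f = mk λ k → Σᴿ-0 (suc k) λ i → zeroˡ (f (k ∸ toℕ i))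

    -- The definition splits off the first term of the convolution; splitting off the last one is
    -- the mirror image that makes commutativity an induction.
    ⊠-sucʳ : ∀ f g k → (f ⊠ g) (suc k) ≋ f (suc k) ⊗ g 0 ⊕ (f ⊠ tail g) k
    ⊠-sucʳ f g zero = trans (+-congˡ (+-identityʳ _))
      (trans (+-comm _ _) (+-congˡ (sym (+-identityʳ _))))
    ⊠-sucʳ f g (suc k) = trans (+-congˡ (⊠-sucʳ (tail f) g k))
      (trans (sym (+-assoc _ _ _)) (trans (+-congʳ (+-comm _ _)) (+-assoc _ _ _)))

    ⊠-comm : ∀ f g → f ⊠ g ≃ g ⊠ f
    ⊠-comm f g = mk (go f g)
      where
      go : ∀ f g k → (f ⊠ g) k ≋ (g ⊠ f) k
      go f g zero    = +-congʳ (*-comm (f 0) (g 0))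
      go f g (suc k) = trans (+-cong (*-comm (f 0) (g (suc k))) (go (tail f) g k))
                             (sym (⊠-sucʳ g f k))

    ⊠-assoc : ∀ f g h → (f ⊠ g) ⊠ h ≃ f ⊠ (g ⊠ h)
    ⊠-assoc f g h = mk (go f g h)
      where
      open SetoidReasoning setoid
      go : ∀ f g h k → ((f ⊠ g) ⊠ h) k ≋ (f ⊠ (g ⊠ h)) k
      go f g h zero = +-congʳ (begin
        (f 0 ⊗ g 0 ⊕ 0#) ⊗ h 0   ≈⟨ *-congʳ (+-identityʳ _) ⟩
        f 0 ⊗ g 0 ⊗ h 0          ≈⟨ *-assoc _ _ _ ⟩
        f 0 ⊗ (g 0 ⊗ h 0)        ≈⟨ *-congˡ (+-identityʳ _) ⟨
        f 0 ⊗ (g 0 ⊗ h 0 ⊕ 0#)   ∎)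
      go f g h (suc k) = begin
        (f ⊠ g) 0 ⊗ h (suc k) ⊕ (tail (f ⊠ g) ⊠ h) k
          ≈⟨ +-cong (trans (*-congʳ (+-identityʳ _)) (*-assoc _ _ _))
                    (at (⊠-distribʳ h (f 0 ∙ tail g) (tail f ⊠ g)) k) ⟩
        f 0 ⊗ (g 0 ⊗ h (suc k)) ⊕ (((f 0 ∙ tail g) ⊠ h) k ⊕ ((tail f ⊠ g) ⊠ h) k)
          ≈⟨ +-congˡ (+-cong (at (∙-⊠ (f 0) (tail g) h) k) (go (tail f) g h k)) ⟩
        f 0 ⊗ (g 0 ⊗ h (suc k)) ⊕ (f 0 ⊗ (tail g ⊠ h) k ⊕ (tail f ⊠ (g ⊠ h)) k)
          ≈⟨ +-assoc _ _ _ ⟨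
        f 0 ⊗ (g 0 ⊗ h (suc k)) ⊕ f 0 ⊗ (tail g ⊠ h) k ⊕ (tail f ⊠ (g ⊠ h)) k
          ≈⟨ +-congʳ (distribˡ _ _ _) ⟨
        f 0 ⊗ (g ⊠ h) (suc k) ⊕ (tail f ⊠ (g ⊠ h)) k ∎

    ⊠-identityˡ : ∀ f → 𝟙 ⊠ f ≃ f
    ⊠-identityˡ f = mk λ where
      zero    → trans (+-identityʳ _) (*-identityˡ (f 0))
      (suc k) → trans (+-cong (*-identityˡ (f (suc k))) (at (⊠-zeroˡ f) k)) (+-identityʳ _)

  seriesSemiring : CommutativeSemiring 0ℓ 0ℓ
  seriesSemiring = record
    { Carrier = PS ; _≈_ = _≃_ ; _+_ = _⊞_ ; _*_ = _⊠_ ; 0# = 𝟘 ; 1# = 𝟙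
    ; isCommutativeSemiring = isCommutativeSemiringˡ record
      { +-isCommutativeMonoid = isCommutativeMonoidˡ record
        { isSemigroup = record
          { isMagma = record { isEquivalence = ≃-isEquivalence ; ∙-cong = ⊞-cong }
          ; assoc = λ f g h → mk λ k → +-assoc (f k) (g k) (h k) }
        ; identityˡ = λ f → mk λ k → +-identityˡ (f k)
        ; comm = λ f g → mk λ k → +-comm (f k) (g k) }
      ; *-isCommutativeMonoid = isCommutativeMonoidˡ record
        { isSemigroup = record
          { isMagma = record { isEquivalence = ≃-isEquivalence ; ∙-cong = ⊠-cong }
          ; assoc = ⊠-assoc }
        ; identityˡ = ⊠-identityˡ
        ; comm = ⊠-comm }
      ; distribʳ = ⊠-distribʳ
      ; zeroˡ = ⊠-zeroˡ } }

  ⊠-∙ : ∀ c f g → f ⊠ (c ∙ g) ≃ c ∙ (f ⊠ g)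
  ⊠-∙ c f g = ≃.trans (⊠-comm f (c ∙ g)) (≃.trans (∙-⊠ c g f) (∙-congˢ c (⊠-comm g f)))

  abstract

    shift-⊠ : ∀ f g → shift f ⊠ g ≃ shift (f ⊠ g)
    shift-⊠ f g = mk λ where
      zero    → trans (+-identityʳ _) (zeroˡ (g 0))
      (suc k) → trans (+-congʳ (zeroˡ (g (suc k)))) (+-identityˡ _)

  ∙-assoc : ∀ a b f → a ∙ (b ∙ f) ≃ (a ⊗ b) ∙ f
  ∙-assoc a b f = mk λ k → sym (*-assoc a b (f k))

  ∙-cong : ∀ {a b f g} → a ≋ b → f ≃ g → a ∙ f ≃ b ∙ g
  ∙-cong e e′ = mk λ k → *-cong e (at e′ k)

  ∙-⊞ : ∀ a f g → a ∙ (f ⊞ g) ≃ a ∙ f ⊞ a ∙ g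
  ∙-⊞ a f g = mk λ k → distribˡ a (f k) (g k)

  1∙ : ∀ f → 1# ∙ f ≃ f
  1∙ f = mk λ k → *-identityˡ (f k)

  0∙ : ∀ f → 0# ∙ f ≃ 𝟘
  0∙ f = mk λ k → zeroˡ (f k)

  ∙-swap : ∀ a b f → a ∙ (b ∙ f) ≃ b ∙ (a ∙ f)
  ∙-swap a b f = mk λ k → x∙yz≈y∙xz a b (f k)

  shift-cong : ∀ {f g} → f ≃ g → shift f ≃ shift g
  shift-cong e = mk λ where
    zero    → refl
    (suc k) → at e k

  ↑-cong : ∀ {f g} d → f ≃ g → f ↑ d ≃ g ↑ d
  ↑-cong zero    e = ≃.refl
  ↑-cong (suc d) e = ⊠-cong e (↑-cong d e)

  ∘ˢ-cong : ∀ {f f′ g g′} → g ≃ g′ → f ≃ f′ → g ∘ˢ f ≃ g′ ∘ˢ f′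
  ∘ˢ-cong e e′ = mk λ k → sum-cong-≋ {suc k} λ d → *-cong (at e (toℕ d)) (at (↑-cong (toℕ d) e′) k)

  ∘ˢ-⊞ : ∀ f g h → (g ⊞ h) ∘ˢ f ≃ (g ∘ˢ f) ⊞ (h ∘ˢ f)
  ∘ˢ-⊞ f g h = mk λ k → trans
    (sum-cong-≋ {suc k} λ d → distribʳ ((f ↑ toℕ d) k) (g (toℕ d)) (h (toℕ d)))
    (Σᴿ-⊕ {suc k} (λ d → g (toℕ d) ⊗ (f ↑ toℕ d) k) (λ d → h (toℕ d) ⊗ (f ↑ toℕ d) k))

  ∘ˢ-∙ : ∀ f c g → (c ∙ g) ∘ˢ f ≃ c ∙ (g ∘ˢ f)
  ∘ˢ-∙ f c g = mk λ k → trans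
    (sum-cong-≋ {suc k} λ d → *-assoc c (g (toℕ d)) ((f ↑ toℕ d) k))
    (sym (*-distribˡ-sum {suc k} c λ d → g (toℕ d) ⊗ (f ↑ toℕ d) k))

  ∘ˢ-𝟙 : ∀ f → 𝟙 ∘ˢ f ≃ 𝟙
  ∘ˢ-𝟙 f = mk λ k → trans (+-cong (*-identityˡ (𝟙 k)) (Σᴿ-0 k λ d → zeroˡ ((f ↑ toℕ (suc d)) k)))
                          (+-identityʳ (𝟙 k))

  Σᴿ-extend : ∀ {j k} (a : ℕ → Carrier) → j ≤ k → (∀ d → j < d → a d ≋ 0#) →
              Σᴿ {suc j} (a ∘ toℕ) ≋ Σᴿ {suc k} (a ∘ toℕ)
  Σᴿ-extend {zero}  {k}     a z≤n     v = +-congˡ (sym (Σᴿ-0 k λ i → v (suc (toℕ i)) (s≤s z≤n)))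
  Σᴿ-extend {suc j} {suc k} a (s≤s p) v = +-congˡ (Σᴿ-extend (a ∘ suc) p λ d lt → v (suc d) (s≤s lt))

  module _ {f : PS} (f0 : f 0 ≋ 0#) where

    abstract

      ⊠-tail : ∀ g k → (f ⊠ g) (suc k) ≋ (tail f ⊠ g) k
      ⊠-tail g k = trans (+-congʳ (trans (*-congʳ f0) (zeroˡ (g (suc k))))) (+-identityˡ _)

      ↑-order : ∀ d k → k < d → (f ↑ d) k ≋ 0#
      ↑-order (suc d) zero    lt = trans (+-identityʳ _) (trans (*-congʳ f0) (zeroˡ _))
      ↑-order (suc d) (suc k) (s≤s lt) = trans (⊠-tail (f ↑ d) k)
        (Σᴿ-0 (suc k) λ i → trans (*-congˡ (↑-order d (k ∸ toℕ i) (≤-trans (s≤s (m∸n≤m k (toℕ i))) lt)))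
                                  (zeroʳ (tail f (toℕ i))))

      -- Substitution turns the factor x into f. As f has no constant term, f^d vanishes below
      -- degree d, so all truncated sums may be extended to a common range before the order of
      -- summation is exchanged.
      ∘ˢ-shift : ∀ g → shift g ∘ˢ f ≃ f ⊠ (g ∘ˢ f)
      ∘ˢ-shift g = mk go
        where
        open SetoidReasoning setoid
        term : ∀ {k} → Fin (suc k) → Fin (suc k) → Carrier
        term {k} d i = tail f (toℕ i) ⊗ (g (toℕ d) ⊗ (f ↑ toℕ d) (k ∸ toℕ i))
        go : ∀ k → (shift g ∘ˢ f) k ≋ (f ⊠ (g ∘ˢ f)) k
        go zero = trans (+-cong (zeroˡ 1#) refl) (trans (+-identityˡ _) (sym (trans (+-identityʳ _)
          (trans (*-congʳ f0) (zeroˡ _)))))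
        go (suc k) = begin
          0# ⊗ 0# ⊕ Σᴿ {suc k} (λ d → g (toℕ d) ⊗ (f ⊠ f ↑ toℕ d) (suc k))
            ≈⟨ trans (+-congʳ (zeroˡ 0#)) (+-identityˡ _) ⟩
          Σᴿ {suc k} (λ d → g (toℕ d) ⊗ (f ⊠ f ↑ toℕ d) (suc k))
            ≈⟨ sum-cong-≋ {suc k} (λ d → trans (*-congˡ (⊠-tail (f ↑ toℕ d) k))
                  (trans (*-distribˡ-sum {suc k} (g (toℕ d)) λ i → tail f (toℕ i) ⊗ (f ↑ toℕ d) (k ∸ toℕ i))
                    (sum-cong-≋ {suc k} λ i → x∙yz≈y∙xz (g (toℕ d)) (tail f (toℕ i)) ((f ↑ toℕ d) (k ∸ toℕ i))))) ⟩
          Σᴿ {suc k} (λ d → Σᴿ {suc k} λ i → term d i)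
            ≈⟨ Σᴿ-comm {suc k} {suc k} term ⟩
          Σᴿ {suc k} (λ i → Σᴿ {suc k} λ d → term d i)
            ≈⟨ sum-cong-≋ {suc k} (λ i → trans
                  (sym (*-distribˡ-sum {suc k} (tail f (toℕ i)) λ d → g (toℕ d) ⊗ (f ↑ toℕ d) (k ∸ toℕ i)))
                  (*-congˡ (sym (Σᴿ-extend {k ∸ toℕ i} (λ d → g d ⊗ (f ↑ d) (k ∸ toℕ i)) (m∸n≤m k (toℕ i))
                    λ d lt → trans (*-congˡ (↑-order d _ lt)) (zeroʳ (g d)))))) ⟩
          (tail f ⊠ (g ∘ˢ f)) k
            ≈⟨ ⊠-tail (g ∘ˢ f) k ⟨
          (f ⊠ (g ∘ˢ f)) (suc k) ∎

  module _ (pow : ℕ → Carrier) (pow-0 : pow 0 ≋ 1#) (pow-+ : ∀ i j → pow (i + j) ≋ pow i ⊗ pow j) where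

    -- The substitution f(c x), with `pow k` in the role of c^k.
    dilate : PS → PS
    dilate f k = f k ⊗ pow k

    abstract

      dilate-⊠ : ∀ f g → dilate (f ⊠ g) ≃ dilate f ⊠ dilate g
      dilate-⊠ f g = mk λ k → trans (*-distribʳ-sum {suc k} (pow k) λ i → f (toℕ i) ⊗ g (k ∸ toℕ i))
        (sum-cong-≋ {suc k} λ i → trans
          (*-congˡ (trans (reflexive (≡.cong pow (≡.sym (m+[n∸m]≡n (toℕ≤pred[n] i))))) (pow-+ (toℕ i) (k ∸ toℕ i))))
          (interchange (f (toℕ i)) (g (k ∸ toℕ i)) _ _))

    dilate-↑ : ∀ f d → dilate (f ↑ d) ≃ dilate f ↑ d
    dilate-↑ f zero = mk λ where
      zero    → trans (*-identityˡ _) pow-0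
      (suc k) → zeroˡ (pow (suc k))
    dilate-↑ f (suc d) = ≃.trans (dilate-⊠ f (f ↑ d)) (⊠-cong {f = dilate f} ≃.refl (dilate-↑ f d))

    dilate-∘ˢ : ∀ g f → dilate (g ∘ˢ f) ≃ g ∘ˢ dilate f
    dilate-∘ˢ g f = mk λ k → trans (*-distribʳ-sum {suc k} (pow k) λ d → g (toℕ d) ⊗ (f ↑ toℕ d) k)
      (sum-cong-≋ {suc k} λ d → trans (*-assoc (g (toℕ d)) _ _) (*-congˡ (at (dilate-↑ f (toℕ d)) k)))

-- The series of a black vertex.

module LocalSeries (R : CommutativeSemiring 0ℓ 0ℓ) where

  open PowerSeries R public
  open SemiringMult (CommutativeSemiring.semiring R) using (×-homo-+; ×1-homo-*) renaming (_×_ to _·_)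
  module S = CommutativeSemiring seriesSemiring

  ι : ℕ → Carrier
  ι n = n · 1#

  ι-+ : ∀ a b → ι (a + b) ≋ ι a ⊕ ι b
  ι-+ = ×-homo-+ 1#

  ι-* : ∀ a b → ι (a * b) ≋ ι a ⊗ ι b
  ι-* = ×1-homo-*

  ι-1 : ι 1 ≋ 1#
  ι-1 = +-identityʳ 1#

  ι-cong : ∀ {a b} → a ≡ b → ι a ≋ ι b
  ι-cong e = reflexive (≡.cong ι e)

  Σᴿ-ι : ∀ {k} (f : Fin k → ℕ) → Σᴿ (ι ∘ f) ≋ ι (sum f)
  Σᴿ-ι {zero}  f = refl
  Σᴿ-ι {suc k} f = trans (+-congˡ (Σᴿ-ι (f ∘ suc))) (sym (ι-+ (f zero) _))

  Σᴿ-ι⊗ : ∀ {k} (f : Fin k → ℕ) c → Σᴿ (λ i → ι (f i) ⊗ c) ≋ ι (sum f) ⊗ c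
  Σᴿ-ι⊗ f c = trans (sym (*-distribʳ-sum c (ι ∘ f))) (*-congʳ (Σᴿ-ι f))

  -- All divisions are by factorials, so the counting takes place over a commutative semiring with
  -- given inverse factorials; rational numbers enter only at the end.
  module _ (inv! : ℕ → Carrier) (inv!-0 : inv! 0 ≋ 1#)
           (inv!-suc : ∀ k → ι (suc k) ⊗ inv! (suc k) ≋ inv! k) (m′ : ℕ) where

    private
      m = suc m′

    power : Carrier → ℕ → Carrier
    power c zero    = 1#
    power c (suc d) = c ⊗ power c d

    scale : ℕ → Carrier
    scale d = inv! d ⊗ power (inv! m) d

    -- The number of arrangements of q distinguishable exits together with m equal exits to each of
    -- d new hyperedges, the latter being told apart only by the order of their first occurrence.
    coeff : ℕ → PS
    coeff q d = ι ((q + d * m) !) ⊗ scale d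

    open SetoidReasoning setoid

    scale-suc : ∀ d → ι (suc d * m) ⊗ scale (suc d) ≋ inv! m′ ⊗ scale d
    scale-suc d = begin
      ι (suc d * m) ⊗ (inv! (suc d) ⊗ (inv! m ⊗ power (inv! m) d))
        ≈⟨ *-cong (ι-* (suc d) m) (sym (*-assoc _ _ _)) ⟩
      ι (suc d) ⊗ ι m ⊗ (inv! (suc d) ⊗ inv! m ⊗ power (inv! m) d)
        ≈⟨ sym (*-assoc _ _ _) ⟩
      ι (suc d) ⊗ ι m ⊗ (inv! (suc d) ⊗ inv! m) ⊗ power (inv! m) d
        ≈⟨ *-congʳ (trans (interchange _ _ _ _) (*-cong (inv!-suc d) (inv!-suc m′))) ⟩
      inv! d ⊗ inv! m′ ⊗ power (inv! m) d
        ≈⟨ trans (*-congʳ (*-comm _ _)) (*-assoc _ _ _) ⟩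
      inv! m′ ⊗ scale d ∎

    ι-! : ∀ k → ι (suc k !) ≋ ι (suc k) ⊗ ι (k !)
    ι-! k = ι-* (suc k) (k !)

    coeff-lower : ∀ q d → ι (suc d * m) ⊗ (ι ((q + suc d * m) !) ⊗ scale (suc d)) ≋ inv! m′ ⊗ coeff (q + m) d
    coeff-lower q d = begin
      ι (suc d * m) ⊗ (ι ((q + suc d * m) !) ⊗ scale (suc d))   ≈⟨ x∙yz≈y∙xz _ _ _ ⟩
      ι ((q + suc d * m) !) ⊗ (ι (suc d * m) ⊗ scale (suc d))   ≈⟨ *-cong (ι-cong (≡.cong _! (≡.sym (ℕ.+-assoc q m (d * m))))) (scale-suc d) ⟩
      ι ((q + m + d * m) !) ⊗ (inv! m′ ⊗ scale d)               ≈⟨ x∙yz≈y∙xz _ _ _ ⟩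
      inv! m′ ⊗ coeff (q + m) d                                 ∎

    -- The first place of an arrangement holds one of the q + 1 known exits, or a new hyperedge. In
    -- the second case its other m - 1 exits join the known ones, and the factor 1/(m - 1)! makes
    -- them equal again.
    coeff-suc : ∀ q → coeff (suc q) ≃ ι (suc q) ∙ coeff q ⊞ inv! m′ ∙ shift (coeff (q + m))
    coeff-suc q = mk λ where
      zero → begin
        ι ((suc q + 0) !) ⊗ scale 0
          ≈⟨ *-congʳ (trans (ι-! (q + 0)) (*-congʳ (ι-cong (≡.cong suc (ℕ.+-identityʳ q))))) ⟩
        ι (suc q) ⊗ ι ((q + 0) !) ⊗ scale 0                     ≈⟨ *-assoc _ _ _ ⟩
        ι (suc q) ⊗ coeff q 0                                   ≈⟨ +-identityʳ _ ⟨
        ι (suc q) ⊗ coeff q 0 ⊕ 0#                              ≈⟨ +-congˡ (zeroʳ (inv! m′)) ⟨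
        ι (suc q) ⊗ coeff q 0 ⊕ inv! m′ ⊗ 0#                    ∎
      (suc d) → begin
        ι ((suc q + suc d * m) !) ⊗ scale (suc d)
          ≈⟨ trans (*-congʳ (trans (ι-! (q + suc d * m)) (*-congʳ (ι-+ (suc q) (suc d * m))))) (*-assoc _ _ _) ⟩
        (ι (suc q) ⊕ ι (suc d * m)) ⊗ coeff q (suc d)           ≈⟨ distribʳ _ _ _ ⟩
        ι (suc q) ⊗ coeff q (suc d) ⊕ ι (suc d * m) ⊗ coeff q (suc d)
          ≈⟨ +-congˡ (coeff-lower q d) ⟩
        ι (suc q) ⊗ coeff q (suc d) ⊕ inv! m′ ⊗ coeff (q + m) d ∎

    coeff-zero : coeff 0 ≃ 𝟙 ⊞ inv! m′ ∙ shift (coeff m′)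
    coeff-zero = mk λ where
      zero → begin
        ι 1 ⊗ (inv! 0 ⊗ 1#)      ≈⟨ trans (*-cong ι-1 (trans (*-identityʳ _) inv!-0)) (*-identityʳ 1#) ⟩
        1#                       ≈⟨ +-identityʳ 1# ⟨
        1# ⊕ 0#                  ≈⟨ +-congˡ (zeroʳ (inv! m′)) ⟨
        1# ⊕ inv! m′ ⊗ 0#        ∎
      (suc d) → begin
        ι ((suc d * m) !) ⊗ scale (suc d)
          ≈⟨ trans (*-congʳ (ι-! (m′ + d * m))) (*-assoc _ _ _) ⟩
        ι (suc d * m) ⊗ (ι ((m′ + d * m) !) ⊗ scale (suc d))    ≈⟨ x∙yz≈y∙xz _ _ _ ⟩
        ι ((m′ + d * m) !) ⊗ (ι (suc d * m) ⊗ scale (suc d))    ≈⟨ *-congˡ (scale-suc d) ⟩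
        ι ((m′ + d * m) !) ⊗ (inv! m′ ⊗ scale d)                ≈⟨ x∙yz≈y∙xz _ _ _ ⟩
        inv! m′ ⊗ coeff m′ d                                    ≈⟨ +-identityˡ _ ⟨
        0# ⊕ inv! m′ ⊗ coeff m′ d                               ∎

    module _ (G : PS) (G0 : G 0 ≋ 0#) where

      B : ℕ → PS
      B q = coeff q ∘ˢ G

      private
        lower : ∀ q → (inv! m′ ∙ shift (coeff q)) ∘ˢ G ≃ inv! m′ ∙ (G ⊠ B q)
        lower q = S.trans (∘ˢ-∙ G (inv! m′) (shift (coeff q))) (∙-congˢ (inv! m′) (∘ˢ-shift G0 (coeff q)))

      B-suc : ∀ q → B (suc q) ≃ ι (suc q) ∙ B q ⊞ inv! m′ ∙ (G ⊠ B (q + m))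
      B-suc q = S.trans (∘ˢ-cong (coeff-suc q) S.refl)
        (S.trans (∘ˢ-⊞ G (ι (suc q) ∙ coeff q) (inv! m′ ∙ shift (coeff (q + m))))
          (⊞-cong (∘ˢ-∙ G (ι (suc q)) (coeff q)) (lower (q + m))))

      B-zero : B 0 ≃ 𝟙 ⊞ inv! m′ ∙ (G ⊠ B m′)
      B-zero = S.trans (∘ˢ-cong coeff-zero S.refl)
        (S.trans (∘ˢ-⊞ G 𝟙 (inv! m′ ∙ shift (coeff m′))) (⊞-cong (∘ˢ-𝟙 G) (lower m′)))

sum-+ : ∀ {k} {f g : Fin k → ℕ} c x → f x ≡ c + g x → (∀ y → y ≢ x → f y ≡ g y) → sum f ≡ c + sum g
sum-+ {suc k} {f} {g} c zero    e eq = ≡.trans (≡.cong₂ _+_ e (sum-cong-≗ λ y → eq (suc y) λ ())) (ℕ.+-assoc c (g zero) _)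
sum-+ {suc k} {f} {g} c (suc x) e eq = ≡.trans
  (≡.cong₂ _+_ (eq zero λ ()) (sum-+ c x e λ y ne → eq (suc y) (ne ∘ Fin.suc-injective)))
  (≡.trans (≡.sym (ℕ.+-assoc (g zero) c _)) (≡.trans (≡.cong (_+ sum (g ∘ suc)) (ℕ.+-comm (g zero) c)) (ℕ.+-assoc c (g zero) _)))

module Product (M : CommutativeMonoid 0ℓ 0ℓ) where
  open CommutativeMonoid M renaming (_≈_ to infix 4 _≋_)
  open CSemigroup commutativeSemigroup using (x∙yz≈y∙xz)
  open MonoidSum M public using () renaming (sum to Π; sum-cong-≋ to Π-cong)

  except : ∀ {k} → Fin k → (Fin k → Carrier) → Carrier
  except x f = Π λ y → if does (y Fin.≟ x) then ε else f y

  split : ∀ {k} x (f : Fin k → Carrier) → Π f ≋ f x ∙ except x f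
  split zero    f = ∙-congˡ (sym (identityˡ _))
  split (suc x) f = trans (∙-congˡ (split x (f ∘ suc))) (x∙yz≈y∙xz _ _ _)

  except-cong : ∀ {k} x {f g : Fin k → Carrier} → (∀ y → y ≢ x → f y ≋ g y) → except x f ≋ except x g
  except-cong x {f} {g} e = Π-cong λ y → go y (y Fin.≟ x)
    where
    go : ∀ y (d : Dec (y ≡ x)) → (if does d then ε else f y) ≋ (if does d then ε else g y)
    go y (yes _) = refl
    go y (no ne) = e y ne

  -- A step of the walk changes a product of local factors at a single index; this passes from the
  -- change of that factor to the change of the product.
  replace : ∀ {k} x {f g : Fin k → Carrier} {c} → f x ≋ c ∙ g x → (∀ y → y ≢ x → f y ≋ g y) → Π f ≋ c ∙ Π g
  replace x {f} {g} {c} e eq = trans (split x f) (trans (∙-cong e (except-cong x eq))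
    (trans (assoc c _ _) (∙-congˡ (sym (split x g)))))

-- Weights of partial walks and their recurrence.

module Weights (R : CommutativeSemiring 0ℓ 0ℓ)
  (inv! : ℕ → CommutativeSemiring.Carrier R)
  (inv!-0 : CommutativeSemiring._≈_ R (inv! 0) (CommutativeSemiring.1# R))
  (inv!-suc : ∀ k → CommutativeSemiring._≈_ R (CommutativeSemiring._*_ R (LocalSeries.ι R (suc k)) (inv! (suc k))) (inv! k))
  (r m′ N n : ℕ) where

  open LocalSeries R
  open LocalCount r (suc m′)

  m full κ : ℕ
  m    = suc m′
  full = suc r * m
  κ    = Q (suc full) 1 0 (λ _ → 0)

  open Residuals {N} {n} m

  module Πˢ = Product S.*-commutativeMonoid
  module Πᶜ = Product (CommutativeSemiring.*-commutativeMonoid R)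

  Πˢ-𝟙 : ∀ {k} {f : Fin k → PS} → (∀ i → f i ≃ 𝟙) → Πˢ.Π f ≃ 𝟙
  Πˢ-𝟙 {k} e = S.trans (Πˢ.Π-cong e) (MonoidSum.sum-replicate-zero S.*-commutativeMonoid k)

  Πˢ-𝟘 : ∀ {k} (f : Fin k → PS) i → f i ≃ 𝟘 → Πˢ.Π f ≃ 𝟘
  Πˢ-𝟘 f i e = S.trans (Πˢ.split i f) (S.trans (⊠-cong e S.refl) (S.zeroˡ _))

  -- `block` treats the remaining exits to known children as distinguishable. Those to one and the
  -- same child are not, hence one inverse factorial for each child.
  residual! : List (Vertex N n) → Fin N → Carrier
  residual! ws u = Πᶜ.Π (λ i → inv! (downs ws u i))

  unseenB unseenW : List (Vertex N n) → ℕ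
  unseenB ws = sum λ u → unseen ws (black u)
  unseenW ws = sum λ i → unseen ws (white i)

  unseenB-keep : ∀ {y ws} → (∀ u → black u ≢ y) ⊎ y ∈ˡ ws → unseenB (y ∷ ws) ≡ unseenB ws
  unseenB-keep {y} {ws} (inj₁ ne) = sum-cong-≗ λ u → unseen-keep {ws = ws} (inj₁ (ne u))
  unseenB-keep {y} {ws} (inj₂ y∈) = sum-cong-≗ λ u → unseen-keep {ws = ws} {black u} (inj₂ y∈)

  unseenW-keep : ∀ {y ws} → (∀ i → white i ≢ y) ⊎ y ∈ˡ ws → unseenW (y ∷ ws) ≡ unseenW ws
  unseenW-keep {y} {ws} (inj₁ ne) = sum-cong-≗ λ i → unseen-keep {ws = ws} (inj₁ (ne i))
  unseenW-keep {y} {ws} (inj₂ y∈) = sum-cong-≗ λ i → unseen-keep {ws = ws} {white i} (inj₂ y∈)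

  unseenB-new : ∀ {u ws} → black u ∉ˡ ws → unseenB ws ≡ suc (unseenB (black u ∷ ws))
  unseenB-new {u} {ws} u∉ = sum-suc u (unseen-new u∉) λ u′ ne → ≡.sym (unseen-keep {ws = ws} {black u′} {black u} (inj₁ (ne ∘ inj₁-injective)))

  unseenW-new : ∀ {i ws} → white i ∉ˡ ws → unseenW ws ≡ suc (unseenW (white i ∷ ws))
  unseenW-new {i} {ws} i∉ = sum-suc i (unseen-new i∉) λ i′ ne → ≡.sym (unseen-keep {ws = ws} {white i′} {white i} (inj₁ (ne ∘ inj₂-injective)))

  inv!-lower : ∀ {a b} → a ≡ suc b → inv! b ≋ ι a ⊗ inv! a
  inv!-lower {b = b} ≡.refl = sym (inv!-suc b)

  module _ (G : PS) (G0 : G 0 ≋ 0#) where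

    Bᴳ : ℕ → PS
    Bᴳ = B inv! inv!-0 inv!-suc m′ G G0

    Λ : PS
    Λ = inv! m′ ∙ Bᴳ m′

    -- A black vertex with p remaining exits to its parent and E remaining exits to
    -- known children; the last exit of all must be to the parent.
    block : ℕ → ℕ → PS
    block zero    zero    = 𝟙
    block zero    (suc E) = 𝟘
    block (suc p) E       = inv! p ∙ Bᴳ (p + E)

    private
      new-term : ∀ p q → inv! p ∙ (inv! m′ ∙ (G ⊠ Bᴳ q)) ≃ inv! m′ ∙ (G ⊠ (inv! p ∙ Bᴳ q))
      new-term p q = S.trans (∙-swap (inv! p) (inv! m′) _) (∙-congˢ (inv! m′) (S.sym (⊠-∙ (inv! p) G (Bᴳ q))))

    -- The three terms are the possible next exits: to the parent, one of the E exits to known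
    -- children, or to a new hyperedge, which leaves m - 1 further exits to it.
    block-rec : ∀ p E → block (suc p) E ≃
      (block p E ⊞ ι E ∙ block (suc p) (E ∸ 1)) ⊞ inv! m′ ∙ (G ⊠ block (suc p) (E + m′))
    block-rec zero zero = begin
      inv! 0 ∙ Bᴳ 0                                                    ≈⟨ ∙-congˢ (inv! 0) (B-zero inv! inv!-0 inv!-suc m′ G G0) ⟩
      inv! 0 ∙ (𝟙 ⊞ inv! m′ ∙ (G ⊠ Bᴳ m′))                              ≈⟨ ∙-⊞ (inv! 0) _ _ ⟩
      inv! 0 ∙ 𝟙 ⊞ inv! 0 ∙ (inv! m′ ∙ (G ⊠ Bᴳ m′))                     ≈⟨ ⊞-cong (S.trans (∙-cong inv!-0 S.refl) (1∙ 𝟙)) (new-term 0 m′) ⟩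
      𝟙 ⊞ inv! m′ ∙ (G ⊠ (inv! 0 ∙ Bᴳ m′))                              ≈⟨ ⊞-cong (S.sym (S.trans (S.+-congˡ (0∙ _)) (S.+-identityʳ 𝟙))) S.refl ⟩
      (𝟙 ⊞ 0# ∙ block 1 0) ⊞ inv! m′ ∙ (G ⊠ (inv! 0 ∙ Bᴳ m′))            ∎
      where open SetoidReasoning S.setoid
    block-rec zero (suc E) = begin
      inv! 0 ∙ Bᴳ (suc E)                                              ≈⟨ ∙-congˢ (inv! 0) (B-suc inv! inv!-0 inv!-suc m′ G G0 E) ⟩
      inv! 0 ∙ (ι (suc E) ∙ Bᴳ E ⊞ inv! m′ ∙ (G ⊠ Bᴳ (E + m)))           ≈⟨ ∙-⊞ (inv! 0) _ _ ⟩
      inv! 0 ∙ (ι (suc E) ∙ Bᴳ E) ⊞ inv! 0 ∙ (inv! m′ ∙ (G ⊠ Bᴳ (E + m)))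
        ≈⟨ ⊞-cong (∙-swap (inv! 0) (ι (suc E)) (Bᴳ E)) (new-term 0 (E + m)) ⟩
      ι (suc E) ∙ (inv! 0 ∙ Bᴳ E) ⊞ inv! m′ ∙ (G ⊠ (inv! 0 ∙ Bᴳ (E + m)))
        ≈⟨ ⊞-cong (S.sym (S.+-identityˡ _)) (S.reflexive (≡.cong (λ q → inv! m′ ∙ (G ⊠ (inv! 0 ∙ Bᴳ q))) (ℕ.+-suc E m′))) ⟩
      (𝟘 ⊞ ι (suc E) ∙ (inv! 0 ∙ Bᴳ E)) ⊞ inv! m′ ∙ (G ⊠ (inv! 0 ∙ Bᴳ (suc E + m′)))  ∎
      where open SetoidReasoning S.setoid
    block-rec (suc p) E = begin
      inv! (suc p) ∙ Bᴳ (suc (p + E))                                  ≈⟨ ∙-congˢ (inv! (suc p)) (B-suc inv! inv!-0 inv!-suc m′ G G0 (p + E)) ⟩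
      inv! (suc p) ∙ (ι (suc p + E) ∙ Bᴳ (p + E) ⊞ inv! m′ ∙ (G ⊠ Bᴳ (p + E + m)))  ≈⟨ ∙-⊞ (inv! (suc p)) _ _ ⟩
      inv! (suc p) ∙ (ι (suc p + E) ∙ Bᴳ (p + E)) ⊞ inv! (suc p) ∙ (inv! m′ ∙ (G ⊠ Bᴳ (p + E + m)))
        ≈⟨ ⊞-cong exits-term (S.trans (new-term (suc p) (p + E + m))
             (S.reflexive (≡.cong (λ q → inv! m′ ∙ (G ⊠ (inv! (suc p) ∙ Bᴳ q))) (≡.trans (ℕ.+-assoc p E m)
               (≡.trans (≡.cong (p +_) (ℕ.+-suc E m′)) (ℕ.+-suc p (E + m′))))))) ⟩
      (inv! p ∙ Bᴳ (p + E) ⊞ ι E ∙ (inv! (suc p) ∙ Bᴳ (suc p + (E ∸ 1)))) ⊞ inv! m′ ∙ (G ⊠ (inv! (suc p) ∙ Bᴳ (suc p + (E + m′)))) ∎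
      where
      open SetoidReasoning S.setoid
      ⊕-∙ : ∀ a b f → (a ⊕ b) ∙ f ≃ a ∙ f ⊞ b ∙ f
      ⊕-∙ a b f = mk λ k → distribʳ (f k) a b
      second : ∀ E → ι E ∙ (inv! (suc p) ∙ Bᴳ (p + E)) ≃ ι E ∙ (inv! (suc p) ∙ Bᴳ (suc p + (E ∸ 1)))
      second zero    = S.trans (0∙ _) (S.sym (0∙ _))
      second (suc E) = S.reflexive (≡.cong (λ q → ι (suc E) ∙ (inv! (suc p) ∙ Bᴳ q)) (ℕ.+-suc p E))
      exits-term : inv! (suc p) ∙ (ι (suc p + E) ∙ Bᴳ (p + E)) ≃ inv! p ∙ Bᴳ (p + E) ⊞ ι E ∙ (inv! (suc p) ∙ Bᴳ (suc p + (E ∸ 1)))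
      exits-term = begin
        inv! (suc p) ∙ (ι (suc p + E) ∙ Bᴳ (p + E))                    ≈⟨ ∙-swap (inv! (suc p)) (ι (suc p + E)) _ ⟩
        ι (suc p + E) ∙ (inv! (suc p) ∙ Bᴳ (p + E))                    ≈⟨ ∙-cong (ι-+ (suc p) E) S.refl ⟩
        (ι (suc p) ⊕ ι E) ∙ (inv! (suc p) ∙ Bᴳ (p + E))                ≈⟨ ⊕-∙ (ι (suc p)) (ι E) _ ⟩
        ι (suc p) ∙ (inv! (suc p) ∙ Bᴳ (p + E)) ⊞ ι E ∙ (inv! (suc p) ∙ Bᴳ (p + E))
          ≈⟨ ⊞-cong (S.trans (∙-assoc (ι (suc p)) (inv! (suc p)) _) (∙-cong (inv!-suc p) S.refl)) (second E) ⟩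
        inv! p ∙ Bᴳ (p + E) ⊞ ι E ∙ (inv! (suc p) ∙ Bᴳ (suc p + (E ∸ 1))) ∎

    blackOf : List (Vertex N n) → Fin N → PS
    blackOf ws u = residual! ws u ∙ block (ups ws u) (sum (downs ws u))

    -- The continuations of the sequence of exits, with one factor `Λ` for every vertex of the
    -- hyperedge that is still to be discovered.
    whiteOf : List (Vertex N n) → Fin n → Slots {N} {n} → PS
    whiteOf ws i s = ι (Q (suc full ∸ exits ws i) (count s) (last s) (exitsTo ws i s)) ∙ Λ ↑ (suc r ∸ count s)

    abstract

      bfac : List (Vertex N n) → Fin N → PS
      bfac ws u = if does (black u ∈? ws) then blackOf ws u else 𝟙

      wfac : List (Vertex N n) → (Fin n → Slots {N} {n}) → Fin n → PS
      wfac ws loc i = if does (white i ∈? ws) then whiteOf ws i (loc i) else 𝟙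

      bfac-seen : ∀ {ws u} → black u ∈ˡ ws → bfac ws u ≡ blackOf ws u
      bfac-seen {ws} {u} p = ≡.cong (λ b → if b then blackOf ws u else 𝟙) (dec-true (black u ∈? ws) p)

      bfac-unseen : ∀ {ws u} → black u ∉ˡ ws → bfac ws u ≡ 𝟙
      bfac-unseen {ws} {u} p = ≡.cong (λ b → if b then blackOf ws u else 𝟙) (dec-false (black u ∈? ws) p)

      wfac-seen : ∀ {ws i} loc → white i ∈ˡ ws → wfac ws loc i ≡ whiteOf ws i (loc i)
      wfac-seen {ws} {i} loc p = ≡.cong (λ b → if b then whiteOf ws i (loc i) else 𝟙) (dec-true (white i ∈? ws) p)

      wfac-unseen : ∀ {ws i} loc → white i ∉ˡ ws → wfac ws loc i ≡ 𝟙
      wfac-unseen {ws} {i} loc p = ≡.cong (λ b → if b then whiteOf ws i (loc i) else 𝟙) (dec-false (white i ∈? ws) p)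

    blackOf-cong : ∀ {ws ws′ u} → ups ws u ≡ ups ws′ u → (∀ i → downs ws u i ≡ downs ws′ u i) → blackOf ws u ≃ blackOf ws′ u
    blackOf-cong {ws} {ws′} {u} e f = ∙-cong (Πᶜ.Π-cong λ i → reflexive (≡.cong inv! (f i)))
      (S.reflexive (≡.cong₂ block e (sum-cong-≗ f)))

    whiteOf-cong : ∀ {ws ws′ i s s′} → exits ws i ≡ exits ws′ i → count s ≡ count s′ → last s ≡ last s′ →
                   (∀ a → a < count s → exitsTo ws i s a ≡ exitsTo ws′ i s′ a) → whiteOf ws i s ≃ whiteOf ws′ i s′
    whiteOf-cong {ws} {ws′} {i} {slots c l lab} {slots _ _ lab′} e ≡.refl ≡.refl f = ∙-cong (ι-cong (≡.trans
      (Q-cong (suc full ∸ exits ws i) c l f) (≡.cong (λ k → Q (suc full ∸ k) c l (exitsTo ws′ i (slots c l lab′))) e))) S.refl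

    bfac-keep : ∀ x w y {u} → black u ≢ x → black u ≢ y → bfac (y ∷ x ∷ w) u ≃ bfac (x ∷ w) u
    bfac-keep x w y {u} u≢x u≢y with black u ∈? (x ∷ w)
    ... | yes u∈ = S.trans (S.reflexive (bfac-seen (there u∈))) (S.trans
      (blackOf-cong (Step.ups-keep x w y u∈ u≢x) (λ i → Step.downs-keep x w y u≢x)) (S.sym (S.reflexive (bfac-seen u∈))))
    ... | no u∉ = S.trans (S.reflexive (bfac-unseen (λ { (here p) → u≢y p ; (there p) → u∉ p }))) (S.sym (S.reflexive (bfac-unseen u∉)))

    wfac-keep : ∀ x w y loc {i} → white i ≢ x → white i ≢ y → wfac (y ∷ x ∷ w) loc i ≃ wfac (x ∷ w) loc i
    wfac-keep x w y loc {i} i≢x i≢y with white i ∈? (x ∷ w)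
    ... | yes i∈ = S.trans (S.reflexive (wfac-seen loc (there i∈))) (S.trans
      (whiteOf-cong {y ∷ x ∷ w} {x ∷ w} {i} {loc i} {loc i} (Step.exits-keep x w y (i≢x ∘ ≡.sym)) ≡.refl ≡.refl
        (λ a _ → steps-miss y x w (inj₁ i≢x))) (S.sym (S.reflexive (wfac-seen loc i∈))))
    ... | no i∉ = S.trans (S.reflexive (wfac-unseen loc (λ { (here p) → i≢y p ; (there p) → i∉ p }))) (S.sym (S.reflexive (wfac-unseen loc i∉)))

    product : List (Vertex N n) → (Fin n → Slots) → PS
    product ws loc = Πˢ.Π (bfac ws) ⊠ Πˢ.Π (wfac ws loc)

    Φ : List (Vertex N n) → (Fin n → Slots) → Carrier
    Φ ws loc = ι (unseenB ws ! * unseenW ws !) ⊗ product ws loc (unseenW ws)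

    module _ (G-eq : G ≃ shift (ι κ ∙ Λ ↑ r)) where

      module BlackRec {v u : Fin N} {w : List (Vertex N n)} {on loc} (inv : Inv m v (black u) w on loc) where
        open Inv inv

        ws : List (Vertex N n)
        ws = black u ∷ w
        K = unseenW ws
        E = sum (downs ws u)
        D = residual! ws u
        Z = ι κ ∙ Λ ↑ r
        P = Πˢ.except u (bfac ws) ⊠ Πˢ.Π (wfac ws loc)

        c = ι (unseenB ws ! * K !)

        H : PS → Carrier
        H Y = c ⊗ ((D ∙ Y) ⊠ P) K

        -- The weights that belong to a step to the parent, to one of the distinguishable exits to
        -- known children, and to one particular unseen hyperedge.
        γ δ α : ℕ → Carrier
        γ p = H (block p E)
        δ p = H (block p (E ∸ 1))
        α p = ι (unseenB ws ! * (K ∸ 1) !) ⊗ (((inv! m′ ⊗ D) ∙ block p (E + m′)) ⊠ (Z ⊠ P)) (K ∸ 1)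

        H-cong : ∀ {X Y} → X ≃ Y → H X ≋ H Y
        H-cong e = *-congˡ (at (⊠-cong (∙-congˢ D e) S.refl) K)

        H-⊞ : ∀ X Y → H (X ⊞ Y) ≋ H X ⊕ H Y
        H-⊞ X Y = trans (*-congˡ (at (S.trans (⊠-cong (∙-⊞ D X Y) S.refl) (⊠-distribʳ P (D ∙ X) (D ∙ Y))) K)) (distribˡ c _ _)

        H-∙ : ∀ a X → H (a ∙ X) ≋ a ⊗ H X
        H-∙ a X = trans (*-congˡ (at (S.trans (⊠-cong (∙-swap D a X) S.refl) (∙-⊠ a (D ∙ X) P)) K)) (x∙yz≈y∙xz c a _)

        -- The factor x of G lowers the degree from K to K - 1, and K! = K (K - 1)!. So the term for
        -- a new hyperedge splits into K equal contributions, one for each unseen name.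
        α-weight : ∀ p → H (inv! m′ ∙ (G ⊠ block p (E + m′))) ≋ ι K ⊗ α p
        α-weight p = begin
          c ⊗ ((D ∙ (inv! m′ ∙ (G ⊠ X))) ⊠ P) K   ≈⟨ *-congˡ (at shifted K) ⟩
          c ⊗ shift (Y ⊠ (Z ⊠ P)) K               ≈⟨ go K ≡.refl ⟩
          ι K ⊗ α p                               ∎
          where
          open SetoidReasoning setoid
          X = block p (E + m′)
          Y = (inv! m′ ⊗ D) ∙ X
          shifted : (D ∙ (inv! m′ ∙ (G ⊠ X))) ⊠ P ≃ shift (Y ⊠ (Z ⊠ P))
          shifted = S.trans (⊠-cong (S.trans (S.trans (∙-swap D (inv! m′) _) (∙-assoc (inv! m′) D (G ⊠ X))) (S.sym (⊠-∙ (inv! m′ ⊗ D) G X))) S.refl)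
            (S.trans (⊠-assoc G Y P) (S.trans (⊠-cong G-eq S.refl) (S.trans (shift-⊠ Z (Y ⊠ P))
              (shift-cong (S.trans (S.sym (⊠-assoc Z Y P)) (S.trans (⊠-cong (⊠-comm Z Y) S.refl) (⊠-assoc Y Z P)))))))
          go : ∀ K → K ≡ unseenW ws → ι (unseenB ws ! * K !) ⊗ shift (Y ⊠ (Z ⊠ P)) K
               ≋ ι K ⊗ (ι (unseenB ws ! * (K ∸ 1) !) ⊗ (Y ⊠ (Z ⊠ P)) (K ∸ 1))
          go zero    _ = trans (zeroʳ _) (sym (zeroˡ _))
          go (suc k) _ = trans (*-congʳ (trans (ι-cong (≡.trans (≡.sym (ℕ.*-assoc (unseenB ws !) (suc k) (k !)))
            (≡.trans (≡.cong (_* k !) (ℕ.*-comm (unseenB ws !) (suc k))) (ℕ.*-assoc (suc k) (unseenB ws !) (k !))))) (ι-* (suc k) (unseenB ws ! * k !)))) (*-assoc _ _ _)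

        Φ≋H : ∀ {p} → ups ws u ≡ p → Φ ws loc ≋ H (block p E)
        Φ≋H ≡.refl = *-congˡ (at (S.trans (⊠-cong (S.trans (Πˢ.split u (bfac ws)) (⊠-cong (S.reflexive (bfac-seen (here ≡.refl))) S.refl)) S.refl)
          (⊠-assoc _ _ _)) K)

        total : ∀ p → H (block (suc p) E) ≋ ι K ⊗ α (suc p) ⊕ (ι E ⊗ δ (suc p) ⊕ γ p)
        total p = begin
          H (block (suc p) E)                      ≈⟨ H-cong (block-rec p E) ⟩
          H ((X ⊞ ι E ∙ Y) ⊞ inv! m′ ∙ W₀)         ≈⟨ H-⊞ (X ⊞ ι E ∙ Y) (inv! m′ ∙ W₀) ⟩
          H (X ⊞ ι E ∙ Y) ⊕ H (inv! m′ ∙ W₀)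
            ≈⟨ +-cong (trans (H-⊞ X (ι E ∙ Y)) (+-congˡ (H-∙ (ι E) Y))) (α-weight (suc p)) ⟩
          (γ p ⊕ ι E ⊗ δ (suc p)) ⊕ ι K ⊗ α (suc p)   ≈⟨ trans (+-comm _ _) (+-congˡ (+-comm _ _)) ⟩
          ι K ⊗ α (suc p) ⊕ (ι E ⊗ δ (suc p) ⊕ γ p)   ∎
          where
          open SetoidReasoning setoid
          X  = block p E
          Y  = block (suc p) (E ∸ 1)
          W₀ = G ⊠ block (suc p) (E + m′)

        private
          rest = Πˢ.except u (bfac ws)

        next-Φ : ∀ i {loc′ d q e k Y} → residual! (white i ∷ ws) u ≋ d → ups (white i ∷ ws) u ≡ q →
                 sum (downs (white i ∷ ws) u) ≡ e → unseenW (white i ∷ ws) ≡ k → Πˢ.Π (wfac (white i ∷ ws) loc′) ≃ Y →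
                 Φ (white i ∷ ws) loc′ ≋ ι (unseenB ws ! * k !) ⊗ ((d ∙ block q e) ⊠ (rest ⊠ Y)) k
        next-Φ i {loc′} {d} {q} {e} {k} {Y} dEq ≡.refl ≡.refl ≡.refl yEq = *-cong
          (ι-cong (≡.cong (λ b → b ! * k !) (unseenB-keep {white i} {ws} (inj₁ λ u ()))))
          (at (S.trans (⊠-cong blacks yEq) (⊠-assoc (d ∙ block q e) rest Y)) k)
          where
          blacks : Πˢ.Π (bfac (white i ∷ ws)) ≃ (d ∙ block q e) ⊠ rest
          blacks = S.trans (Πˢ.split u (bfac (white i ∷ ws))) (⊠-cong
            (S.trans (S.reflexive (bfac-seen {white i ∷ ws} (there (here ≡.refl)))) (∙-cong dEq S.refl))
            (Πˢ.except-cong u λ u′ ne → bfac-keep (black u) w (white i) (ne ∘ inj₁-injective) λ ()))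

        whites-keep : ∀ i → white i ∈ˡ ws → Πˢ.Π (wfac (white i ∷ ws) loc) ≃ Πˢ.Π (wfac ws loc)
        whites-keep i i∈ = Πˢ.Π-cong λ i′ → go i′ (i′ Fin.≟ i)
          where
          go : ∀ i′ → Dec (i′ ≡ i) → wfac (white i ∷ ws) loc i′ ≃ wfac ws loc i′
          go i′ (no ne) = wfac-keep (black u) w (white i) loc (λ ()) (ne ∘ inj₂-injective)
          go i′ (yes ≡.refl) = S.trans (S.reflexive (wfac-seen {white i ∷ ws} loc (here ≡.refl))) (S.trans
            (whiteOf-cong {white i ∷ ws} {ws} {i} {loc i} {loc i} (Step.exits-keep (black u) w (white i) λ ()) ≡.refl ≡.refl
              λ a _ → steps-miss (white i) (black u) w (inj₁ λ ())) (S.reflexive (≡.sym (wfac-seen {ws} loc i∈))))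

        newSlots : Fin n → Fin n → Slots
        newSlots i = loc [ i ≔ˢ slots 1 0 (λ _ → u) ]

        module _ {p} (p≡ : ups ws u ≡ suc p) where

          Φ-up : ∀ i → par ws (black u) ≡ just (white i) → Φ (white i ∷ ws) loc ≋ γ p
          Φ-up i q = next-Φ i (Πᶜ.Π-cong λ i′ → reflexive (≡.cong inv! (downs-up i′)))
            (ℕ.suc-injective (≡.trans (≡.sym ups-up) p≡)) (sum-cong-≗ downs-up)
            (unseenW-keep {white i} {ws} (inj₂ i∈)) (whites-keep i i∈)
            where
            open BlackStep.Up u w i q (up-room tree q)
            i∈ = proj₂ (par⇒∈ ws q)

          -- The letter i stands for d = `downs ws u i` exits that `block` distinguishes; the factor
          -- d appears because the inverse factorial changes from 1/d! to 1/(d - 1)!.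
          Φ-down : ∀ i → par ws (white i) ≡ just (black u) → steps ws (black u) (white i) < m →
                   Φ (white i ∷ ws) loc ≋ ι (downs ws u i) ⊗ δ (suc p)
          Φ-down i q room = trans (next-Φ i
            (Πᶜ.replace i (inv!-lower downs-down) λ i′ ne → reflexive (≡.cong inv! (BlackStep.downs-other u w i ne)))
            (≡.trans ups-down p≡) (≡.cong (_∸ 1) (≡.sym (sum-suc i downs-down λ i′ ne → ≡.sym (BlackStep.downs-other u w i ne))))
            (unseenW-keep {white i} {ws} (inj₂ i∈)) (whites-keep i i∈))
            (trans (*-congˡ (at (S.trans (⊠-cong (S.sym (∙-assoc (ι (downs ws u i)) D X)) S.refl) (∙-⊠ (ι (downs ws u i)) (D ∙ X) P)) K))
              (x∙yz≈y∙xz c (ι (downs ws u i)) _))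
            where
            open BlackStep.Down u w i q room
            i∈ = proj₁ (par⇒∈ ws q)
            X = block (suc p) (E ∸ 1)

          -- The new hyperedge brings `Z`, that is κ with one `Λ` for each of its r undiscovered
          -- vertices, and its m - 1 later entries from u bring the factor 1/(m - 1)!.
          Φ-new : ∀ i → white i ∉ˡ ws → Φ (white i ∷ ws) (newSlots i) ≋ α (suc p)
          Φ-new i i∉ = trans (next-Φ i {d = inv! m′ ⊗ D} {e = E + m′}
            (Πᶜ.replace i (trans (reflexive (≡.cong inv! downs-new)) (trans (sym (*-identityʳ (inv! m′)))
                (*-congˡ (sym (trans (reflexive (≡.cong inv! downs-before)) inv!-0)))))
              λ i′ ne → reflexive (≡.cong inv! (BlackStep.downs-other u w i ne)))
            (≡.trans ups-new p≡) (≡.trans (sum-+ m′ i (≡.trans downs-new (≡.sym (≡.trans (≡.cong (m′ +_) downs-before) (ℕ.+-identityʳ m′))))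
                                    λ i′ ne → BlackStep.downs-other u w i ne) (ℕ.+-comm m′ E))
            (≡.cong (_∸ 1) (≡.sym (unseenW-new i∉)))
            (Πˢ.replace i {c = Z} new-white-factor λ i′ ne → other-white i′ ne))
            (*-congˡ (at (⊠-cong S.refl (x∙yz≃y∙xz rest Z (Πˢ.Π (wfac ws loc)))) (K ∸ 1)))
            where
            open BlackStep.New u w i i∉
            open CSemigroup S.*-commutativeSemigroup using () renaming (x∙yz≈y∙xz to x∙yz≃y∙xz)
            s₀ = slots {N} {n} 1 0 (λ _ → u)
            no-steps : ∀ a → exitsTo (white i ∷ ws) i s₀ a ≡ 0
            no-steps a with exitsTo (white i ∷ ws) i s₀ a in eq
            ... | zero  = ≡.refl
            ... | suc k = contradiction (proj₁ (steps⇒∈ ws (white i) (black u) (≡.subst (0 <_)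
                (≡.trans (≡.sym eq) (steps-miss (white i) (black u) w (inj₁ λ ()))) (s≤s z≤n)))) i∉
            new-white-factor : wfac (white i ∷ ws) (newSlots i) i ≃ Z ⊠ wfac ws loc i
            new-white-factor = S.trans (S.reflexive (≡.trans (wfac-seen {white i ∷ ws} (newSlots i) (here ≡.refl))
                (≡.cong (whiteOf (white i ∷ ws) i) (≔ˢ-hit loc i {s₀}))))
              (S.trans (∙-cong (ι-cong (≡.trans (Q-cong (suc full ∸ exits (white i ∷ ws) i) 1 0 λ a _ → no-steps a)
                  (≡.cong (λ k → Q (suc full ∸ k) 1 0 (λ _ → 0)) (≡.trans (Step.exits-keep (black u) w (white i) λ ()) (exits-unseen ws i∉))))) S.refl)
                (S.trans (S.sym (S.*-identityʳ Z)) (⊠-cong S.refl (S.reflexive (≡.sym (wfac-unseen loc i∉))))))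
            other-white : ∀ i′ → i′ ≢ i → wfac (white i ∷ ws) (newSlots i) i′ ≃ wfac ws loc i′
            other-white i′ ne = S.trans (go (white i′ ∈? (white i ∷ ws))) (wfac-keep (black u) w (white i) loc (λ ()) (ne ∘ inj₂-injective))
              where
              go : Dec (white i′ ∈ˡ white i ∷ ws) → wfac (white i ∷ ws) (newSlots i) i′ ≃ wfac (white i ∷ ws) loc i′
              go (yes p) = S.reflexive (≡.trans (wfac-seen (newSlots i) p) (≡.trans (≡.cong (whiteOf (white i ∷ ws) i′) (≔ˢ-miss loc ne)) (≡.sym (wfac-seen loc p))))
              go (no p)  = S.reflexive (≡.trans (wfac-unseen (newSlots i) p) (≡.sym (wfac-unseen loc p)))

          private
            upInd : Fin n → ℕ
            upInd i = ind (par ws (black u) ≟ᴹ just (white i))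

            -- One formula for all kinds of letters: at most one of the three coefficients is
            -- nonzero for a given i, and summed over i they become K, E and the number of parents
            -- of u.
            term : Fin n → Carrier
            term i = ι (unseen ws (white i)) ⊗ α (suc p) ⊕ (ι (downs ws u i) ⊗ δ (suc p) ⊕ ι (upInd i) ⊗ γ p)

            eval : ∀ {i a b d} → unseen ws (white i) ≡ a → downs ws u i ≡ b → upInd i ≡ d →
                   term i ≋ ι a ⊗ α (suc p) ⊕ (ι b ⊗ δ (suc p) ⊕ ι d ⊗ γ p)
            eval ≡.refl ≡.refl ≡.refl = refl

            0⊗ : ∀ x → ι 0 ⊗ x ≋ 0#
            0⊗ x = zeroˡ x

            1⊗ : ∀ x → ι 1 ⊗ x ≋ x
            1⊗ x = trans (*-congʳ ι-1) (*-identityˡ x)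

            no-down : ∀ {i} → white i ∉ˡ ws → downs ws u i ≡ 0
            no-down i∉ = downs-no λ q → i∉ (proj₁ (par⇒∈ ws q))

            no-up : ∀ {i} → par ws (black u) ≢ just (white i) → upInd i ≡ 0
            no-up {i} q = ind-no (par ws (black u) ≟ᴹ just (white i)) q

            Σterm : Σᴿ term ≋ ι K ⊗ α (suc p) ⊕ (ι E ⊗ δ (suc p) ⊕ ι (sum upInd) ⊗ γ p)
            Σterm = trans (Σᴿ-⊕ (λ i → ι (unseen ws (white i)) ⊗ α (suc p)) (λ i → ι (downs ws u i) ⊗ δ (suc p) ⊕ ι (upInd i) ⊗ γ p))
              (+-cong (Σᴿ-ι⊗ (λ i → unseen ws (white i)) (α (suc p)))
                (trans (Σᴿ-⊕ (λ i → ι (downs ws u i) ⊗ δ (suc p)) (λ i → ι (upInd i) ⊗ γ p))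
                  (+-cong (Σᴿ-ι⊗ (downs ws u) (δ (suc p))) (Σᴿ-ι⊗ upInd (γ p)))))

          -- `T i` is going to be the number of completions after the letter i. The hypotheses are
          -- the induction hypothesis for the possible letters and the absence of completions for
          -- the others.
          module _ (T : Fin n → Carrier)
            (T-new  : ∀ i → white i ∉ˡ ws → T i ≋ Φ (white i ∷ ws) (newSlots i))
            (T-down : ∀ i → par ws (white i) ≡ just (black u) → steps ws (black u) (white i) < m → T i ≋ Φ (white i ∷ ws) loc)
            (T-full : ∀ i → par ws (white i) ≡ just (black u) → ¬ steps ws (black u) (white i) < m → T i ≋ 0#)
            (T-up   : ∀ i → par ws (black u) ≡ just (white i) → T i ≋ Φ (white i ∷ ws) loc)
            (T-none : ∀ i → white i ∈ˡ ws → par ws (white i) ≢ just (black u) → par ws (black u) ≢ just (white i) → T i ≋ 0#)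
            where

            private
              T≋term : ∀ i → T i ≋ term i
              T≋term i = go (white i ∈? ws) (par ws (white i) ≟ᴹ just (black u)) (par ws (black u) ≟ᴹ just (white i))
                            (steps ws (black u) (white i) ℕ.<? m)
               where
               go : Dec (white i ∈ˡ ws) → Dec (par ws (white i) ≡ just (black u)) → Dec (par ws (black u) ≡ just (white i)) →
                    Dec (steps ws (black u) (white i) < m) → T i ≋ term i
               go (no i∉) _ _ _ = trans (trans (T-new i i∉) (Φ-new i i∉)) (sym (trans
                (eval (unseen-∉ i∉) (no-down i∉) (no-up (λ q → i∉ (proj₂ (par⇒∈ ws q)))))
                (trans (+-cong (1⊗ _) (trans (+-cong (0⊗ _) (0⊗ _)) (+-identityʳ 0#))) (+-identityʳ _))))
               go (yes i∈) (yes q) _ (yes room) = trans (trans (T-down i q room) (Φ-down i q room)) (sym (trans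
                (eval (unseen-∈ i∈) ≡.refl (no-up (λ q′ → par-acyclic₂ ws q q′)))
                (trans (+-cong (0⊗ _) (trans (+-congˡ (0⊗ _)) (+-identityʳ _))) (+-identityˡ _))))
               go (yes i∈) (yes q) _ (no full) = trans (T-full i q full) (sym (trans
                (eval (unseen-∈ i∈) (≡.trans (downs-yes q) (ℕ.m≤n⇒m∸n≡0 (ℕ.≮⇒≥ full))) (no-up (λ q′ → par-acyclic₂ ws q q′)))
                (trans (+-cong (0⊗ _) (trans (+-cong (0⊗ _) (0⊗ _)) (+-identityʳ _))) (+-identityˡ _))))
               go (yes i∈) (no ¬q) (yes q′) _ = trans (trans (T-up i q′) (Φ-up i q′)) (sym (trans
                (eval (unseen-∈ i∈) (downs-no ¬q) (ind-yes (par ws (black u) ≟ᴹ just (white i)) q′))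
                (trans (+-cong (0⊗ _) (trans (+-cong (0⊗ _) (1⊗ _)) (+-identityˡ _))) (+-identityˡ _))))
               go (yes i∈) (no ¬q) (no ¬q′) _ = trans (T-none i i∈ ¬q ¬q′) (sym (trans
                (eval (unseen-∈ i∈) (downs-no ¬q) (no-up ¬q′))
                (trans (+-cong (0⊗ _) (trans (+-cong (0⊗ _) (0⊗ _)) (+-identityʳ _))) (+-identityˡ _))))

            black-step : ∀ {i} → par ws (black u) ≡ just (white i) → Φ ws loc ≋ Σᴿ T
            black-step {i} q = trans (Φ≋H p≡) (trans (total p) (sym (trans (sum-cong-≋ T≋term) (trans Σterm
              (+-congˡ (+-congˡ (trans (*-congʳ (ι-cong one)) (1⊗ (γ p)))))))))
              where
              one : sum upInd ≡ 1
              one = ≡.trans (sum-single i upInd λ i′ ne → no-up λ q′ → ne (inj₂-injective (just-injective (≡.trans (≡.sym q′) q))))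
                            (ind-yes (par ws (black u) ≟ᴹ just (white i)) q)

            -- The recurrence of `block` includes an exit to the parent, but at the root no letter
            -- realises it: γ p, the fictitious exit that ends the walk, is left over.
            root-step : par ws (black u) ≡ nothing → Φ ws loc ≋ Σᴿ T ⊕ γ p
            root-step q = trans (Φ≋H p≡) (trans (total p) (trans (sym (+-assoc _ _ _)) (+-congʳ (sym (trans (sum-cong-≋ T≋term) (trans Σterm
              (+-congˡ (trans (+-congˡ (trans (*-congʳ (ι-cong zero-ups)) (0⊗ (γ p)))) (+-identityʳ _)))))))))
              where
              zero-ups : sum upInd ≡ 0
              zero-ups = sum-0 λ i → no-up {i} λ q′ → case (≡.trans (≡.sym q) q′)
                where
                case : ∀ {x : Vertex N n} → nothing ≢ just x
                case ()

      module WhiteRec {v : Fin N} {i : Fin n} {w : List (Vertex N n)} {on loc} (inv : Inv m v (white i) w on loc) where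
        open Inv inv

        ws : List (Vertex N n)
        ws = white i ∷ w
        s  = loc i
        j  = count s
        k  = suc full ∸ exits ws i
        t  = suc r ∸ j
        es = exitsTo ws i s
        K  = unseenW ws
        rest = Πˢ.except i (wfac ws loc)
        P  = Πˢ.Π (bfac ws) ⊠ rest
        c  = ι (unseenB ws ! * K !)
        Qnew = Q (k ∸ 1) (suc j) j (es [ j ≔ᴺ 1 ])
        open SlotsInv (slotsInv i (here ≡.refl))

        -- δ is the weight of everything but the exit sequence at i, so a step to a known vertex
        -- changes only the integer in front of it. α is the weight after the discovery of one
        -- particular vertex.
        δ α : Carrier
        δ = c ⊗ (Λ ↑ t ⊠ P) K
        α = ι ((unseenB ws ∸ 1) ! * K !) ⊗ ((ι Qnew ∙ Λ ↑ t) ⊠ P) K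

        Qδ : ∀ q → c ⊗ ((ι q ∙ Λ ↑ t) ⊠ P) K ≋ ι q ⊗ δ
        Qδ q = trans (*-congˡ (at (∙-⊠ (ι q) (Λ ↑ t) P) K)) (x∙yz≈y∙xz c (ι q) _)

        private
          swapˢ : ∀ X Y → X ⊠ (Y ⊠ rest) ≃ Y ⊠ (X ⊠ rest)
          swapˢ X Y = CSemigroup.x∙yz≈y∙xz S.*-commutativeSemigroup X Y rest

        Φ≋Qδ : Φ ws loc ≋ ι (Q k j (last s) es) ⊗ δ
        Φ≋Qδ = trans (*-congˡ (at (S.trans (⊠-cong S.refl (S.trans (Πˢ.split i (wfac ws loc)) (⊠-cong (S.reflexive (wfac-seen loc (here ≡.refl))) S.refl)))
          (swapˢ (Πˢ.Π (bfac ws)) (whiteOf ws i s))) K)) (Qδ (Q k j (last s) es))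

        rem-step : ∀ y → suc full ∸ exits (y ∷ ws) i ≡ k ∸ 1
        rem-step y = ≡.trans (≡.cong (suc full ∸_) (≡.trans (Step.exits-step (white i) w y ≡.refl) (ℕ.+-comm 1 (exits ws i))))
                             (≡.sym (ℕ.∸-+-assoc (suc full) (exits ws i) 1))

        other-whites : ∀ u s′ → Πˢ.except i (wfac (black u ∷ ws) (loc [ i ≔ˢ s′ ])) ≃ rest
        other-whites u s′ = Πˢ.except-cong i λ i′ ne → S.trans (go i′ ne (white i′ ∈? (black u ∷ ws)))
            (wfac-keep (white i) w (black u) loc (ne ∘ inj₂-injective) λ ())
          where
          go : ∀ i′ → i′ ≢ i → Dec (white i′ ∈ˡ black u ∷ ws) → wfac (black u ∷ ws) (loc [ i ≔ˢ s′ ]) i′ ≃ wfac (black u ∷ ws) loc i′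
          go i′ ne (yes p) = S.reflexive (≡.trans (wfac-seen (loc [ i ≔ˢ s′ ]) p) (≡.trans (≡.cong (whiteOf (black u ∷ ws) i′) (≔ˢ-miss loc ne)) (≡.sym (wfac-seen loc p))))
          go i′ ne (no p)  = S.reflexive (≡.trans (wfac-unseen (loc [ i ≔ˢ s′ ]) p) (≡.sym (wfac-unseen loc p)))

        whites-step : ∀ u s′ → Πˢ.Π (wfac (black u ∷ ws) (loc [ i ≔ˢ s′ ])) ≃ whiteOf (black u ∷ ws) i s′ ⊠ rest
        whites-step u s′ = S.trans (Πˢ.split i (wfac (black u ∷ ws) (loc [ i ≔ˢ s′ ]))) (⊠-cong
          (S.reflexive (≡.trans (wfac-seen (loc [ i ≔ˢ s′ ]) (there (here ≡.refl))) (≡.cong (whiteOf (black u ∷ ws) i) (≔ˢ-hit loc i))))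
          (other-whites u s′))

        Φ-known : ∀ a → a < j → a ≢ last s × es a < m → Φ (black (label s a) ∷ ws) (loc [ i ≔ˢ slots j a (label s) ])
                  ≋ ι (Q (k ∸ 1) j a (bump es a)) ⊗ δ
        Φ-known a lt ok = trans (*-cong
            (ι-cong (≡.cong₂ (λ b k → b ! * k !) (unseenB-keep {y} {ws} (inj₂ y∈)) (unseenW-keep {y} {ws} (inj₂ y∈))))
            (trans (at (S.trans (⊠-cong blacks (S.trans (whites-step (label s a) _) (⊠-cong white-factor S.refl)))
                          (swapˢ (Πˢ.Π (bfac ws)) (ι (Q (k ∸ 1) j a (bump es a)) ∙ Λ ↑ t))) (unseenW (y ∷ ws)))
               (reflexive (≡.cong (((ι (Q (k ∸ 1) j a (bump es a)) ∙ Λ ↑ t) ⊠ P)) (unseenW-keep {y} {ws} (inj₂ y∈))))))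
          (Qδ (Q (k ∸ 1) j a (bump es a)))
          where
          y  = black (label s a)
          y∈ = label-seen a lt
          blacks : Πˢ.Π (bfac (y ∷ ws)) ≃ Πˢ.Π (bfac ws)
          blacks = Πˢ.Π-cong λ u → go u (u Fin.≟ label s a)
            where
            go : ∀ u → Dec (u ≡ label s a) → bfac (y ∷ ws) u ≃ bfac ws u
            go u (no ne) = bfac-keep (white i) w y (λ ()) (ne ∘ inj₁-injective)
            go u (yes ≡.refl) = S.trans (S.reflexive (bfac-seen {y ∷ ws} (here ≡.refl))) (S.trans
              (blackOf-cong (Step.ups-keep (white i) w y y∈ λ ()) (λ i′ → Step.downs-keep (white i) w y λ ())) (S.sym (S.reflexive (bfac-seen y∈))))
          exits-new : ∀ b → b < j → exitsTo (y ∷ ws) i (slots j a (label s)) b ≡ bump es a b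
          exits-new b lt′ = go (b ℕ.≟ a)
            where
            go : Dec (b ≡ a) → exitsTo (y ∷ ws) i (slots j a (label s)) b ≡ bump es a b
            go (yes ≡.refl) = ≡.trans (steps-hit y (white i) w) (≡.sym (bump-hit es a))
            go (no ne) = ≡.trans (steps-miss y (white i) w (inj₂ λ e → ne (label-inj lt′ lt (inj₁-injective e)))) (≡.sym (bump-miss es ne))
          white-factor : whiteOf (y ∷ ws) i (slots j a (label s)) ≃ ι (Q (k ∸ 1) j a (bump es a)) ∙ Λ ↑ t
          white-factor = ∙-cong (ι-cong (≡.trans (Q-cong (suc full ∸ exits (y ∷ ws) i) j a exits-new)
            (≡.cong (λ k → Q k j a (bump es a)) (rem-step y)))) S.refl

        -- A vertex just discovered has m exits to its parent and no children, so its own factor is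
        -- `Λ`. It replaces one of the factors `Λ` that the hyperedge held for its undiscovered
        -- vertices.
        Φ-new : ∀ u → black u ∉ˡ ws → Φ (black u ∷ ws) (loc [ i ≔ˢ slots (suc j) j (label s [ j ≔ᴺ u ]) ]) ≋ α
        Φ-new u u∉ = *-cong
            (ι-cong (≡.cong₂ (λ b k → b ! * k !) (≡.cong (_∸ 1) (≡.sym (unseenB-new u∉))) K-keep))
            (trans (at (S.trans (⊠-cong blacks (S.trans (whites-step u s′) (⊠-cong white-factor S.refl)))
                (S.trans (CSemigroup.interchange S.*-commutativeSemigroup Λ (Πˢ.Π (bfac ws)) (ι Qnew ∙ Λ ↑ (r ∸ j)) rest)
                  (⊠-cong powers S.refl))) (unseenW (y ∷ ws)))
              (reflexive (≡.cong ((ι Qnew ∙ Λ ↑ t) ⊠ P) K-keep)))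
          where
          y = black u
          K-keep = unseenW-keep {y} {ws} (inj₁ λ _ ())
          s′ = slots (suc j) j (label s [ j ≔ᴺ u ])
          no-steps : ∀ z → steps (y ∷ ws) (black u) z ≡ 0
          no-steps z with steps (y ∷ ws) (black u) z in eq
          ... | zero  = ≡.refl
          ... | suc _ = contradiction (proj₁ (steps⇒∈ ws (black u) z (≡.subst (0 <_) (≡.trans (≡.sym eq) (steps-miss y (white i) w (inj₁ λ ()))) (s≤s z≤n)))) u∉
          no-downs : ∀ i′ → downs (y ∷ ws) u i′ ≡ 0
          no-downs i′ = downs-no λ q → u∉ (proj₂ (par⇒∈ ws (Step.par-back (white i) w y {white i′} (λ ()) q)))
          new-black-factor : bfac (y ∷ ws) u ≃ Λ ⊠ bfac ws u
          new-black-factor = S.trans (S.reflexive (bfac-seen {y ∷ ws} (here ≡.refl))) (S.trans (S.trans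
              (∙-cong ones (S.reflexive (≡.cong₂ block
                (≡.trans (ups-just (par-new y (white i) w u∉)) (≡.cong (m ∸_) (no-steps (white i))))
                (sum-0 no-downs))))
              (S.trans (1∙ _) (S.reflexive (≡.cong (λ q → inv! m′ ∙ Bᴳ q) (ℕ.+-identityʳ m′)))))
            (S.trans (S.sym (S.*-identityʳ Λ)) (⊠-cong S.refl (S.reflexive (≡.sym (bfac-unseen u∉))))))
            where
            ones : residual! (y ∷ ws) u ≋ 1#
            ones = trans (Πᶜ.Π-cong λ i′ → trans (reflexive (≡.cong inv! (no-downs i′))) inv!-0)
              (MonoidSum.sum-replicate-zero (CommutativeSemiring.*-commutativeMonoid R) n)
          blacks : Πˢ.Π (bfac (y ∷ ws)) ≃ Λ ⊠ Πˢ.Π (bfac ws)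
          blacks = Πˢ.replace u new-black-factor λ u′ ne → bfac-keep (white i) w y (λ ()) (ne ∘ inj₁-injective)
          exits-new : ∀ b → b < suc j → exitsTo (y ∷ ws) i s′ b ≡ (es [ j ≔ᴺ 1 ]) b
          exits-new b (s≤s le) = go (b ℕ.≟ j)
            where
            fresh : steps ws (white i) (black u) ≡ 0
            fresh with steps ws (white i) (black u) in eq
            ... | zero  = ≡.refl
            ... | suc _ = contradiction (proj₂ (steps⇒∈ ws (white i) (black u) (≡.subst (0 <_) (≡.sym eq) (s≤s z≤n)))) u∉
            at-label : Fin N → ℕ
            at-label x = steps (y ∷ ws) (white i) (black x)
            go : Dec (b ≡ j) → exitsTo (y ∷ ws) i s′ b ≡ (es [ j ≔ᴺ 1 ]) b
            go (yes ≡.refl) = ≡.trans (≡.cong at-label (≔ᴺ-hit (label s) j))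
              (≡.trans (steps-hit y (white i) w) (≡.trans (≡.cong suc fresh) (≡.sym (≔ᴺ-hit es j))))
            go (no ne) = ≡.trans (≡.cong at-label (≔ᴺ-miss (label s) ne))
              (≡.trans (steps-miss y (white i) w (inj₂ λ e → u∉ (≡.subst (_∈ˡ ws) e (label-seen b (ℕ.≤∧≢⇒< le ne))))) (≡.sym (≔ᴺ-miss es ne)))
          white-factor : whiteOf (y ∷ ws) i s′ ≃ ι Qnew ∙ Λ ↑ (r ∸ j)
          white-factor = ∙-cong (ι-cong (≡.trans (Q-cong (suc full ∸ exits (y ∷ ws) i) (suc j) j exits-new)
            (≡.cong (λ k → Q k (suc j) j (es [ j ≔ᴺ 1 ])) (rem-step y)))) S.refl
          powers : Λ ⊠ (ι Qnew ∙ Λ ↑ (r ∸ j)) ≃ ι Qnew ∙ Λ ↑ t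
          powers with j ℕ.≤? r
          ... | yes j≤r = S.trans (⊠-∙ (ι Qnew) Λ (Λ ↑ (r ∸ j))) (∙-congˢ (ι Qnew) (S.reflexive (≡.cong (Λ ↑_) (≡.sym (ℕ.+-∸-assoc 1 j≤r)))))
          -- With more than r known vertices the truncated exponents no longer differ by one, but
          -- then `Qnew` is 0.
          ... | no j≰r = S.trans (⊠-∙ (ι Qnew) Λ (Λ ↑ (r ∸ j))) (S.trans (∙-cong zeroQ S.refl) (S.trans (0∙ _) (S.sym (S.trans (∙-cong zeroQ S.refl) (0∙ _)))))
            where
            zeroQ : ι Qnew ≋ 0#
            zeroQ = ι-cong (Q-overfull (k ∸ 1) (suc j) j (es [ j ≔ᴺ 1 ]) (s≤s (ℕ.≰⇒> j≰r)))

        private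
          known : Fin N → ℕ
          known u = sum {j} λ a → ind (label s (toℕ a) Fin.≟ u) * Qknown (k ∸ 1) j (last s) es (toℕ a)

          Σknown : sum known ≡ sum {j} λ a → Qknown (k ∸ 1) j (last s) es (toℕ a)
          Σknown = ≡.trans (∑-comm {N} {j} (λ u a → ind (label s (toℕ a) Fin.≟ u) * Qknown (k ∸ 1) j (last s) es (toℕ a)))
            (sum-cong-≗ {j} λ a → let lab = label s (toℕ a) ; q = Qknown (k ∸ 1) j (last s) es (toℕ a) in
              ≡.trans (sum-single lab (λ u → ind (lab Fin.≟ u) * q) λ u ne → ≡.cong (_* q) (ind-no (lab Fin.≟ u) (ne ∘ ≡.sym)))
                (≡.trans (≡.cong (_* q) (ind-yes (lab Fin.≟ lab) ≡.refl)) (ℕ.+-identityʳ q)))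

          known-none : ∀ u → (∀ a → a < j → label s a ≢ u) → known u ≡ 0
          known-none u ne = sum-0 {j} λ a → ≡.cong (_* Qknown (k ∸ 1) j (last s) es (toℕ a))
            (ind-no (label s (toℕ a) Fin.≟ u) (ne (toℕ a) (Fin.toℕ<n a)))

          known-label : ∀ a → a < j → known (label s a) ≡ Qknown (k ∸ 1) j (last s) es a
          known-label a lt = ≡.trans (sum-single a′ _ λ b ne → ≡.cong (_* Qknown (k ∸ 1) j (last s) es (toℕ b))
              (ind-no (label s (toℕ b) Fin.≟ label s a) λ e → ne (Fin.toℕ-injective (≡.trans (label-inj (Fin.toℕ<n b) lt e) (≡.sym (Fin.toℕ-fromℕ< lt))))))
            (≡.trans (≡.cong (λ b → ind (label s b Fin.≟ label s a) * Qknown (k ∸ 1) j (last s) es b) (Fin.toℕ-fromℕ< lt))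
              (≡.trans (≡.cong (_* Qknown (k ∸ 1) j (last s) es a) (ind-yes (label s a Fin.≟ label s a) ≡.refl)) (ℕ.+-identityʳ _)))
            where
            a′ = fromℕ< lt

          term : Fin N → Carrier
          term u = ι (unseen ws (black u)) ⊗ α ⊕ ι (known u) ⊗ δ

          eval : ∀ {u a b} → unseen ws (black u) ≡ a → known u ≡ b → term u ≋ ι a ⊗ α ⊕ ι b ⊗ δ
          eval ≡.refl ≡.refl = refl

        module _ (nonfinal : k ≡ 1 → ¬ Final j (last s) es)
          (room : unseenB ws ≡ 0 → suc r ≤ j ⊎ ∃ λ i′ → white i′ ∈ˡ ws × suc r < count (loc i′))
          (T : Fin N → Carrier)
          (T-new     : ∀ u → black u ∉ˡ ws → T u ≋ Φ (black u ∷ ws) (loc [ i ≔ˢ slots (suc j) j (label s [ j ≔ᴺ u ]) ]))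
          (T-known   : ∀ a → a < j → a ≢ last s × es a < m → T (label s a) ≋ Φ (black (label s a) ∷ ws) (loc [ i ≔ˢ slots j a (label s) ]))
          (T-illegal : ∀ a → a < j → ¬ (a ≢ last s × es a < m) → T (label s a) ≋ 0#)
          (T-none    : ∀ u → black u ∈ˡ ws → (∀ a → a < j → label s a ≢ u) → T u ≋ 0#)
          where

          private
            T≋term : ∀ u → T u ≋ term u
            T≋term u = go (black u ∈? ws) (Fin.any? {n = j} λ a → label s (toℕ a) Fin.≟ u)
              where
              illegal : ∀ a → a < j → Dec (a ≢ last s × es a < m) → T (label s a) ≋ ι (Qknown (k ∸ 1) j (last s) es a) ⊗ δ
              illegal a lt (yes ok) = trans (trans (T-known a lt ok) (Φ-known a lt ok))
                (*-congʳ (ι-cong (≡.sym (≡.trans (≡.cong (_* Q (k ∸ 1) j a (bump es a)) (ind-yes (legal? (last s) es a) ok)) (ℕ.+-identityʳ _)))))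
              illegal a lt (no ¬ok) = trans (T-illegal a lt ¬ok) (sym (trans (*-congʳ (ι-cong
                (≡.cong (_* Q (k ∸ 1) j a (bump es a)) (ind-no (legal? (last s) es a) ¬ok)))) (zeroˡ δ)))
              go : Dec (black u ∈ˡ ws) → Dec (∃ λ (a : Fin j) → label s (toℕ a) ≡ u) → T u ≋ term u
              go (no u∉) _ = trans (trans (T-new u u∉) (Φ-new u u∉)) (sym (trans
                (eval (unseen-∉ u∉) (known-none u λ a lt e → u∉ (≡.subst (λ x → black x ∈ˡ ws) e (label-seen a lt))))
                (trans (+-cong (trans (*-congʳ ι-1) (*-identityˡ α)) (zeroˡ δ)) (+-identityʳ α))))
              go (yes u∈) (yes (a , ≡.refl)) = trans (illegal (toℕ a) (Fin.toℕ<n a) (legal? (last s) es (toℕ a)))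
                (sym (trans (eval (unseen-∈ u∈) (known-label (toℕ a) (Fin.toℕ<n a))) (trans (+-congʳ (zeroˡ α)) (+-identityˡ _))))
              go (yes u∈) (no ¬a) = trans (T-none u u∈ ne) (sym (trans (eval (unseen-∈ u∈) (known-none u ne))
                (trans (+-cong (zeroˡ α) (zeroˡ δ)) (+-identityʳ 0#))))
                where
                ne : ∀ a → a < j → label s a ≢ u
                ne a lt e = ¬a (fromℕ< lt , ≡.trans (≡.cong (label s) (Fin.toℕ-fromℕ< lt)) e)

            overfull : suc r < j → ι Qnew ⊗ δ ≋ 0#
            overfull lt = trans (*-congʳ (ι-cong (Q-overfull (k ∸ 1) (suc j) j (es [ j ≔ᴺ 1 ]) (ℕ.m<n⇒m<1+n lt)))) (zeroˡ δ)

            vanish : suc r ≤ j ⊎ (∃ λ i′ → white i′ ∈ˡ ws × suc r < count (loc i′)) → ι Qnew ⊗ δ ≋ 0#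
            vanish (inj₁ le) = trans (*-congʳ (ι-cong (Q-overfull (k ∸ 1) (suc j) j (es [ j ≔ᴺ 1 ]) (s≤s le)))) (zeroˡ δ)
            vanish (inj₂ (i′ , i′∈ , lt)) with i′ Fin.≟ i
            ... | yes ≡.refl = overfull lt
            ... | no ne = trans (*-congˡ (trans (*-congˡ (at P≃𝟘 K)) (zeroʳ c))) (zeroʳ (ι Qnew))
              where
              factor : wfac ws loc i′ ≃ 𝟘
              factor = S.trans (S.reflexive (wfac-seen loc i′∈)) (S.trans (∙-cong (ι-cong
                (Q-overfull (suc full ∸ exits ws i′) (count (loc i′)) (last (loc i′)) (exitsTo ws i′ (loc i′)) lt)) S.refl) (0∙ _))
              rest≃𝟘 : rest ≃ 𝟘
              rest≃𝟘 = S.trans (Πˢ.split i′ _) (S.trans (⊠-cong (S.trans (S.reflexive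
                (≡.cong (λ b → if b then 𝟙 else wfac ws loc i′) (dec-false (i′ Fin.≟ i) ne))) factor) S.refl) (S.zeroˡ _))
              P≃𝟘 : Λ ↑ t ⊠ P ≃ 𝟘
              P≃𝟘 = S.trans (⊠-cong S.refl (S.trans (⊠-cong S.refl rest≃𝟘) (S.zeroʳ _))) (S.zeroʳ _)

            -- While b > 0 vertices are unseen, this is b (b - 1)! = b!. For b = 0 no letter
            -- realises a discovery, and the right-hand side vanishes because of `room`: either i is
            -- full already or the factor of an overfull hyperedge is 0.
            new-total : ι (unseenB ws) ⊗ α ≋ ι Qnew ⊗ δ
            new-total = go (unseenB ws) ≡.refl
              where
              X = ((ι Qnew ∙ Λ ↑ t) ⊠ P) K
              go : ∀ b → unseenB ws ≡ b → ι b ⊗ (ι ((b ∸ 1) ! * K !) ⊗ X) ≋ ι Qnew ⊗ δ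
              go zero    e = trans (zeroˡ _) (sym (vanish (room e)))
              go (suc b) e = trans (sym (*-assoc _ _ _)) (trans (*-congʳ (trans (sym (ι-* (suc b) (b ! * K !)))
                (ι-cong (≡.trans (≡.sym (ℕ.*-assoc (suc b) (b !) (K !))) (≡.cong (λ b → b ! * K !) (≡.sym e)))))) (Qδ Qnew))

          white-step : Φ ws loc ≋ Σᴿ T
          white-step = trans Φ≋Qδ (trans (*-congʳ (trans (ι-cong (Q-unfold k j (last s) es nonfinal)) (ι-+ (sum {j} λ a → Qknown (k ∸ 1) j (last s) es (toℕ a)) Qnew)))
            (trans (distribʳ δ _ _) (sym (trans (sum-cong-≋ T≋term) (trans (Σᴿ-⊕ (λ u → ι (unseen ws (black u)) ⊗ α) (λ u → ι (known u) ⊗ δ))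
              (trans (+-cong (trans (Σᴿ-ι⊗ (λ u → unseen ws (black u)) α) new-total)
                             (trans (Σᴿ-ι⊗ known δ) (*-congʳ (ι-cong Σknown)))) (+-comm _ _)))))))

-- Completions of a partial walk

-- Each element of the type occurs exactly once in the list, in the form in which sums over the list
-- use it.
Once : ∀ {A : Set} → List A → Set
Once xs = ∀ y (g : _ → ℕ) → (∀ x → x ≢ y → g x ≡ 0) → lsum xs g ≡ g y

Once-vectors : ∀ {A : Set} {xs : List A} → Once xs → ∀ k → Once (vectors xs k)
Once-vectors once zero [] g z = ℕ.+-identityʳ _
Once-vectors {xs = xs} once (suc k) (y ∷ ys) g z = ≡.trans (lsum-vectors xs k g)
  (≡.trans (once y (λ x → lsum (vectors xs k) (λ v → g (x ∷ v)))
      λ x ne → ≡.trans (lsum-cong (vectors xs k) λ v → z (x ∷ v) (ne ∘ proj₁ ∘ ∷-injective)) (lsum-0 (vectors xs k)))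
    (Once-vectors once k ys (λ v → g (y ∷ v)) λ v ne → z (y ∷ v) (ne ∘ proj₂ ∘ ∷-injective)))

Once-sides : Once (inside ∷ outside ∷ [])
Once-sides true  g z = ≡.trans (≡.cong (g true +_) (≡.trans (ℕ.+-identityʳ _) (z false λ ()))) (ℕ.+-identityʳ _)
Once-sides false g z = ≡.trans (≡.cong (_+ (g false + 0)) (z true λ ())) (ℕ.+-identityʳ _)

Once-hypergraphs : ∀ N n → Once (hypergraphs N n)
Once-hypergraphs N n = Once-vectors (Once-vectors Once-sides N) n

module WalkCounts (r m n : ℕ) where

  private
    N : ℕ
    N = suc (r * n)

  abstract

    valid : List (Vertex N n) → ℕ
    valid w = lsum (hypergraphs N n) λ T → ind (isHypertree? r n T) * sum (λ v → ind (isWalk? T m v w))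

    valid-def : ∀ w → valid w ≡ lsum (hypergraphs N n) λ T → ind (isHypertree? r n T) * sum (λ v → ind (isWalk? T m v w))
    valid-def w = ≡.refl

    valid-0 : ∀ {w} → (∀ {T v} → IsHypertree r n T → ¬ IsWalk T m v w) → valid w ≡ 0
    valid-0 {w} no-walk = ≡.trans (lsum-cong (hypergraphs N n) λ T → go T (isHypertree? r n T)) (lsum-0 (hypergraphs N n))
      where
      go : ∀ T (d : Dec (IsHypertree r n T)) → ind d * sum (λ v → ind (isWalk? T m v w)) ≡ 0
      go T (no _)    = ≡.refl
      go T (yes hyp) = ≡.trans (ℕ.+-identityʳ _) (sum-0 λ v → ind-no (isWalk? T m v w) (no-walk hyp))

    valid-1 : ∀ {w T v} → IsHypertree r n T → IsWalk T m v w →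
              (∀ {T′ v′} → IsHypertree r n T′ → IsWalk T′ m v′ w → T′ ≡ T × v′ ≡ v) → valid w ≡ 1
    valid-1 {w} {T} {v} hyp walk unique = ≡.trans
      (Once-hypergraphs N n T _ λ T′ ne → go T′ ne (isHypertree? r n T′))
      (≡.trans (≡.cong₂ _*_ (ind-yes (isHypertree? r n T) hyp)
        (≡.trans (sum-single v _ λ v′ ne → ind-no (isWalk? T m v′ w) λ walk′ → ne (proj₂ (unique hyp walk′))) (ind-yes (isWalk? T m v w) walk))) ≡.refl)
      where
      go : ∀ T′ → T′ ≢ T → (d : Dec (IsHypertree r n T′)) → ind d * sum (λ v → ind (isWalk? T′ m v w)) ≡ 0
      go T′ ne (no _)     = ≡.refl
      go T′ ne (yes hyp′) = ≡.trans (ℕ.+-identityʳ _) (sum-0 λ v → ind-no (isWalk? T′ m v w) λ walk′ → ne (proj₁ (unique hyp′ walk′)))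

    completions : ℕ → List (Vertex N n) → ℕ
    completions k w = wordSum k λ p → valid (p ++ w)

    completions-suc : ∀ k w → completions (suc k) w ≡ vsum λ y → completions k (y ∷ w)
    completions-suc k w = ≡.trans (wordSum-snoc k λ p → valid (p ++ w))
      (vsum-cong λ y → wordSum-cong k λ p → ≡.cong valid (++-assoc p (y ∷ []) w))

    completions-0 : ∀ k {w} → (∀ p {T v} → IsHypertree r n T → ¬ IsWalk T m v (p ++ w)) → completions k w ≡ 0
    completions-0 k none-valid = wordSum-0 k λ p → valid-0 (none-valid p)

    completions-def : ∀ k w → completions k w ≡ wordSum k λ p → valid (p ++ w)
    completions-def k w = ≡.refl

    completions-zero : ∀ w → completions 0 w ≡ valid w
    completions-zero w = ≡.refl

double-injective : ∀ a b → a + a ≡ b + b → a ≡ b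
double-injective zero    zero    e = ≡.refl
double-injective (suc a) (suc b) e = ≡.cong suc (double-injective a b (ℕ.suc-injective
  (≡.trans (≡.sym (ℕ.+-suc a a)) (≡.trans (ℕ.suc-injective e) (ℕ.+-suc b b)))))

-- The weight of a partial walk is the number of its completions.

module Main (R : CommutativeSemiring 0ℓ 0ℓ)
  (inv! : ℕ → CommutativeSemiring.Carrier R)
  (inv!-0 : CommutativeSemiring._≈_ R (inv! 0) (CommutativeSemiring.1# R))
  (inv!-suc : ∀ k → CommutativeSemiring._≈_ R (CommutativeSemiring._*_ R (LocalSeries.ι R (suc k)) (inv! (suc k))) (inv! k))
  (r′ m′ n : ℕ) where

  private
    r N : ℕ
    r = suc r′
    N = suc (r * n)

  open LocalSeries R
  open LocalCount r (suc m′)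
  open Weights R inv! inv!-0 inv!-suc r m′ N n public
  open Residuals {N} {n} m
  open WalkCounts r m n public
  open Validity r m′ n

  module _ (G : PS) (G0 : G 0 ≋ 0#) (G-eq : G ≃ shift (ι κ ∙ Λ G G0 ↑ r)) where

    private
      Φ′ = Φ G G0
      bf = bfac G G0
      wf = wfac G G0

    total-length : ℕ
    total-length = 2 * m * (suc r * n)

    total-length≡ : total-length ≡ n * full + n * full
    total-length≡ = ≡.trans (ℕ.*-assoc 2 m (suc r * n)) (≡.trans (≡.cong (m * (suc r * n) +_) (ℕ.+-identityʳ _)) (≡.cong₂ _+_ half half))
      where
      half : m * (suc r * n) ≡ n * full
      half = ≡.trans (ℕ.*-comm m (suc r * n)) (≡.trans (≡.cong (_* m) (ℕ.*-comm (suc r) n)) (ℕ.*-assoc n (suc r) m))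

    dead-factor : ∀ {ws i} loc → white i ∈ˡ ws → Q (Remaining ws i) (count (loc i)) (last (loc i)) (exitsTo ws i (loc i)) ≡ 0 → wf ws loc i ≃ 𝟘
    dead-factor {ws} {i} loc i∈ e = S.trans (S.reflexive (wfac-seen G G0 loc i∈)) (S.trans (∙-cong (ι-cong e) S.refl) (0∙ _))

    complete-factor : ∀ {ws i} loc → white i ∈ˡ ws → Complete ws loc i → wf ws loc i ≃ 𝟙
    complete-factor {ws} {i} loc i∈ (e , final@(_ , c , _)) = S.trans (S.reflexive (wfac-seen G G0 loc i∈))
      (S.trans (∙-cong (trans (ι-cong one) ι-1) (S.reflexive (≡.cong (Λ G G0 ↑_) (≡.trans (≡.cong (suc r ∸_) c) (ℕ.n∸n≡0 (suc r)))))) (1∙ 𝟙))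
      where
      one : Q (Remaining ws i) (count (loc i)) (last (loc i)) (exitsTo ws i (loc i)) ≡ 1
      one = ≡.trans (≡.cong (λ k → Q k (count (loc i)) (last (loc i)) (exitsTo ws i (loc i)))
              (≡.trans (≡.cong (suc full ∸_) e) (ℕ.m+n∸n≡m 1 full)))
            (ind-yes (final? (count (loc i)) (last (loc i)) (exitsTo ws i (loc i))) final)

    module _ {v u : Fin N} {w : List (Vertex N n)} {on loc} (inv : Inv m v (black u) w on loc) (root : par (black u ∷ w) (black u) ≡ nothing) where
      open Inv inv
      open AtRoot inv root
      open Facts inv

      private
        ws : List (Vertex N n)
        ws = black u ∷ w
        module BR = BlackRec G G0 G-eq inv

      residual-1 : ∀ u′ → (∀ i → downs ws u′ i ≡ 0) → residual! ws u′ ≋ 1#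
      residual-1 u′ z = trans (Πᶜ.Π-cong λ i → trans (reflexive (≡.cong inv! (z i))) inv!-0)
        (MonoidSum.sum-replicate-zero (CommutativeSemiring.*-commutativeMonoid R) n)

      module _ (complete : ∀ i → white i ∈ˡ ws → Complete ws loc i) where

        white-factors : Πˢ.Π (wf ws loc) ≃ 𝟙
        white-factors = Πˢ-𝟙 λ i → go i (white i ∈? ws)
          where
          go : ∀ i → Dec (white i ∈ˡ ws) → wf ws loc i ≃ 𝟙
          go i (yes i∈) = complete-factor loc i∈ (complete i i∈)
          go i (no i∉)  = S.reflexive (wfac-unseen G G0 loc i∉)

        no-downs : ∀ u′ i → downs ws u′ i ≡ 0
        no-downs u′ i with par ws (white i) ≟ᴹ just (black u′)
        ... | yes q = complete⇒downs (complete i (proj₁ (par⇒∈ ws q))) q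
        ... | no ¬q = downs-no ¬q

        black-factors : Πˢ.except u (bf ws) ≃ 𝟙
        black-factors = Πˢ-𝟙 λ u′ → go u′ (u′ Fin.≟ u) (black u′ ∈? ws)
          where
          go : ∀ u′ (d : Dec (u′ ≡ u)) → Dec (black u′ ∈ˡ ws) → (if does d then 𝟙 else bf ws u′) ≃ 𝟙
          go u′ (yes _) _ = S.refl
          go u′ (no ne) (no u∉) = S.reflexive (bfac-unseen G G0 u∉)
          go u′ (no ne) (yes u∈) = S.trans (S.reflexive (bfac-seen G G0 u∈)) (S.trans
              (∙-cong (residual-1 u′ (no-downs u′)) (S.reflexive (≡.cong₂ (block G G0) ups-0 (sum-0 (no-downs u′))))) (1∙ 𝟙))
            where
            ups-0 : ups ws u′ ≡ 0
            ups-0 with par ws (black u′) in q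
            ... | nothing = contradiction (inj₁-injective (≡.trans (v-root u∈ q) (≡.sym (v-root (here ≡.refl) root)))) ne
            ... | just z with up-white q
            ... | i , ≡.refl = complete⇒ups (complete i (proj₂ (par⇒∈ ws q))) q

      -- Unless `block 0 E` is 0, the root has no exits left. Then either another factor is 0, or
      -- all explored hyperedges are complete. In the latter case the product is the constant 1,
      -- whose coefficient of x^K is 0 for K > 0; and K = 0 would mean that the word has its full
      -- length, although letters are missing.
      root-vanish : ∀ {k} → List.length ws + suc k ≡ suc total-length → BR.γ 0 ≋ 0#
      root-vanish {k} len = go (sum (downs ws u)) ≡.refl
        where
        vanish : ∀ {X} → X ⊠ BR.P ≃ 𝟘 → BR.c ⊗ (X ⊠ BR.P) BR.K ≋ 0#
        vanish e = trans (*-congˡ (at e BR.K)) (zeroʳ BR.c)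
        dead : Dead → BR.P ≃ 𝟘
        dead (dead-white i i∈ e) = S.trans (⊠-cong S.refl (Πˢ-𝟘 (wf ws loc) i (dead-factor loc i∈ e))) (S.zeroʳ _)
        dead (dead-black u′ ne u∈ e nz) = S.trans (⊠-cong (Πˢ-𝟘 (λ y → if does (y Fin.≟ u) then 𝟙 else bf ws y) u′ (S.trans
            (S.reflexive (≡.cong (λ b → if b then 𝟙 else bf ws u′) (dec-false (u′ Fin.≟ u) ne)))
            (S.trans (S.reflexive (bfac-seen G G0 u∈)) (S.trans (∙-congˢ (residual! ws u′) (blocked (sum (downs ws u′)) nz)) (mk λ k → zeroʳ _))))) S.refl) (S.zeroˡ _)
          where
          blocked : ∀ E → E ≢ 0 → block G G0 (ups ws u′) E ≃ 𝟘
          blocked zero    ne = contradiction ≡.refl ne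
          blocked (suc E) ne = S.reflexive (≡.cong (λ p → block G G0 p (suc E)) e)
        finished : (∀ i → downs ws u i ≡ 0) → (∀ i → white i ∈ˡ ws → Complete ws loc i) → ∀ K → BR.K ≡ K →
                   ((BR.D ∙ 𝟙) ⊠ BR.P) K ≋ 0#
        finished z complete (suc K) e = at (S.trans (⊠-cong (S.trans (∙-cong (residual-1 u z) S.refl) (1∙ 𝟙))
          (S.trans (⊠-cong (black-factors complete) (white-factors complete)) (S.*-identityˡ 𝟙))) (S.*-identityˡ 𝟙)) (suc K)
        finished z complete zero e = ⊥-elim (ℕ.m≢1+m+n (List.length ws) (≡.trans same-length (≡.trans (≡.sym len) (ℕ.+-suc _ k))))
          where
          seen : ∀ i → white i ∈ˡ ws
          seen i with white i ∈? ws
          ... | yes p = p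
          ... | no ¬p = contradiction (≤-trans (≤-reflexive (≡.sym (unseen-∉ ¬p))) (≤-trans (f≤sum (λ i → unseen ws (white i)) i) (≤-reflexive e))) λ ()
          all-exits : Σexits ws ≡ n * full
          all-exits = ≡.trans (sum-cong-≗ λ i → proj₁ (complete i (seen i))) (sum-const n full)
          same-length : List.length ws ≡ suc total-length
          same-length = ≡.trans (proj₁ (length-exits alt ends) u ≡.refl) (≡.cong suc (≡.trans (≡.cong₂ _+_ all-exits all-exits) (≡.sym total-length≡)))
        go : ∀ E → sum (downs ws u) ≡ E → BR.γ 0 ≋ 0#
        go (suc E) e = vanish (S.trans (⊠-cong (S.trans (∙-congˢ BR.D (S.reflexive (≡.cong (block G G0 0) e))) (mk λ k → zeroʳ _)) S.refl) (S.zeroˡ _))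
        go zero e with dead-or-complete downs-0
          where
          downs-0 : ∀ i → downs ws u i ≡ 0
          downs-0 i = ℕ.n≤0⇒n≡0 (≤-trans (f≤sum (downs ws u) i) (≤-reflexive e))
        ... | inj₁ d = vanish (S.trans (⊠-cong S.refl (dead d)) (S.zeroʳ _))
        ... | inj₂ complete = trans (*-congˡ (trans (at (⊠-cong (∙-congˢ BR.D (S.reflexive (≡.cong (block G G0 0) e))) S.refl) BR.K)
            (finished (λ i → ℕ.n≤0⇒n≡0 (≤-trans (f≤sum (downs ws u) i) (≤-reflexive e))) complete BR.K ≡.refl))) (zeroʳ BR.c)

    -- A full word has n(r + 1)m exits. So some hyperedge was left too often, or each exactly (r +
    -- 1)m times. A hyperedge left too often or without a final sequence excludes a walk and makes
    -- its factor 0. Otherwise the word is a walk on exactly one tree, and the weight is the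
    -- constant term 1 of `B 0`.
    base : ∀ {v u w on loc} → Inv m v (black u) w on loc → NoReturn (black u ∷ w) →
           List.length (black u ∷ w) ≡ suc total-length → ι (valid (black u ∷ w)) ≋ Φ′ (black u ∷ w) loc
    base {v} {u} {w} {on} {loc} inv nr len = go (Fin.any? λ i → full ℕ.<? exits ws i)
      where
      open Inv inv
      open Facts inv
      ws : List (Vertex N n)
      ws = black u ∷ w

      Σexits≡ : Σexits ws ≡ n * full
      Σexits≡ = double-injective _ _ (≡.trans (ℕ.suc-injective (≡.trans (≡.sym (proj₁ (length-exits alt ends) u ≡.refl)) len)) total-length≡)

      dead : ∀ i → white i ∈ˡ ws → Q (Remaining ws i) (count (loc i)) (last (loc i)) (exitsTo ws i (loc i)) ≡ 0 → Φ′ ws loc ≋ 0#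
      dead i i∈ e = trans (*-congˡ (at (S.trans (⊠-cong S.refl (Πˢ-𝟘 (wf ws loc) i (dead-factor loc i∈ e))) (S.zeroʳ _)) _)) (zeroʳ _)

      none-valid : (∀ {T v} → IsHypertree r n T → ¬ IsWalk T m v ws) → Φ′ ws loc ≋ 0# → ι (valid ws) ≋ Φ′ ws loc
      none-valid no-walk z = trans (ι-cong (valid-0 no-walk)) (sym z)

      all-complete : (∀ i → white i ∈ˡ ws × Complete ws loc i) → par ws (black u) ≡ nothing → ι (valid ws) ≋ Φ′ ws loc
      all-complete c root = trans (trans (ι-cong (valid-1 hypertree walk unique)) ι-1)
          (sym (trans (*-cong (trans (ι-cong (≡.cong₂ (λ b k → b ! * k !) no-black no-white)) ι-1)
            (trans (at factors (unseenW ws)) (trans (reflexive (≡.cong (Bᴳ G G0 0) no-white)) B-constant))) (*-identityˡ 1#)))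
        where
        seen : ∀ i → white i ∈ˡ ws
        seen i = proj₁ (c i)
        complete : ∀ i → white i ∈ˡ ws → Complete ws loc i
        complete i _ = proj₂ (c i)
        open Determined inv nr (s≤s z≤n) root seen (λ i → proj₂ (c i)) using (hypertree; walk; unique; all-black)
        no-white : unseenW ws ≡ 0
        no-white = sum-0 λ i → unseen-∈ (seen i)
        no-black : unseenB ws ≡ 0
        no-black = sum-0 λ u → unseen-∈ (all-black u)
        factors : product G G0 ws loc ≃ Bᴳ G G0 0
        factors = S.trans (⊠-cong (S.trans (Πˢ.split u (bf ws)) (⊠-cong (S.trans (S.reflexive (bfac-seen G G0 {ws} (here ≡.refl)))
              (S.trans (∙-cong (residual-1 inv root u (no-downs inv root complete u))
                  (S.trans (S.reflexive (≡.cong₂ (block G G0) (ups-root root) (sum-0 (no-downs inv root complete u)))) (∙-cong inv!-0 S.refl)))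
                (S.trans (1∙ _) (1∙ _))))
            (black-factors inv root complete))) (white-factors inv root complete))
          (S.trans (S.*-identityʳ _) (S.*-identityʳ _))
        B-constant : Bᴳ G G0 0 0 ≋ 1#
        B-constant = trans (at (B-zero inv! inv!-0 inv!-suc m′ G G0) 0) (trans (+-congˡ (trans (*-congˡ
          (trans (at (⊠-cong G-eq S.refl) 0) (at (shift-⊠ (ι κ ∙ Λ G G0 ↑ r) (Bᴳ G G0 m′)) 0))) (zeroʳ (inv! m′)))) (+-identityʳ 1#))

      go : Dec (∃ λ i → full < exits ws i) → ι (valid ws) ≋ Φ′ ws loc
      go (yes (i , lt)) = none-valid (λ hyp walk → ℕ.<⇒≢ lt (≡.sym (Whole.exits≡ inv hyp walk i)))
        (dead i (exits>0⇒∈ ws i (≤-trans (s≤s z≤n) lt)) (≡.cong (λ k → Q k (count (loc i)) (last (loc i)) (exitsTo ws i (loc i))) (ℕ.m≤n⇒m∸n≡0 lt)))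
      go (no ¬over) = finals (Fin.all? λ i → final? (count (loc i)) (last (loc i)) (exitsTo ws i (loc i)))
        where
        exits≡ : ∀ i → exits ws i ≡ full
        exits≡ = sum-squeeze (λ i → ℕ.≮⇒≥ λ lt → ¬over (i , lt)) (≤-reflexive (≡.trans (sum-const n full) (≡.sym Σexits≡)))
        seen : ∀ i → white i ∈ˡ ws
        seen i = exits>0⇒∈ ws i (≡.subst (0 <_) (≡.sym (exits≡ i)) (s≤s z≤n))
        finals : Dec (∀ i → Final (count (loc i)) (last (loc i)) (exitsTo ws i (loc i))) → ι (valid ws) ≋ Φ′ ws loc
        finals (no ¬final) with Fin.¬∀⟶∃¬ n (λ i → Final (count (loc i)) (last (loc i)) (exitsTo ws i (loc i)))
                                  (λ i → final? (count (loc i)) (last (loc i)) (exitsTo ws i (loc i))) ¬final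
        ... | i , ¬fin = none-valid (λ hyp walk → ¬fin (proj₂ (Whole.complete inv hyp walk i)))
          (dead i (seen i) (≡.trans (≡.cong (λ k → Q k (count (loc i)) (last (loc i)) (exitsTo ws i (loc i)))
            (≡.trans (≡.cong (suc full ∸_) (exits≡ i)) (ℕ.m+n∸n≡m 1 full))) (ind-no (final? (count (loc i)) (last (loc i)) (exitsTo ws i (loc i))) ¬fin)))
        finals (yes final) = rooted (par ws (black u)) ≡.refl
          where
          rooted : ∀ q → par ws (black u) ≡ q → ι (valid ws) ≋ Φ′ ws loc
          rooted nothing q = all-complete (λ i → seen i , exits≡ i , final i) q
          rooted (just (black _)) q = ⊥-elim (par⇒linked alt q)
          -- If the current vertex were a child of i, the last exit from i would have gone to it,
          -- whereas a final sequence ends with an exit to the parent.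
          rooted (just (white i)) q with SlotsInv.children (slotsInv i (seen i)) u q
          ... | a , lt , ≡.refl with () ← ≡.trans (≡.sym (SlotsInv.last-on (slotsInv i (seen i)) a lt (Tree.cur-on tree))) (proj₁ (final i))

    -- All rn + 1 vertices are seen, so the n hyperedges have rn children altogether; if none has
    -- more than r, each has exactly r.
    capacity : ∀ {v cur w on loc} → Inv m v cur w on loc → ∀ i → white i ∈ˡ cur ∷ w → unseenB (cur ∷ w) ≡ 0 →
               suc r ≤ count (loc i) ⊎ ∃ λ i′ → white i′ ∈ˡ cur ∷ w × suc r < count (loc i′)
    capacity {cur = cur} {w} {loc = loc} inv i i∈ none = go (suc r ℕ.≤? count (loc i)) (Fin.any? λ i′ → (white i′ ∈? ws) ×-dec (suc r ℕ.<? count (loc i′)))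
      where
      open Facts inv
      ws : List (Vertex N n)
      ws = cur ∷ w
      go : Dec (suc r ≤ count (loc i)) → Dec (∃ λ i′ → white i′ ∈ˡ ws × suc r < count (loc i′)) →
           suc r ≤ count (loc i) ⊎ ∃ λ i′ → white i′ ∈ˡ ws × suc r < count (loc i′)
      go (yes p) _       = inj₁ p
      go (no _)  (yes p) = inj₂ p
      go (no small) (no ¬over) = contradiction (sum-squeeze {f = kids} {g = λ _ → r} kids≤ total i)
          (ℕ.<⇒≢ (≤-trans (s≤s (≤-reflexive (kids-seen i i∈))) (lower (ℕ.≰⇒> small))))
        where
        lower : ∀ {k} → k < suc r → suc (k ∸ 1) ≤ r
        lower {zero}  _        = s≤s z≤n
        lower {suc k} (s≤s lt) = lt
        kids≤ : ∀ i′ → kids i′ ≤ r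
        kids≤ i′ with white i′ ∈? ws
        ... | no ¬p = ≤-trans (≤-reflexive (kids-unseen i′ ¬p)) z≤n
        ... | yes p = ≤-trans (≤-reflexive (kids-seen i′ p)) (ℕ.∸-monoˡ-≤ 1 (ℕ.≮⇒≥ λ lt → ¬over (i′ , p , lt)))
        total : sum {n} (λ _ → r) ≤ sum kids
        total = ≤-reflexive (≡.trans (sum-const n r) (≡.trans (ℕ.*-comm n r) (≡.sym (ℕ.suc-injective
          (≡.trans (≡.cong (_+ suc (sum kids)) (≡.sym none)) count-black)))))

    ι-sum : ∀ {k} (f : Fin k → ℕ) → ι (sum f) ≋ Σᴿ (ι ∘ f)
    ι-sum f = sym (Σᴿ-ι f)

    Claim : ℕ → Set
    Claim k = ∀ {v cur w on loc} → Inv m v cur w on loc → NoReturn (cur ∷ w) →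
              List.length (cur ∷ w) + k ≡ suc total-length → ι (completions k (cur ∷ w)) ≋ Φ′ (cur ∷ w) loc

    claim-0 : Claim 0
    claim-0 {cur = black u} {w} inv nr len = trans (ι-cong (completions-zero (black u ∷ w))) (base inv nr (≡.trans (≡.sym (ℕ.+-identityʳ _)) len))
    -- A word whose latest letter is white has even length, a full word has odd length.
    claim-0 {cur = white i} {w} inv nr len = ⊥-elim (length-even (Σexits (white i ∷ w)) (n * full) (ℕ.suc-injective
      (≡.trans (≡.sym (proj₂ (length-exits (Inv.alt inv) (Inv.ends inv)) i ≡.refl))
        (≡.trans (≡.sym (ℕ.+-identityʳ _)) (≡.trans len (≡.cong suc total-length≡))))))

    black-claim : ∀ k → Claim k → ∀ {v u w on loc} → Inv m v (black u) w on loc → NoReturn (black u ∷ w) →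
      List.length (black u ∷ w) + suc k ≡ suc total-length → ι (completions (suc k) (black u ∷ w)) ≋ Φ′ (black u ∷ w) loc
    black-claim k ih {v} {u} {w} {on} {loc} inv nr len =
      trans (ι-cong (≡.trans (completions-suc k ws) (≡.cong (_+ sum next) (sum-0 {N} {λ u′ → completions k (black u′ ∷ ws)} λ u′ →
          completions-0 k {black u′ ∷ ws} λ p hyp walk → Suffix.adjacent-step hyp p {black u′} {black u} {w} walk))))
        (trans (ι-sum next) (dispatch (par ws (black u)) ≡.refl))
      where
      open Inv inv
      ws : List (Vertex N n)
      ws = black u ∷ w
      module BR = BlackRec G G0 G-eq inv
      next : Fin n → ℕ
      next i = completions k (white i ∷ ws)
      T : Fin n → Carrier
      T i = ι (next i)
      len′ = ≡.trans (≡.sym (ℕ.+-suc (List.length ws) k)) len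
      module _ {p} (p≡ : ups ws u ≡ suc p) where
        private
          T-new : ∀ i → white i ∉ˡ ws → T i ≋ Φ′ (white i ∷ ws) (BR.newSlots i)
          T-new i i∉ = ih (Moves.new-white inv ≡.refl i∉) (noReturn-white nr) len′
          T-down : ∀ i → par ws (white i) ≡ just (black u) → steps ws (black u) (white i) < m → T i ≋ Φ′ (white i ∷ ws) loc
          T-down i q room = ih (Moves.down-white inv ≡.refl q room) (noReturn-white nr) len′
          T-full : ∀ i → par ws (white i) ≡ just (black u) → ¬ steps ws (black u) (white i) < m → T i ≋ 0#
          T-full i q ¬room = ι-cong (completions-0 k λ p hyp walk →
            ¬room (Suffix.step-bound hyp p walk u i (Suffix.adjacent-step hyp p walk) (inj₁ (≡.refl , ≡.refl))))
          T-up : ∀ i → par ws (black u) ≡ just (white i) → T i ≋ Φ′ (white i ∷ ws) loc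
          T-up i q = ih (Moves.up-white inv ≡.refl q) (noReturn-white nr) len′
          T-none : ∀ i → white i ∈ˡ ws → par ws (white i) ≢ just (black u) → par ws (black u) ≢ just (white i) → T i ≋ 0#
          T-none i i∈ ¬q ¬q′ = ι-cong (completions-0 k λ p hyp walk → case (Suffix.edge-seen hyp p walk u i (Suffix.adjacent-step hyp p walk) (here ≡.refl) i∈))
            where
            case : par ws (black u) ≡ just (white i) ⊎ par ws (white i) ≡ just (black u) → ⊥
            case (inj₁ q) = ¬q′ q
            case (inj₂ q) = ¬q q
        inner : ∀ {i} → par ws (black u) ≡ just (white i) → Σᴿ T ≋ Φ′ ws loc
        inner q = sym (BR.black-step p≡ T T-new T-down T-full T-up T-none q)
        outer : par ws (black u) ≡ nothing → Φ′ ws loc ≋ Σᴿ T ⊕ BR.γ p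
        outer = BR.root-step p≡ T T-new T-down T-full T-up T-none
      dispatch : ∀ q → par ws (black u) ≡ q → Σᴿ T ≋ Φ′ ws loc
      dispatch nothing q = sym (trans (outer (ups-root q) q) (trans (+-congˡ (root-vanish inv q len)) (+-identityʳ _)))
      dispatch (just (black _)) q = ⊥-elim (par⇒linked alt q)
      dispatch (just (white i)) q = inner (≡.trans (ups-just q) (ℕ.+-∸-assoc 1 (up-room tree q))) q

    white-claim : ∀ k → Claim k → ∀ {v i w on loc} → Inv m v (white i) w on loc → NoReturn (white i ∷ w) →
      List.length (white i ∷ w) + suc k ≡ suc total-length → ι (completions (suc k) (white i ∷ w)) ≋ Φ′ (white i ∷ w) loc
    -- The previous letter is exposed here so that `T-illegal` can recognise the forbidden return to
    -- it.
    white-claim k ih {v} {i} {w} {on} {loc} inv nr len with Inv.at-white inv i ≡.refl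
    ... | w′ , ≡.refl =
      trans (ι-cong (≡.trans (completions-suc k ws) (≡.trans (≡.cong (sum next +_) (sum-0 {n} {λ i′ → completions k (white i′ ∷ ws)} λ i′ →
          completions-0 k {white i′ ∷ ws} λ p hyp walk → Suffix.adjacent-step hyp p {white i′} {white i} {w} walk)) (ℕ.+-identityʳ _))))
        (trans (ι-sum next) (sym (WR.white-step nonfinal (capacity inv i (here ≡.refl)) T T-new T-known T-illegal T-none)))
      where
      open Inv inv
      ws : List (Vertex N n)
      ws = white i ∷ w
      s  = loc i
      open SlotsInv (slotsInv i (here ≡.refl))
      module WR = WhiteRec G G0 G-eq inv
      next : Fin N → ℕ
      next u = completions k (black u ∷ ws)
      T : Fin N → Carrier
      T u = ι (next u)
      len′ = ≡.trans (≡.sym (ℕ.+-suc (List.length ws) k)) len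
      pos = ≤-trans (s≤s z≤n) last<
      nonfinal : WR.k ≡ 1 → ¬ Final WR.j (last s) WR.es
      -- The walk is still below the edge from i to its parent, so fewer than m exits have gone to
      -- the parent.
      nonfinal _ (_ , _ , f) = ℕ.<⇒≢ (up-room tree parent) (≡.trans (≡.cong WR.es (≡.sym (Fin.toℕ-fromℕ< pos))) (f (fromℕ< pos)))
      T-new : ∀ u → black u ∉ˡ ws → T u ≋ Φ′ (black u ∷ ws) (loc [ i ≔ˢ slots (suc WR.j) WR.j (label s [ WR.j ≔ᴺ u ]) ])
      T-new u u∉ = ih (Moves.new-black inv ≡.refl u∉) (noReturn-black (λ { ≡.refl → u∉ (there (here ≡.refl)) }) nr) len′
      T-known : ∀ a → a < WR.j → a ≢ last s × WR.es a < m → T (label s a) ≋ Φ′ (black (label s a) ∷ ws) (loc [ i ≔ˢ slots WR.j a (label s) ])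
      T-known a lt (ne , room) = go a lt room (noReturn-black (λ e → ne (≡.sym (label-inj last< lt (inj₁-injective e)))) nr)
        where
        go : ∀ a → a < WR.j → WR.es a < m → NoReturn (black (label s a) ∷ ws) → T (label s a) ≋ Φ′ (black (label s a) ∷ ws) (loc [ i ≔ˢ slots WR.j a (label s) ])
        go zero    lt room nr′ = ih (Moves.parent-black inv ≡.refl) nr′ len′
        go (suc a) lt room nr′ = ih (Moves.child-black inv ≡.refl a lt room) nr′ len′
      T-illegal : ∀ a → a < WR.j → ¬ (a ≢ last s × WR.es a < m) → T (label s a) ≋ 0#
      T-illegal a lt ¬ok = ι-cong (completions-0 k λ p hyp walk → ¬ok
        ( (λ { ≡.refl → Suffix.not-returning hyp p walk (label s a) i w′ ≡.refl ≡.refl ≡.refl })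
        , Suffix.step-bound hyp p walk (label s a) i (Suffix.adjacent-step hyp p walk) (inj₂ (≡.refl , ≡.refl))))
      T-none : ∀ u → black u ∈ˡ ws → (∀ a → a < WR.j → label s a ≢ u) → T u ≋ 0#
      T-none u u∈ ne = ι-cong (completions-0 k λ p hyp walk → case (Suffix.edge-seen hyp p walk u i (Suffix.adjacent-step hyp p walk) u∈ (here ≡.refl)))
        where
        case : par ws (black u) ≡ just (white i) ⊎ par ws (white i) ≡ just (black u) → ⊥
        case (inj₁ q) = let a , lt , e = children u q in ne (suc a) lt e
        case (inj₂ q) = ne 0 pos (inj₁-injective (just-injective (≡.trans (≡.sym parent) q)))

    claim : ∀ k → Claim k
    claim zero = claim-0
    claim (suc k) {cur = black u} = black-claim k (claim k)
    claim (suc k) {cur = white i} = white-claim k (claim k)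

-- Orbits of labelled hypertrees

module Isomorphisms where

  open import Data.Fin.Base using (punchOut)
  open import Data.Fin.Subset.Properties using (⊆-antisym) renaming (_∈?_ to _∈ˢ?_)
  open import Data.List.Properties using (head-map; last-map)
  open import Data.List.Relation.Binary.Infix.Heterogeneous using (Infix)
  open import Data.Unit.Base using (⊤; tt)
  open import Data.Vec.Base using (here; there)
  open import Data.Vec.Membership.Propositional using (_∈_)
  open import Data.Vec.Membership.Propositional.Properties using (∈-lookup)
  open import Data.Vec.Properties using (lookup∘tabulate; tabulate∘lookup; lookup-map; map-cong; map-id; map-∘; []=⇒lookup; lookup⇒[]=)
  open import Data.Vec.Relation.Unary.All as All using (All; []; _∷_)
  open import Data.Vec.Relation.Unary.AllPairs using ([]; _∷_; allPairs?)
  open import Data.Vec.Relation.Unary.Any as Any using (Any)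
  open import Data.Vec.Relation.Unary.Unique.Propositional using (Unique)
  open import Data.Vec.Relation.Unary.Unique.Propositional.Properties as Unique using (tabulate⁺; lookup-injective)
  open import Relation.Binary.Construct.Closure.ReflexiveTransitive using (Star; gmap)
  import Data.Fin.Permutation as Perm
  import Data.List.Relation.Unary.Any as ListAny
  import Data.List.Relation.Unary.Linked.Properties as Linked
  import Data.Maybe.Base as Maybe
  import Data.Sum.Base as Sum
  open import Relation.Binary.PropositionalEquality

  injective⇒surjective : ∀ {k} (f : Fin k → Fin k) → (∀ {x y} → f x ≡ f y → x ≡ y) → ∀ y → ∃ λ x → f x ≡ y
  injective⇒surjective {suc k} f inj y with Fin.any? (λ x → f x Fin.≟ y)
  ... | yes p = p
  ... | no ¬p = contradiction (Fin.injective⇒≤ {f = λ x → punchOut (avoid x)}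
          λ {a} {b} e → inj (Fin.punchOut-injective (avoid a) (avoid b) e)) (ℕ.<⇒≱ ≤-refl)
    where
    avoid : ∀ x → y ≢ f x
    avoid x e = ¬p (x , sym e)

  ∈⇒lookup : ∀ {A : Set} {k} {x : A} {v : Vec A k} → x ∈ v → ∃ λ i → lookup v i ≡ x
  ∈⇒lookup (Any.here refl) = zero , refl
  ∈⇒lookup (Any.there p)   = let i , e = ∈⇒lookup p in suc i , e

  lookup⇒∈ : ∀ {A : Set} {k} {x : A} (v : Vec A k) i → lookup v i ≡ x → x ∈ v
  lookup⇒∈ v i refl = ∈-lookup i v

  All-tabulate : ∀ {A : Set} {P : A → Set} {k} (v : Vec A k) → (∀ i → P (lookup v i)) → All P v
  All-tabulate []      f = []
  All-tabulate (x ∷ v) f = f zero ∷ All-tabulate v (f ∘ suc)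

  All-at : ∀ {A : Set} {P : A → Set} {k} {v : Vec A k} → All P v → ∀ i → P (lookup v i)
  All-at (p ∷ ps) zero    = p
  All-at (p ∷ ps) (suc i) = All-at ps i

  Unique-lookup : ∀ {A : Set} {k} {v : Vec A k} → (∀ {i j} → lookup v i ≡ lookup v j → i ≡ j) → Unique v
  Unique-lookup {v = v} inj = subst Unique (tabulate∘lookup v) (tabulate⁺ inj)

  module _ {N : ℕ} where

    ∈-image : ∀ (σ : Vec (Fin N) N) e {w} → w ∈ˢ σ ⟦ e ⟧ → ∃ λ u → u ∈ˢ e × lookup σ u ≡ w
    ∈-image σ e {w} w∈ = toWitness-does (member? w) (trans (sym (lookup∘tabulate (does ∘ member?) w)) ([]=⇒lookup w∈))
      where
      member? : ∀ w → Dec (∃ λ u → u ∈ˢ e × lookup σ u ≡ w)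
      member? w = Fin.any? λ u → (u ∈ˢ? e) ×-dec (lookup σ u Fin.≟ w)

    image-∈ : ∀ (σ : Vec (Fin N) N) e {u} → u ∈ˢ e → lookup σ u ∈ˢ σ ⟦ e ⟧
    image-∈ σ e {u} u∈ = lookup⇒[]= (lookup σ u) _ (trans (lookup∘tabulate (does ∘ member?) (lookup σ u)) (dec-true (member? (lookup σ u)) (u , u∈ , refl)))
      where
      member? : ∀ w → Dec (∃ λ u → u ∈ˢ e × lookup σ u ≡ w)
      member? w = Fin.any? λ u → (u ∈ˢ? e) ×-dec (lookup σ u Fin.≟ w)

    image-∘ : ∀ (τ σ : Vec (Fin N) N) e → Vec.map (lookup τ) σ ⟦ e ⟧ ≡ τ ⟦ σ ⟦ e ⟧ ⟧
    image-∘ τ σ e = ⊆-antisym to from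
      where
      to : ∀ {w} → w ∈ˢ Vec.map (lookup τ) σ ⟦ e ⟧ → w ∈ˢ τ ⟦ σ ⟦ e ⟧ ⟧
      to {w} w∈ with ∈-image (Vec.map (lookup τ) σ) e w∈
      ... | u , u∈ , refl = subst (_∈ˢ τ ⟦ σ ⟦ e ⟧ ⟧) (sym (lookup-map u (lookup τ) σ)) (image-∈ τ (σ ⟦ e ⟧) (image-∈ σ e u∈))
      from : ∀ {w} → w ∈ˢ τ ⟦ σ ⟦ e ⟧ ⟧ → w ∈ˢ Vec.map (lookup τ) σ ⟦ e ⟧
      from w∈ with ∈-image τ (σ ⟦ e ⟧) w∈
      ... | x , x∈ , refl with ∈-image σ e x∈
      ... | u , u∈ , refl = subst (_∈ˢ Vec.map (lookup τ) σ ⟦ e ⟧) (lookup-map u (lookup τ) σ) (image-∈ (Vec.map (lookup τ) σ) e u∈)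

    module Bijective {σ : Vec (Fin N) N} (uniq : Unique σ) where

      injective : ∀ {x y} → lookup σ x ≡ lookup σ y → x ≡ y
      injective = lookup-injective uniq _ _

      inverse : Fin N → Fin N
      inverse y = proj₁ (injective⇒surjective (lookup σ) injective y)

      right : ∀ y → lookup σ (inverse y) ≡ y
      right y = proj₂ (injective⇒surjective (lookup σ) injective y)

      left : ∀ x → inverse (lookup σ x) ≡ x
      left x = injective (right (lookup σ x))

      σ⁻¹ : Vec (Fin N) N
      σ⁻¹ = Vec.tabulate inverse

      lookup-σ⁻¹ : ∀ y → lookup σ⁻¹ y ≡ inverse y
      lookup-σ⁻¹ = lookup∘tabulate inverse

      unique⁻¹ : Unique σ⁻¹
      unique⁻¹ = tabulate⁺ λ {x} {y} e → trans (sym (right x)) (trans (cong (lookup σ) e) (right y))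

      image⁻¹ : ∀ e → σ⁻¹ ⟦ σ ⟦ e ⟧ ⟧ ≡ e
      image⁻¹ e = ⊆-antisym to from
        where
        to : ∀ {w} → w ∈ˢ σ⁻¹ ⟦ σ ⟦ e ⟧ ⟧ → w ∈ˢ e
        to w∈ with ∈-image σ⁻¹ (σ ⟦ e ⟧) w∈
        ... | x , x∈ , refl with ∈-image σ e x∈
        ... | u , u∈ , refl = subst (_∈ˢ e) (sym (trans (lookup-σ⁻¹ (lookup σ u)) (left u))) u∈
        from : ∀ {w} → w ∈ˢ e → w ∈ˢ σ⁻¹ ⟦ σ ⟦ e ⟧ ⟧
        from {w} w∈ = subst (_∈ˢ σ⁻¹ ⟦ σ ⟦ e ⟧ ⟧) (trans (lookup-σ⁻¹ (lookup σ w)) (left w)) (image-∈ σ⁻¹ (σ ⟦ e ⟧) (image-∈ σ e w∈))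

      image-injective : ∀ {d e} → σ ⟦ d ⟧ ≡ σ ⟦ e ⟧ → d ≡ e
      image-injective {d} {e} eq = trans (sym (image⁻¹ d)) (trans (cong (σ⁻¹ ⟦_⟧) eq) (image⁻¹ e))

      ∈-image⁻ : ∀ e {u} → lookup σ u ∈ˢ σ ⟦ e ⟧ → u ∈ˢ e
      ∈-image⁻ e u∈ with ∈-image σ e u∈
      ... | u′ , u′∈ , eq = subst (_∈ˢ e) (injective eq) u′∈

      permute : Perm.Permutation′ N
      permute = Perm.permutation (lookup σ) inverse right left

      sum-image : (f : Fin N → ℕ) → sum (λ x → f (lookup σ x)) ≡ sum f
      sum-image f = sym (∑-permute f permute)

      size-image : ∀ e → ∣ σ ⟦ e ⟧ ∣ ≡ ∣ e ∣
      size-image e = begin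
        ∣ σ ⟦ e ⟧ ∣                                      ≡⟨ ∣∣≡sum (σ ⟦ e ⟧) ⟩
        sum (λ w → ind (w ∈ˢ? (σ ⟦ e ⟧)))                ≡⟨ sum-image (λ w → ind (w ∈ˢ? (σ ⟦ e ⟧))) ⟨
        sum (λ u → ind (lookup σ u ∈ˢ? (σ ⟦ e ⟧)))       ≡⟨ sum-cong-≗ (λ u → ind-cong (lookup σ u ∈ˢ? (σ ⟦ e ⟧)) (u ∈ˢ? e) (∈-image⁻ e) (image-∈ σ e)) ⟩
        sum (λ u → ind (u ∈ˢ? e))                        ≡⟨ ∣∣≡sum e ⟨
        ∣ e ∣                                            ∎
        where open ≡-Reasoning

  module _ {N n : ℕ} where

    private
      Matches : Hypergraph N n → Hypergraph N n → Vec (Fin N) N → Fin n → Fin n → Set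
      Matches S T σ i j = lookup T j ≡ σ ⟦ lookup S i ⟧

    iso-to : ∀ {S T : Hypergraph N n} {σ} → IsIso S T σ → ∀ i → ∃ (Matches S T σ i)
    iso-to (_ , p , _) i = ∈⇒lookup (All-at p i)

    iso-from : ∀ {S T : Hypergraph N n} {σ} → IsIso S T σ → ∀ j → ∃ λ i → Matches S T σ i j
    iso-from {S} {T} {σ} (_ , _ , q) j with ∈⇒lookup (All-at q j)
    ... | i , e = i , trans (sym e) (lookup-map i (σ ⟦_⟧) S)

    mk-iso : ∀ {S T : Hypergraph N n} {σ} → Unique σ → (∀ i → ∃ (Matches S T σ i)) → (∀ j → ∃ λ i → Matches S T σ i j) → IsIso S T σ
    mk-iso {S} {T} {σ} uniq f g = uniq
      , All-tabulate S (λ i → let j , e = f i in lookup⇒∈ T j e)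
      , All-tabulate T (λ j → let i , e = g j in lookup⇒∈ (Vec.map (σ ⟦_⟧) S) i (trans (lookup-map i (σ ⟦_⟧) S) (sym e)))

    iso-∘ : ∀ {S T U : Hypergraph N n} {σ τ} → IsIso S T σ → IsIso T U τ → IsIso S U (Vec.map (lookup τ) σ)
    iso-∘ {S} {T} {U} {σ} {τ} p q = mk-iso (Unique.map⁺ (Bijective.injective (proj₁ q)) (proj₁ p))
      (λ i → let j , e = iso-to p i ; k , e′ = iso-to q j in k , trans e′ (trans (cong (τ ⟦_⟧) e) (sym (image-∘ τ σ (lookup S i)))))
      (λ k → let j , e = iso-from q k ; i , e′ = iso-from p j in i , trans e (trans (cong (τ ⟦_⟧) e′) (sym (image-∘ τ σ (lookup S i)))))

    iso-⁻¹ : ∀ {S T : Hypergraph N n} {σ} (p : IsIso S T σ) → IsIso T S (Bijective.σ⁻¹ (proj₁ p))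
    iso-⁻¹ {S} {T} {σ} p = mk-iso unique⁻¹
      (λ j → let i , e = iso-from p j in i , sym (trans (cong (σ⁻¹ ⟦_⟧) e) (image⁻¹ (lookup S i))))
      (λ i → let j , e = iso-to p i in j , sym (trans (cong (σ⁻¹ ⟦_⟧) e) (image⁻¹ (lookup S i))))
      where open Bijective (proj₁ p)

    ≅-sym : ∀ {S T : Hypergraph N n} → S ≅ T → T ≅ S
    ≅-sym (σ , p) = _ , iso-⁻¹ p

    ≅-trans : ∀ {S T U : Hypergraph N n} → S ≅ T → T ≅ U → S ≅ U
    ≅-trans (σ , p) (τ , q) = _ , iso-∘ p q

  lsum-cong-All : ∀ {A : Set} {P : A → Set} {xs f g} → ListAll.All P xs → (∀ x → P x → f x ≡ g x) → lsum xs f ≡ lsum xs g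
  lsum-cong-All ListAll.[]       eq = refl
  lsum-cong-All (p ListAll.∷ ps) eq = cong₂ _+_ (eq _ p) (lsum-cong-All ps eq)

  module _ {A : Set} {R : A → A → Set} (R? : ∀ x y → Dec (R x y))
           (R-sym : ∀ {x y} → R x y → R y x) (R-trans : ∀ {x y z} → R x y → R y z → R x z) where

    -- A kept x removes all later elements related to it, that is, by symmetry and transitivity,
    -- every other element that could represent the same y.
    deduplicate-count : ∀ xs y → (ListAny.Any (λ x → R x y) xs → lsum (List.deduplicate R? xs) (λ x → ind (R? x y)) ≡ 1)
                               × (¬ ListAny.Any (λ x → R x y) xs → lsum (List.deduplicate R? xs) (λ x → ind (R? x y)) ≡ 0)
    deduplicate-count [] y = (λ ()) , λ _ → refl
    deduplicate-count (x ∷ xs) y with deduplicate-count xs y | R? x y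
    ... | ih | yes Rxy = (λ _ → cong suc others) , λ ¬any → contradiction (here Rxy) ¬any
      where
      ds = List.deduplicate R? xs
      others : lsum (List.filter (¬? ∘ R? x) ds) (λ z → ind (R? z y)) ≡ 0
      others = trans (lsum-filter (¬? ∘ R? x) ds _) (trans (lsum-cong ds λ z → go z (R? x z)) (lsum-0 ds))
        where
        go : ∀ z → (d : Dec (R x z)) → ind (¬? d) * ind (R? z y) ≡ 0
        go z (yes _) = refl
        go z (no ¬Rxz) = trans (ℕ.+-identityʳ _) (ind-no (R? z y) λ Rzy → ¬Rxz (R-trans Rxy (R-sym Rzy)))
    ... | some , none′ | no ¬Rxy = (λ { (here Rxy) → contradiction Rxy ¬Rxy ; (there any) → trans step (some any) })
                                , λ ¬any → trans step (none′ (¬any ∘ there))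
      where
      ds = List.deduplicate R? xs
      step : lsum (List.filter (¬? ∘ R? x) ds) (λ z → ind (R? z y)) ≡ lsum ds (λ z → ind (R? z y))
      step = trans (lsum-filter (¬? ∘ R? x) ds _) (lsum-cong ds λ z → go z (R? x z))
        where
        go : ∀ z → (d : Dec (R x z)) → ind (¬? d) * ind (R? z y) ≡ ind (R? z y)
        go z (no _) = ℕ.+-identityʳ _
        go z (yes Rxz) = sym (ind-no (R? z y) λ Rzy → ¬Rxy (R-trans Rxz Rzy))

  -- Any of the k + 1 admissible elements may come first; excluding it from the predicate leaves k
  -- for the remaining places.
  count-arrangements : ∀ {A : Set} (_≟_ : ∀ (x y : A) → Dec (x ≡ y)) {xs : List A} → Once xs →
    ∀ k {P : A → Set} (P? : ∀ x → Dec (P x)) → lsum xs (ind ∘ P?) ≡ k →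
    lsum (vectors xs k) (λ v → ind (allPairs? (λ x y → ¬? (x ≟ y)) v ×-dec All.all? P? v)) ≡ k !
  count-arrangements _≟_ once zero P? e = refl
  count-arrangements {A} _≟_ {xs} once (suc k) {P} P? e = begin
    lsum (vectors xs (suc k)) (λ v → ind (arranged? P? v))
      ≡⟨ lsum-vectors xs k _ ⟩
    lsum xs (λ x → lsum (vectors xs k) (λ v → ind (arranged? P? (x ∷ v))))
      ≡⟨ lsum-cong xs (λ x → first x (P? x)) ⟩
    lsum xs (λ x → k ! * ind (P? x))
      ≡⟨ trans (lsum-*ˡ (k !) xs (ind ∘ P?)) (trans (cong (k ! *_) e) (ℕ.*-comm (k !) (suc k))) ⟩
    suc k ! ∎
    where
    open ≡-Reasoning
    arranged? : ∀ {k} {P : A → Set} → (∀ x → Dec (P x)) → (v : Vec A k) → Dec (Unique v × All P v)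
    arranged? P? v = allPairs? (λ x y → ¬? (x ≟ y)) v ×-dec All.all? P? v
    first : ∀ x → (d : Dec (P x)) → lsum (vectors xs k) (λ v → ind (arranged? P? (x ∷ v))) ≡ k ! * ind d
    first x (no ¬p) = trans (lsum-cong (vectors xs k) λ v → ind-no (arranged? P? (x ∷ v)) λ { (_ , p ∷ _) → ¬p p })
                            (trans (lsum-0 (vectors xs k)) (sym (ℕ.*-zeroʳ (k !))))
    first x (yes p) = trans (lsum-cong (vectors xs k) λ v → ind-cong (arranged? P? (x ∷ v)) (arranged? P∖x? v)
          (λ { ((ne ∷ u) , (_ ∷ ps)) → u , All.zip (ps , ne) })
          (λ (u , ps) → (All.map proj₂ ps ∷ u) , (p ∷ All.map proj₁ ps)))
        (trans (count-arrangements _≟_ once k P∖x? fewer) (sym (ℕ.*-identityʳ (k !))))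
      where
      P∖x? : ∀ y → Dec (P y × x ≢ y)
      P∖x? y = P? y ×-dec ¬? (x ≟ y)
      fewer : lsum xs (ind ∘ P∖x?) ≡ k
      fewer = ℕ.suc-injective (trans (cong₂ _+_ (sym single) refl) (trans (sym (lsum-+ xs (λ y → ind (y ≟ x)) (ind ∘ P∖x?))) (trans (lsum-cong xs point) e)))
        where
        single : lsum xs (λ y → ind (y ≟ x)) ≡ 1
        single = trans (once x _ λ y ne → ind-no (y ≟ x) ne) (ind-yes (x ≟ x) refl)
        point : ∀ y → ind (y ≟ x) + ind (P∖x? y) ≡ ind (P? y)
        point y with y ≟ x
        ... | yes refl = trans (cong suc (ind-no (P∖x? x) λ (_ , ne) → ne refl)) (sym (ind-yes (P? x) p))
        ... | no ne    = ind-cong (P∖x? y) (P? y) proj₁ λ q → q , ne ∘ sym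

  Once-allFin : ∀ k → Once (List.allFin k)
  Once-allFin k y g z = trans (lsum-allFin k g) (sum-single y g z)

  lsum-witness : ∀ {A : Set} {P : A → Set} (P? : ∀ x → Dec (P x)) xs → NonZero (lsum xs (ind ∘ P?)) → ∃ P
  lsum-witness P? (x ∷ xs) nz with P? x
  ... | yes p = x , p
  ... | no _  = lsum-witness P? xs nz

  wordSum-mono : ∀ {N n} k {f g : List (Vertex N n) → ℕ} → (∀ w → f w ≤ g w) → wordSum k f ≤ wordSum k g
  wordSum-mono zero    le = le []
  wordSum-mono (suc k) le = ℕ.+-mono-≤ (sum-mono λ u → wordSum-mono k (le ∘ (inj₁ u ∷_)))
                                       (sum-mono λ i → wordSum-mono k (le ∘ (inj₂ i ∷_)))

  wordSum-map : ∀ {N n} (φ : Vertex N n → Vertex N n) → (∀ (g : Vertex N n → ℕ) → vsum (g ∘ φ) ≡ vsum g) →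
                ∀ k f → wordSum k (f ∘ List.map φ) ≡ wordSum k f
  wordSum-map φ inv zero    f = refl
  wordSum-map φ inv (suc k) f = trans (vsum-cong λ y → wordSum-map φ inv k (f ∘ (φ y ∷_))) (inv λ y → wordSum k (f ∘ (y ∷_)))

  vectors-map : ∀ {A : Set} (xs : List A) (φ : A → A) → (∀ (g : A → ℕ) → lsum xs (g ∘ φ) ≡ lsum xs g) →
                ∀ k (f : Vec A k → ℕ) → lsum (vectors xs k) (f ∘ Vec.map φ) ≡ lsum (vectors xs k) f
  vectors-map xs φ inv zero    f = refl
  vectors-map xs φ inv (suc k) f = trans (lsum-vectors xs k (f ∘ Vec.map φ))
    (trans (lsum-cong xs λ x → vectors-map xs φ inv k (λ v → f (φ x ∷ v)))
      (trans (inv λ x → lsum (vectors xs k) (λ v → f (x ∷ v))) (sym (lsum-vectors xs k f))))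

  perms : ∀ N → List (Vec (Fin N) N)
  perms N = vectors (List.allFin N) N

  unique-perms : ∀ N → lsum (perms N) (λ σ → ind (allPairs? (λ u v → ¬? (u Fin.≟ v)) σ)) ≡ N !
  unique-perms N = trans (lsum-cong (perms N) λ σ → ind-cong (allPairs? (λ u v → ¬? (u Fin.≟ v)) σ)
      (allPairs? (λ u v → ¬? (u Fin.≟ v)) σ ×-dec All.all? always σ) (λ u → u , All.universal (λ _ → tt) σ) proj₁)
    (count-arrangements Fin._≟_ (Once-allFin N) N always (trans (lsum-allFin N (λ _ → 1)) (trans (sum-const N 1) (ℕ.*-identityʳ N))))
    where
    always : (x : Fin N) → Dec ⊤
    always _ = yes tt

  module _ {N n : ℕ} where

    isoCount : Hypergraph N n → Hypergraph N n → ℕ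
    isoCount S T = lsum (perms N) (ind ∘ isIso? S T)

    Γ-count : ∀ (T : Hypergraph N n) → ∣Γ∣ T ≡ isoCount T T
    Γ-count T = length-filter (isIso? T T) (perms N)

    -- Composition with an isomorphism from S to T identifies Γ(S) with the
    -- isomorphisms from S to T.
    isoCount-≅ : ∀ {S T : Hypergraph N n} → S ≅ T → isoCount S T ≡ ∣Γ∣ S
    isoCount-≅ {S} {T} (τ , q) = begin
      isoCount S T                                                      ≡⟨ vectors-map (List.allFin N) (lookup τ) shuffle N (ind ∘ isIso? S T) ⟨
      lsum (perms N) (λ σ → ind (isIso? S T (Vec.map (lookup τ) σ)))        ≡⟨ lsum-cong (perms N) (λ σ → ind-cong (isIso? S T (Vec.map (lookup τ) σ)) (isIso? S S σ) (back σ) (λ p → iso-∘ p q)) ⟩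
      isoCount S S                                                      ≡⟨ Γ-count S ⟨
      ∣Γ∣ S                                                             ∎
      where
      open ≡-Reasoning
      open Bijective (proj₁ q)
      shuffle : ∀ (g : Fin N → ℕ) → lsum (List.allFin N) (g ∘ lookup τ) ≡ lsum (List.allFin N) g
      shuffle g = trans (lsum-allFin N (g ∘ lookup τ)) (trans (sum-image g) (sym (lsum-allFin N g)))
      back : ∀ σ → IsIso S T (Vec.map (lookup τ) σ) → IsIso S S σ
      back σ p = subst (IsIso S S) (trans (sym (map-∘ (lookup σ⁻¹) (lookup τ) σ))
        (trans (map-cong (λ x → trans (lookup-σ⁻¹ (lookup τ x)) (left x)) σ) (map-id σ))) (iso-∘ p (iso-⁻¹ q))

    module _ {S T : Hypergraph N n} {σ} (p : IsIso S T σ) (uniqS : Unique S) where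
      open Bijective (proj₁ p)

      edgeMap : Fin n → Fin n
      edgeMap i = proj₁ (iso-to p i)

      edgeMap-eq : ∀ i → lookup T (edgeMap i) ≡ σ ⟦ lookup S i ⟧
      edgeMap-eq i = proj₂ (iso-to p i)

      edgeMap-injective : ∀ {i j} → edgeMap i ≡ edgeMap j → i ≡ j
      edgeMap-injective {i} {j} e = lookup-injective uniqS i j (image-injective (trans (sym (edgeMap-eq i)) (trans (cong (lookup T) e) (edgeMap-eq j))))

      edgeMap-surjective : ∀ j → ∃ λ i → edgeMap i ≡ j
      edgeMap-surjective = injective⇒surjective edgeMap edgeMap-injective

      iso-unique : Unique T
      iso-unique = Unique-lookup λ {a} {b} e → go a b e (edgeMap-surjective a) (edgeMap-surjective b)
        where
        go : ∀ a b → lookup T a ≡ lookup T b → (∃ λ i → edgeMap i ≡ a) → (∃ λ j → edgeMap j ≡ b) → a ≡ b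
        go _ _ e (i , refl) (j , refl) = cong edgeMap (lookup-injective uniqS i j
          (image-injective (trans (sym (edgeMap-eq i)) (trans e (edgeMap-eq j)))))

    -- A permutation σ fixes the set of hyperedges of S, but S lists them in an order; this gives n!
    -- choices.
    image-count : ∀ {T : Hypergraph N n} {σ} → Unique T → Unique σ → lsum (hypergraphs N n) (λ S → ind (isIso? T S σ)) ≡ n !
    image-count {T} {σ} uniqT uniqσ = trans
      (lsum-cong (hypergraphs N n) λ S → ind-cong (isIso? T S σ) (allPairs? (λ d e → ¬? (d ≟ˢ e)) S ×-dec All.all? member? S)
        (λ p → iso-unique p uniqT , proj₂ (proj₂ p)) (λ (u , all) → build S u all))
      (count-arrangements _≟ˢ_ once n member? (members (Vec.map (σ ⟦_⟧) T) (Unique.map⁺ image-injective uniqT)))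
      where
      open Bijective uniqσ
      once = Once-vectors Once-sides N
      member? : ∀ e → Dec (e ∈ Vec.map (σ ⟦_⟧) T)
      member? e = Any.any? (e ≟ˢ_) (Vec.map (σ ⟦_⟧) T)
      members : ∀ {k} (v : Vec (Subset N) k) → Unique v → lsum (vectors (inside ∷ outside ∷ []) N) (λ e → ind (Any.any? (e ≟ˢ_) v)) ≡ k
      members [] [] = lsum-0 (vectors (inside ∷ outside ∷ []) N)
      members (d ∷ v) (ne ∷ u) = trans (lsum-cong all point) (trans (lsum-+ all (λ e → ind (e ≟ˢ d)) (λ e → ind (Any.any? (e ≟ˢ_) v)))
          (cong₂ _+_ (trans (once d _ λ e ne → ind-no (e ≟ˢ d) ne) (ind-yes (d ≟ˢ d) refl)) (members v u)))
        where
        all = vectors (inside ∷ outside ∷ []) N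
        absent-d : ∀ {k} {v : Vec (Subset N) k} → All (d ≢_) v → ¬ d ∈ v
        absent-d (ne ∷ _)  (Any.here e)  = ne e
        absent-d (_ ∷ nes) (Any.there p) = absent-d nes p
        point : ∀ e → ind (Any.any? (e ≟ˢ_) (d ∷ v)) ≡ ind (e ≟ˢ d) + ind (Any.any? (e ≟ˢ_) v)
        point e = go (e ≟ˢ d)
          where
          go : (q : Dec (e ≡ d)) → ind (Any.any? (e ≟ˢ_) (d ∷ v)) ≡ ind q + ind (Any.any? (e ≟ˢ_) v)
          go (yes refl) = trans (ind-yes (Any.any? (d ≟ˢ_) (d ∷ v)) (Any.here refl)) (cong suc (sym (ind-no (Any.any? (d ≟ˢ_) v) (absent-d ne))))
          go (no e≢d) = ind-cong (Any.any? (e ≟ˢ_) (d ∷ v)) (Any.any? (e ≟ˢ_) v) (λ { (Any.here q) → contradiction q e≢d ; (Any.there q) → q }) Any.there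
      build : ∀ S → Unique S → All (_∈ Vec.map (σ ⟦_⟧) T) S → IsIso T S σ
      build S u all = mk-iso uniqσ
        (λ i → let j , e = injective⇒surjective f f-inj i in j , trans (f-eq j) (cong (λ i → σ ⟦ lookup T i ⟧) e))
        (λ j → f j , f-eq j)
        where
        f : Fin n → Fin n
        f j = proj₁ (∈⇒lookup (All-at all j))
        f-eq : ∀ j → lookup S j ≡ σ ⟦ lookup T (f j) ⟧
        f-eq j = trans (sym (proj₂ (∈⇒lookup (All-at all j)))) (lookup-map (f j) (σ ⟦_⟧) T)
        f-inj : ∀ {a b} → f a ≡ f b → a ≡ b
        f-inj {a} {b} e = lookup-injective u a b (trans (f-eq a) (trans (cong (λ i → σ ⟦ lookup T i ⟧) e) (sym (f-eq b))))

  module Orbits (r m n : ℕ) where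

    private
      N : ℕ
      N = suc (r * n)

    iso-hypertree : ∀ {S T : Hypergraph N n} {σ} → IsIso S T σ → IsHypertree r n S → IsHypertree r n T
    iso-hypertree {S} {T} {σ} p (uniq , sizes , conn) = iso-unique p uniq
      , All-tabulate T (λ j → let i , e = iso-from p j in trans (cong ∣_∣ e) (trans (size-image (lookup S i)) (All-at sizes i)))
      , λ x y → subst₂ (Star (Joined T)) (right x) (right y) (gmap (lookup σ) joined (conn (inverse x) (inverse y)))
      where
      open Bijective (proj₁ p)
      joined : ∀ {x y} → Joined S x y → Joined T (lookup σ x) (lookup σ y)
      joined {x} {y} a = let i , (x∈ , y∈) = Any-∈⇒lookup a ; j , e = iso-to p i in
        join j (subst (lookup σ x ∈ˢ_) (sym e) (image-∈ σ (lookup S i) x∈)) (subst (lookup σ y ∈ˢ_) (sym e) (image-∈ σ (lookup S i) y∈))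
        where
        join : ∀ {k} {V : Vec (Subset N) k} i {x y} → x ∈ˢ lookup V i → y ∈ˢ lookup V i → Any (λ e → x ∈ˢ e × y ∈ˢ e) V
        join {V = _ ∷ _} zero    p q = Any.here (p , q)
        join {V = _ ∷ _} (suc i) p q = Any.there (join i p q)

    trees : List (Hypergraph N n)
    trees = List.filter (isHypertree? r n) (hypergraphs N n)

    trees-All : ListAll.All (IsHypertree r n) trees
    trees-All = ListAll.all-filter (isHypertree? r n) (hypergraphs N n)

    -- Pairs of a tree S and an isomorphism σ from T to S are counted in two ways. Each S in the
    -- class of T occurs with |Γ(T)| permutations σ, and each of the (rn + 1)! permutations σ occurs
    -- with n! lists S.
    class-size : ∀ {T} → IsHypertree r n T → lsum trees (λ S → ind (T ≅? S)) * ∣Γ∣ T ≡ N ! * n !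
    class-size {T} hyp = begin
      lsum trees (λ S → ind (T ≅? S)) * ∣Γ∣ T             ≡⟨ trans (ℕ.*-comm _ (∣Γ∣ T)) (sym (lsum-*ˡ (∣Γ∣ T) trees (λ S → ind (T ≅? S)))) ⟩
      lsum trees (λ S → ∣Γ∣ T * ind (T ≅? S))             ≡⟨ lsum-cong trees (λ S → isos S (T ≅? S)) ⟩
      lsum trees (λ S → isoCount T S)                     ≡⟨ lsum-filter (isHypertree? r n) (hypergraphs N n) (isoCount T) ⟩
      lsum (hypergraphs N n) (λ S → ind (isHypertree? r n S) * isoCount T S)
        ≡⟨ lsum-cong (hypergraphs N n) (λ S → only-trees S (isHypertree? r n S)) ⟩
      lsum (hypergraphs N n) (λ S → isoCount T S)         ≡⟨ lsum-swap (hypergraphs N n) (perms N) (λ S σ → ind (isIso? T S σ)) ⟩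
      lsum (perms N) (λ σ → lsum (hypergraphs N n) (λ S → ind (isIso? T S σ)))
        ≡⟨ lsum-cong (perms N) (λ σ → images σ (allPairs? (λ u v → ¬? (u Fin.≟ v)) σ)) ⟩
      lsum (perms N) (λ σ → n ! * ind (allPairs? (λ u v → ¬? (u Fin.≟ v)) σ))
        ≡⟨ trans (lsum-*ˡ (n !) (perms N) _) (trans (cong (n ! *_) (unique-perms N)) (ℕ.*-comm (n !) (N !))) ⟩
      N ! * n ! ∎
      where
      open ≡-Reasoning
      isos : ∀ S (d : Dec (T ≅ S)) → ∣Γ∣ T * ind d ≡ isoCount T S
      isos S (yes p) = trans (ℕ.*-identityʳ _) (sym (isoCount-≅ p))
      isos S (no ¬p) = trans (ℕ.*-zeroʳ (∣Γ∣ T)) (sym (trans (lsum-cong (perms N) λ σ → ind-no (isIso? T S σ) λ q → ¬p (σ , q)) (lsum-0 (perms N))))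
      only-trees : ∀ S (d : Dec (IsHypertree r n S)) → ind d * isoCount T S ≡ isoCount T S
      only-trees S (yes _) = ℕ.+-identityʳ _
      only-trees S (no ¬hyp) = sym (trans (lsum-cong (perms N) λ σ → ind-no (isIso? T S σ) λ q → ¬hyp (iso-hypertree q hyp)) (lsum-0 (perms N)))
      images : ∀ σ (d : Dec (Unique σ)) → lsum (hypergraphs N n) (λ S → ind (isIso? T S σ)) ≡ n ! * ind d
      images σ (yes u) = trans (image-count (proj₁ hyp) u) (sym (ℕ.*-identityʳ (n !)))
      images σ (no ¬u) = trans (lsum-cong (hypergraphs N n) λ S → ind-no (isIso? T S σ) (¬u ∘ proj₁)) (trans (lsum-0 (hypergraphs N n)) (sym (ℕ.*-zeroʳ (n !))))

    walks : Hypergraph N n → ℕ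
    walks T = sum λ v → walkCount r m T v

    len : ℕ
    len = suc (2 * m * (suc r * n))

    walkCount≡ : ∀ T v → walkCount r m T v ≡ wordSum len (λ w → ind (isWalk? T m v w))
    walkCount≡ T v = trans (length-filter (isWalk? T m v) (List.map Vec.toList (vectors (vertices N n) len)))
      (trans (lsum-map Vec.toList (vectors (vertices N n) len) (ind ∘ isWalk? T m v)) (lsum-words len (ind ∘ isWalk? T m v)))

    module Transport {S T : Hypergraph N n} {σ} (p : IsIso S T σ) (hyp : IsHypertree r n S) where
      open Bijective (proj₁ p)

      private
        π = edgeMap p (proj₁ hyp)
        π-eq = edgeMap-eq p (proj₁ hyp)
        π-inj : ∀ {i j} → π i ≡ π j → i ≡ j
        π-inj = edgeMap-injective p (proj₁ hyp)
        π⁻¹ : Fin n → Fin n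
        π⁻¹ j = proj₁ (edgeMap-surjective p (proj₁ hyp) j)
        π-right : ∀ j → π (π⁻¹ j) ≡ j
        π-right j = proj₂ (edgeMap-surjective p (proj₁ hyp) j)

      φ : Vertex N n → Vertex N n
      φ (black u) = black (lookup σ u)
      φ (white i) = white (π i)

      φ-injective : ∀ {x y} → φ x ≡ φ y → x ≡ y
      φ-injective {black _} {black _} e = cong inj₁ (injective (inj₁-injective e))
      φ-injective {white _} {white _} e = cong inj₂ (π-inj (inj₂-injective e))

      φ-vsum : ∀ (g : Vertex N n → ℕ) → vsum (g ∘ φ) ≡ vsum g
      φ-vsum g = cong₂ _+_ (sum-image (g ∘ inj₁)) (sym (∑-permute (g ∘ inj₂)
        (Perm.permutation π π⁻¹ π-right λ i → π-inj (π-right (π i)))))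

      edge⁺ : ∀ {u i} → u ∈ˢ lookup S i → lookup σ u ∈ˢ lookup T (π i)
      edge⁺ {u} {i} u∈ = subst (lookup σ u ∈ˢ_) (sym (π-eq i)) (image-∈ σ (lookup S i) u∈)

      edge⁻ : ∀ {u i} → lookup σ u ∈ˢ lookup T (π i) → u ∈ˢ lookup S i
      edge⁻ {u} {i} u∈ = ∈-image⁻ (lookup S i) (subst (lookup σ u ∈ˢ_) (π-eq i) u∈)

      adjacent⁺ : ∀ {x y} → Adjacent S x y → Adjacent T (φ x) (φ y)
      adjacent⁺ {black _} {white _} = edge⁺
      adjacent⁺ {white _} {black _} = edge⁺

      steps-map : ∀ w a b → steps (List.map φ w) (φ a) (φ b) ≡ steps w a b
      steps-map [] a b = refl
      steps-map (y ∷ []) a b = refl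
      steps-map (y ∷ w′@(x ∷ w)) a b with step? x y a b | steps-map w′ a b
      ... | inj₁ (refl , refl) | ih = trans (steps-hit (φ y) (φ x) (List.map φ w)) (trans (cong suc ih) (sym (steps-hit y x w)))
      ... | inj₂ ne | ih = trans (steps-miss (φ y) (φ x) (List.map φ w) (Sum.map (_∘ φ-injective) (_∘ φ-injective) ne)) (trans ih (sym (steps-miss y x w ne)))

      infix⁻ : ∀ {a b c} w → Infix _≡_ (φ a ∷ φ b ∷ φ c ∷ []) (List.map φ w) → Infix _≡_ (a ∷ b ∷ c ∷ []) w
      infix⁻ []               (Infix.here ())
      infix⁻ (x ∷ [])         (Infix.here (_ ∷ ()))
      infix⁻ (x ∷ y ∷ [])     (Infix.here (_ ∷ _ ∷ ()))
      infix⁻ (x ∷ y ∷ z ∷ w)  (Infix.here (p ∷ q ∷ r ∷ _)) = Infix.here (φ-injective p ∷ φ-injective q ∷ φ-injective r ∷ [])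
      infix⁻ (x ∷ w) (Infix.there i) = Infix.there (infix⁻ w i)

      walk⁺ : ∀ {v w} → IsWalk S m v w → IsWalk T m (lookup σ v) (List.map φ w)
      walk⁺ {v} {w} (mkWalk adj st en ed nr) = mkWalk
        (Linked.map⁺ (Linked.map adjacent⁺ adj))
        (trans (head-map w) (cong (Maybe.map φ) st))
        (trans (last-map φ w) (cong (Maybe.map φ) en))
        (λ u i u∈ → edges⁺ u i u∈ (right u) (π-right i))
        (λ u i q → nr (inverse u) (π⁻¹ i) (infix⁻ w (subst₂ (λ u i → Infix _≡_ (black u ∷ white i ∷ black u ∷ []) (List.map φ w)) (sym (right u)) (sym (π-right i)) q)))
        where
        edges⁺ : ∀ u i → u ∈ˢ lookup T i → lookup σ (inverse u) ≡ u → π (π⁻¹ i) ≡ i →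
                 steps (List.map φ w) (white i) (black u) ≡ m × steps (List.map φ w) (black u) (white i) ≡ m
        edges⁺ u i u∈ e e′ with inverse u | π⁻¹ i
        edges⁺ _ _ u∈ refl refl | u | i = let p , q = ed u i (edge⁻ u∈) in
          trans (steps-map w (white i) (black u)) p , trans (steps-map w (black u) (white i)) q

      -- The map on words preserves walks, and its bijectivity on letters preserves sums over words.
      -- The inequality suffices, since the inverse isomorphism gives the opposite one.
      walks-≤ : walks S ≤ walks T
      walks-≤ = begin
        sum (λ v → walkCount r m S v)                                                             ≡⟨ sum-cong-≗ (walkCount≡ S) ⟩
        sum (λ v → wordSum len (λ w → ind (isWalk? S m v w)))
          ≤⟨ sum-mono (λ v → wordSum-mono len λ w → ind-mono (isWalk? S m v w) (isWalk? T m (lookup σ v) (List.map φ w)) walk⁺) ⟩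
        sum (λ v → wordSum len (λ w → ind (isWalk? T m (lookup σ v) (List.map φ w))))
          ≡⟨ sum-cong-≗ (λ v → wordSum-map φ φ-vsum len (λ w → ind (isWalk? T m (lookup σ v) w))) ⟩
        sum (λ v → wordSum len (λ w → ind (isWalk? T m (lookup σ v) w)))                          ≡⟨ sum-image (λ v → wordSum len (λ w → ind (isWalk? T m v w))) ⟩
        sum (λ v → wordSum len (λ w → ind (isWalk? T m v w)))                                     ≡⟨ sum-cong-≗ (walkCount≡ T) ⟨
        sum (λ v → walkCount r m T v)                                                             ∎
        where open ℕ.≤-Reasoning

    walks-≅ : ∀ {S T} → IsHypertree r n S → IsHypertree r n T → S ≅ T → walks S ≡ walks T
    walks-≅ hS hT (σ , p) = ℕ.≤-antisym (Transport.walks-≤ p hS) (Transport.walks-≤ (iso-⁻¹ p) hT)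

    -- The number of walks is constant on an isomorphism class, and each labelled tree is isomorphic
    -- to exactly one representative.
    classes : lsum (ℋ r n) (λ T → lsum trees (λ S → ind (T ≅? S)) * walks T) ≡ lsum trees walks
    classes = begin
      lsum (ℋ r n) (λ T → lsum trees (λ S → ind (T ≅? S)) * walks T)
        ≡⟨ lsum-cong-All (ListAll.deduplicate⁺ _≅?_ trees-All) (λ T hT → trans (ℕ.*-comm _ (walks T))
             (trans (sym (lsum-*ˡ (walks T) trees (λ S → ind (T ≅? S)))) (lsum-cong-All trees-All λ S hS → swap T hT S hS (T ≅? S)))) ⟩
      lsum (ℋ r n) (λ T → lsum trees (λ S → walks S * ind (T ≅? S)))
        ≡⟨ lsum-swap (ℋ r n) trees (λ T S → walks S * ind (T ≅? S)) ⟩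
      lsum trees (λ S → lsum (ℋ r n) (λ T → walks S * ind (T ≅? S)))
        ≡⟨ lsum-cong trees (λ S → lsum-*ˡ (walks S) (ℋ r n) (λ T → ind (T ≅? S))) ⟩
      lsum trees (λ S → walks S * lsum (ℋ r n) (λ T → ind (T ≅? S)))
        ≡⟨ lsum-cong-All represented (λ S rep → trans (cong (walks S *_) (proj₁ (deduplicate-count _≅?_ ≅-sym ≅-trans trees S) rep)) (ℕ.*-identityʳ (walks S))) ⟩
      lsum trees walks ∎
      where
      open ≡-Reasoning
      swap : ∀ T → IsHypertree r n T → ∀ S → IsHypertree r n S → (d : Dec (T ≅ S)) → walks T * ind d ≡ walks S * ind d
      swap T hT S hS (yes p) = cong (_* 1) (walks-≅ hT hS p)
      swap T hT S hS (no _)  = trans (ℕ.*-zeroʳ (walks T)) (sym (ℕ.*-zeroʳ (walks S)))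
      ≅-refl : ∀ (T : Hypergraph N n) → T ≅ T
      ≅-refl T = lsum-witness (isIso? T T) (vectors (List.allFin N) N) (subst NonZero (length-filter (isIso? T T) (vectors (List.allFin N) N)) (∣Γ∣≢0 T))
      represented : ListAll.All (λ S → ListAny.Any (_≅ S) trees) trees
      represented = go trees
        where
        go : ∀ xs → ListAll.All (λ S → ListAny.Any (_≅ S) xs) xs
        go []       = ListAll.[]
        go (x ∷ xs) = here (≅-refl x) ListAll.∷ ListAll.map there (go xs)

    open WalkCounts r m n using (valid; valid-def)

    all-walks : lsum trees walks ≡ wordSum len valid
    all-walks = begin
      lsum trees walks
        ≡⟨ lsum-filter (isHypertree? r n) (hypergraphs N n) walks ⟩
      lsum (hypergraphs N n) (λ T → ind (isHypertree? r n T) * walks T)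
        ≡⟨ lsum-cong (hypergraphs N n) (λ T → trans (cong (ind (isHypertree? r n T) *_) (walks-words T))
             (sym (lsum-*ˡ (ind (isHypertree? r n T)) words _))) ⟩
      lsum (hypergraphs N n) (λ T → lsum words (λ w → ind (isHypertree? r n T) * sum (λ v → ind (isWalk? T m v (Vec.toList w)))))
        ≡⟨ lsum-swap (hypergraphs N n) words _ ⟩
      lsum words (λ w → lsum (hypergraphs N n) (λ T → ind (isHypertree? r n T) * sum (λ v → ind (isWalk? T m v (Vec.toList w)))))
        ≡⟨ lsum-cong words (λ w → valid-def (Vec.toList w)) ⟨
      lsum words (valid ∘ Vec.toList)
        ≡⟨ lsum-words len valid ⟩
      wordSum len valid ∎
      where
      open ≡-Reasoning
      words = vectors (vertices N n) len
      walks-words : ∀ T → walks T ≡ lsum words (λ w → sum (λ v → ind (isWalk? T m v (Vec.toList w))))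
      walks-words T = begin
        sum (λ v → walkCount r m T v)
          ≡⟨ sum-cong-≗ (λ v → trans (walkCount≡ T v) (sym (lsum-words len (λ w → ind (isWalk? T m v w))))) ⟩
        sum (λ v → lsum words (λ w → ind (isWalk? T m v (Vec.toList w))))
          ≡⟨ lsum-allFin N _ ⟨
        lsum (List.allFin N) (λ v → lsum words (λ w → ind (isWalk? T m v (Vec.toList w))))
          ≡⟨ lsum-swap (List.allFin N) words (λ v w → ind (isWalk? T m v (Vec.toList w))) ⟩
        lsum words (λ w → lsum (List.allFin N) (λ v → ind (isWalk? T m v (Vec.toList w))))
          ≡⟨ lsum-cong words (λ w → lsum-allFin N (λ v → ind (isWalk? T m v (Vec.toList w)))) ⟩
        lsum words (λ w → sum (λ v → ind (isWalk? T m v (Vec.toList w)))) ∎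

open Isomorphisms

-- The number of all pairs of a labelled hypertree and a walk.

module Total (R : CommutativeSemiring 0ℓ 0ℓ)
  (inv! : ℕ → CommutativeSemiring.Carrier R)
  (inv!-0 : CommutativeSemiring._≈_ R (inv! 0) (CommutativeSemiring.1# R))
  (inv!-suc : ∀ k → CommutativeSemiring._≈_ R (CommutativeSemiring._*_ R (LocalSeries.ι R (suc k)) (inv! (suc k))) (inv! k))
  (r′ m′ n : ℕ) where

  private
    r N : ℕ
    r = suc r′
    N = suc (r * n)

  open LocalSeries R
  open Main R inv! inv!-0 inv!-suc r′ m′ n
  open Residuals {N} {n} m

  start-on : Fin N → Vertex N n → Bool
  start-on v = (λ _ → false) [ black v ≔ true ]

  -- Dummy values, since no hyperedge has been seen at the start.
  start-loc : Fin n → Slots {N} {n}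
  start-loc _ = slots 0 0 (λ _ → zero)

  start : ∀ v → Inv m v (black v) [] (start-on v) start-loc
  start v = record
    { tree = record
      { cur-on = ≔-hit (λ _ → false) (black v)
      ; on-par = λ _ () ; on-unique = λ _ _ () ; cur-top = λ _ ()
      ; on-seen = λ {x} → seen x
      ; balance = λ () ; tree-edge = λ () ; cap = λ _ _ → z≤n }
    ; ends = ≡.refl
    ; alt = [-]
    ; slotsInv = λ { i (here ()) ; i (there ()) }
    ; at-white = λ { i () }
    }
    where
    seen : ∀ x → start-on v x ≡ true → x ∈ˡ black v ∷ []
    seen x e with x ≟ᵛ black v
    ... | yes p = here p
    ... | no ne with () ← ≡.trans (≡.sym e) (≔-miss (λ _ → false) ne)

  start-noReturn : ∀ (v : Fin N) → NoReturn {N} {n} (black v ∷ [])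
  start-noReturn v u i (Infix.here (_ ∷ ()))
  start-noReturn v u i (Infix.there (Infix.here ()))

  module _ (G : PS) (G0 : G 0 ≋ 0#) (G-eq : G ≃ shift (ι κ ∙ Λ G G0 ↑ r)) where

    private
      coefficient : Carrier
      coefficient = Bᴳ G G0 0 n

    start-Φ : ∀ v → Φ G G0 (black v ∷ []) start-loc ≋ ι ((r * n) ! * n !) ⊗ coefficient
    start-Φ v = *-cong (ι-cong (≡.cong₂ (λ b k → b ! * k !) blacks whites))
        (trans (at factors (unseenW ws)) (reflexive (≡.cong (Bᴳ G G0 0) whites)))
      where
      ws : List (Vertex N n)
      ws = black v ∷ []
      i∉ : ∀ {i} → white i ∉ˡ ws
      i∉ (here ())
      i∉ (there ())
      whites : unseenW ws ≡ n
      whites = ≡.trans (sum-cong-≗ λ i → unseen-∉ (i∉ {i})) (≡.trans (sum-const n 1) (ℕ.*-identityʳ n))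
      blacks : unseenB ws ≡ r * n
      blacks = ℕ.suc-injective (≡.trans (≡.sym (sum-suc {f = λ _ → 1} {g = λ u → unseen ws (black u)} v
          (≡.cong suc (≡.sym (unseen-∈ {N} {n} {ws} {black v} (here ≡.refl))))
          (λ u ne → ≡.sym (unseen-∉ {N} {n} {ws} {black u} λ { (here p) → ne (inj₁-injective p) }))))
        (≡.trans (sum-const N 1) (ℕ.*-identityʳ N)))
      root-factor : bfac G G0 ws v ≃ Bᴳ G G0 0
      root-factor = S.trans (S.reflexive (bfac-seen G G0 {ws} (here ≡.refl))) (S.trans
        (∙-cong (residual-1 G G0 G-eq (start v) ≡.refl v zero-downs)
          (S.trans (S.reflexive (≡.cong₂ (block G G0) (ups-root ≡.refl) (sum-0 zero-downs))) (∙-cong inv!-0 S.refl)))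
        (S.trans (1∙ _) (1∙ _)))
        where
        zero-downs : ∀ i → downs ws v i ≡ 0
        zero-downs i = downs-no λ ()
      others : Πˢ.except v (bfac G G0 ws) ≃ 𝟙
      others = Πˢ-𝟙 λ u → go u (u Fin.≟ v)
        where
        go : ∀ u (d : Dec (u ≡ v)) → (if does d then 𝟙 else bfac G G0 ws u) ≃ 𝟙
        go u (yes _) = S.refl
        go u (no ne) = S.reflexive (bfac-unseen G G0 λ { (here p) → ne (inj₁-injective p) })
      factors : product G G0 ws start-loc ≃ Bᴳ G G0 0
      factors = S.trans (⊠-cong (S.trans (Πˢ.split v (bfac G G0 ws)) (⊠-cong root-factor others))
          (Πˢ-𝟙 λ i → S.reflexive (wfac-unseen G G0 start-loc (i∉ {i}))))
        (S.trans (S.*-identityʳ _) (S.*-identityʳ _))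

    -- The last letter of the word is the root. Each of its rn + 1 choices starts with the weight
    -- (rn)! n! times the coefficient, which together gives (rn + 1)! n!, the factor that also
    -- occurs in the orbit count.
    total : ι (wordSum (suc (2 * m * (suc r * n))) valid) ≋ ι (N ! * n !) ⊗ coefficient
    total = trans (ι-cong (≡.trans (wordSum-snoc M valid) (≡.trans (≡.cong₂ _+_
          (sum-cong-≗ λ u → ≡.sym (completions-def M (black u ∷ [])))
          (sum-0 {n} {λ i → wordSum M λ p → valid (p ++ white i ∷ [])} λ i → wordSum-0 M λ p → valid-0 λ hyp walk → not-white p i (IsWalk.ends walk)))
        (ℕ.+-identityʳ _))))
      (trans (sym (Σᴿ-ι (λ u → completions M (black u ∷ []))))
        (trans (sum-cong-≋ λ u → trans (claim G G0 G-eq M (start u) (start-noReturn u) ≡.refl) (start-Φ u))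
          (trans (sym (*-distribʳ-sum {N} coefficient (λ _ → ι ((r * n) ! * n !))))
            (*-congʳ (trans (Σᴿ-ι {N} (λ _ → (r * n) ! * n !)) (ι-cong (≡.trans (sum-const N _) (≡.sym (ℕ.*-assoc N ((r * n) !) (n !))))))))))
      where
      M = 2 * m * (suc r * n)
      not-white : ∀ (p : List (Vertex N n)) i {v} → List.last (p ++ white i ∷ []) ≢ just (black v)
      not-white []          i ()
      not-white (x ∷ [])    i ()
      not-white (x ∷ y ∷ p) i e = not-white (y ∷ p) i e

module FirstCoefficient (R : CommutativeSemiring 0ℓ 0ℓ)
  (inv! : ℕ → CommutativeSemiring.Carrier R)
  (inv!-0 : CommutativeSemiring._≈_ R (inv! 0) (CommutativeSemiring.1# R))
  (inv!-suc : ∀ k → CommutativeSemiring._≈_ R (CommutativeSemiring._*_ R (LocalSeries.ι R (suc k)) (inv! (suc k))) (inv! k))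
  (r m′ : ℕ) where

  open LocalSeries R

  inv!-inverse : ∀ k → inv! k ⊗ ι (k !) ≋ 1#
  inv!-inverse zero    = trans (*-cong inv!-0 ι-1) (*-identityˡ 1#)
  inv!-inverse (suc k) = begin
    inv! (suc k) ⊗ ι (suc k * k !)          ≈⟨ *-congˡ (ι-* (suc k) (k !)) ⟩
    inv! (suc k) ⊗ (ι (suc k) ⊗ ι (k !))    ≈⟨ *-assoc _ _ _ ⟨
    inv! (suc k) ⊗ ι (suc k) ⊗ ι (k !)      ≈⟨ *-congʳ (trans (*-comm _ _) (inv!-suc k)) ⟩
    inv! k ⊗ ι (k !)                        ≈⟨ inv!-inverse k ⟩
    1#                                      ∎
    where open SetoidReasoning setoid

  ⊠-0 : ∀ f g → (f ⊠ g) 0 ≋ f 0 ⊗ g 0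
  ⊠-0 f g = trans (reflexive (⊠-def f g 0)) (+-identityʳ _)

  module _ (G : PS) (G0 : G 0 ≋ 0#) (κ : ℕ) where

    private
      Bᴳ : ℕ → PS
      Bᴳ = B inv! inv!-0 inv!-suc m′ G G0

      Λ : PS
      Λ = inv! m′ ∙ Bᴳ m′

      Λ-0 : Λ 0 ≋ 1#
      Λ-0 = trans (*-congˡ (trans (+-identityʳ _) (trans (*-identityʳ _) (trans (*-cong (ι-cong (≡.cong _! (ℕ.+-identityʳ m′)))
        (trans (*-identityʳ _) inv!-0)) (*-identityʳ _))))) (inv!-inverse m′)

      Λ-power : ∀ d → (Λ ↑ d) 0 ≋ 1#
      Λ-power zero    = refl
      Λ-power (suc d) = trans (⊠-0 Λ (Λ ↑ d)) (trans (*-cong Λ-0 (Λ-power d)) (*-identityˡ 1#))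

    -- In B 0 = 1 + G B (m - 1) / (m - 1)! only the lowest terms matter: `Λ` has constant term 1, so
    -- G starts with κ x.
    first-coefficient : G ≃ shift (ι κ ∙ Λ ↑ r) → Bᴳ 0 1 ≋ ι κ
    first-coefficient G-eq = begin
      Bᴳ 0 1                                   ≈⟨ at (B-zero inv! inv!-0 inv!-suc m′ G G0) 1 ⟩
      0# ⊕ inv! m′ ⊗ (G ⊠ Bᴳ m′) 1             ≈⟨ +-identityˡ _ ⟩
      inv! m′ ⊗ (G ⊠ Bᴳ m′) 1                  ≈⟨ *-congˡ (trans (at (⊠-cong G-eq S.refl) 1) (trans (at (shift-⊠ Z (Bᴳ m′)) 1) (⊠-0 Z (Bᴳ m′)))) ⟩
      inv! m′ ⊗ (Z 0 ⊗ Bᴳ m′ 0)                ≈⟨ x∙yz≈y∙xz _ _ _ ⟩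
      Z 0 ⊗ Λ 0                                ≈⟨ *-cong (trans (*-congˡ (Λ-power r)) (*-identityʳ (ι κ))) Λ-0 ⟩
      ι κ ⊗ 1#                                 ≈⟨ *-identityʳ (ι κ) ⟩
      ι κ                                      ∎
      where
      open SetoidReasoning setoid
      Z = ι κ ∙ Λ ↑ r

-- Fractions, and the series of the theorem in terms of the local series.

frac : ℕ → (d : ℕ) .{{_ : NonZero d}} → ℚ
frac a d = ℤ.+ a ℚ./ d

fromℚᵘ-* : ∀ x y → ℚ.fromℚᵘ x ℚ.* ℚ.fromℚᵘ y ≡ ℚ.fromℚᵘ (x ℚᵘ.* y)
fromℚᵘ-* x y = ℚ.toℚᵘ-injective (ℚᵘ.≃-trans (ℚ.toℚᵘ-homo-* (ℚ.fromℚᵘ x) (ℚ.fromℚᵘ y))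
  (ℚᵘ.≃-trans (ℚᵘ.*-cong (ℚ.toℚᵘ-fromℚᵘ x) (ℚ.toℚᵘ-fromℚᵘ y)) (ℚᵘ.≃-sym (ℚ.toℚᵘ-fromℚᵘ (x ℚᵘ.* y)))))

fromℚᵘ-+ : ∀ x y → ℚ.fromℚᵘ x ℚ.+ ℚ.fromℚᵘ y ≡ ℚ.fromℚᵘ (x ℚᵘ.+ y)
fromℚᵘ-+ x y = ℚ.toℚᵘ-injective (ℚᵘ.≃-trans (ℚ.toℚᵘ-homo-+ (ℚ.fromℚᵘ x) (ℚ.fromℚᵘ y))
  (ℚᵘ.≃-trans (ℚᵘ.+-cong (ℚ.toℚᵘ-fromℚᵘ x) (ℚ.toℚᵘ-fromℚᵘ y)) (ℚᵘ.≃-sym (ℚ.toℚᵘ-fromℚᵘ (x ℚᵘ.+ y)))))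

frac-≡ : ∀ a b d e .{{_ : NonZero d}} .{{_ : NonZero e}} → a * e ≡ b * d → frac a d ≡ frac b e
frac-≡ a b (suc d) (suc e) eq = ℚ.fromℚᵘ-cong {ℚᵘ.mkℚᵘ (ℤ.+ a) d} {ℚᵘ.mkℚᵘ (ℤ.+ b) e}
  (ℚᵘ.*≡* (≡.trans (≡.sym (ℤ.pos-* a (suc e))) (≡.trans (≡.cong ℤ.+_ eq) (ℤ.pos-* b (suc d)))))

frac-* : ∀ a b d e .{{_ : NonZero d}} .{{_ : NonZero e}} → frac a d ℚ.* frac b e ≡ frac (a * b) (d * e) {{ℕ.m*n≢0 d e}}
frac-* a b (suc d) (suc e) = ≡.trans (fromℚᵘ-* (ℚᵘ.mkℚᵘ (ℤ.+ a) d) (ℚᵘ.mkℚᵘ (ℤ.+ b) e))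
  (≡.cong (λ z → z ℚ./ (suc d * suc e)) (≡.sym (ℤ.pos-* a b)))

frac-suc : ∀ n → 1ℚ ℚ.+ frac n 1 ≡ frac (suc n) 1
frac-suc n = ≡.trans (fromℚᵘ-+ (ℚᵘ.mkℚᵘ (ℤ.+ 1) 0) (ℚᵘ.mkℚᵘ (ℤ.+ n) 0))
  (≡.cong (λ z → z ℚ./ 1) (≡.cong₂ ℤ._+_ {x = ℤ.+ 1 ℤ.* ℤ.+ 1} ≡.refl (ℤ.*-identityʳ (ℤ.+ n))))

binomial-! : ∀ a b → ((a + b) C a) * (a ! * b !) ≡ (a + b) !
binomial-! a b = ≡.trans (≡.cong (λ c → ((a + b) C a) * (a ! * c !)) (≡.sym (ℕ.m+n∸m≡n a b)))
  (≡.trans (≡.cong (_* (a ! * (a + b ∸ a) !)) (nCk≡n!/k![n-k]! a≤))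
    (ℕ.m/n*n≡m {{ℕ._!*_!≢0 a (a + b ∸ a)}} (k![n∸k]!∣n! a≤)))
  where
  a≤ = ℕ.m≤m+n a b

ℚ-semiring : CommutativeSemiring 0ℓ 0ℓ
ℚ-semiring = CommutativeRing.commutativeSemiring +-*-commutativeRing

module Bridge where

  open LocalSeries ℚ-semiring

  ι≡frac : ∀ k → ι k ≡ frac k 1
  ι≡frac zero    = ≡.refl
  ι≡frac (suc k) = ≡.trans (≡.cong (1ℚ ℚ.+_) (ι≡frac k)) (frac-suc k)

  frac-ι : ∀ a d .{{_ : NonZero d}} → frac a d ℚ.* ι d ≡ ι a
  frac-ι a d = ≡.trans (≡.cong (frac a d ℚ.*_) (ι≡frac d)) (≡.trans (frac-* a d d 1)
    (≡.trans (frac-≡ (a * d) a (d * 1) 1 {{ℕ.m*n≢0 d 1}} (ℕ.*-assoc a d 1)) (≡.sym (ι≡frac a))))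

  ι-cancel : ∀ d .{{_ : NonZero d}} {x y} → x ℚ.* ι d ≡ y ℚ.* ι d → x ≡ y
  ι-cancel d {x} {y} e = ≡.trans (≡.sym (undo x)) (≡.trans (≡.cong (ℚ._* frac 1 d) e) (undo y))
    where
    undo : ∀ z → (z ℚ.* ι d) ℚ.* frac 1 d ≡ z
    undo z = ≡.trans (ℚ.*-assoc z (ι d) (frac 1 d)) (≡.trans (≡.cong (z ℚ.*_) (≡.trans (ℚ.*-comm (ι d) (frac 1 d)) (frac-ι 1 d))) (ℚ.*-identityʳ z))

  1/! : ℕ → ℚ
  1/! k = frac 1 (k !) {{k !≢0}}

  1/!-suc : ∀ k → ι (suc k) ℚ.* 1/! (suc k) ≡ 1/! k
  1/!-suc k = ≡.trans (≡.cong (ℚ._* 1/! (suc k)) (ι≡frac (suc k))) (≡.trans (frac-* (suc k) 1 1 (suc k !) {{_}} {{suc k !≢0}})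
    (frac-≡ (suc k * 1) 1 (1 * suc k !) (k !) {{ℕ.m*n≢0 1 (suc k !) {{_}} {{suc k !≢0}}}} {{k !≢0}}
      (≡.trans (≡.cong (_* k !) (ℕ.*-identityʳ (suc k))) (≡.sym (≡.trans (ℕ.*-identityˡ _) (ℕ.*-identityˡ _))))))

  *ˢ≃ : ∀ f g → f *ˢ g ≃ f ⊠ g
  *ˢ≃ f g = mk λ k → ≡.sym (⊠-def f g k)

  1ˢ≃ : 1ˢ ≃ 𝟙
  1ˢ≃ = mk λ { zero → ≡.refl ; (suc k) → ≡.refl }

  x·≃ : ∀ f → x· f ≃ shift f
  x·≃ f = mk λ { zero → ≡.refl ; (suc k) → ≡.refl }

  ^ˢ≃ : ∀ f d → f ^ˢ d ≃ f ↑ d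
  ^ˢ≃ f zero    = 1ˢ≃
  ^ˢ≃ f (suc d) = S.trans (*ˢ≃ f (f ^ˢ d)) (⊠-cong S.refl (^ˢ≃ f d))

  ⟨⟩≃ : ∀ g f → g ⟨ f ⟩ ≃ g ∘ˢ f
  ⟨⟩≃ g f = mk λ k → sum-cong-≋ {suc k} λ d → ≡.cong (g (toℕ d) ℚ.*_) (at (^ˢ≃ f (toℕ d)) k)

  module _ (m′ : ℕ) where

    private
      m : ℕ
      m = suc m′
      D : ℕ → ℕ
      D d = (m !) ℕ.^ d * d !
      D≢0 : ∀ d → NonZero (D d)
      D≢0 d = ℕ.m*n≢0 ((m !) ℕ.^ d) (d !) {{ℕ.m^n≢0 (m !) d {{m !≢0}}}} {{d !≢0}}

    coeffℚ : ℕ → ℕ → ℚ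
    coeffℚ = coeff 1/! ≡.refl 1/!-suc m′

    coeff≡frac : ∀ q d → coeffℚ q d ≡ frac ((q + d * m) !) (D d) {{D≢0 d}}
    coeff≡frac q d = ≡.trans (≡.cong₂ ℚ._*_ (ι≡frac ((q + d * m) !)) (≡.trans (≡.cong (1/! d ℚ.*_) (power≡ d))
        (frac-* 1 1 (d !) ((m !) ℕ.^ d) {{d !≢0}} {{ℕ.m^n≢0 (m !) d {{m !≢0}}}})))
      (≡.trans (frac-* ((q + d * m) !) 1 1 (d ! * (m !) ℕ.^ d) {{_}} {{E≢0}})
        (frac-≡ ((q + d * m) ! * 1) ((q + d * m) !) (1 * (d ! * (m !) ℕ.^ d)) (D d) {{ℕ.m*n≢0 1 (d ! * (m !) ℕ.^ d) {{_}} {{E≢0}}}} {{D≢0 d}}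
          (≡.cong₂ _*_ (ℕ.*-identityʳ ((q + d * m) !)) (≡.trans (ℕ.*-comm ((m !) ℕ.^ d) (d !)) (≡.sym (ℕ.*-identityˡ (d ! * (m !) ℕ.^ d)))))))
      where
      E≢0 : NonZero (d ! * (m !) ℕ.^ d)
      E≢0 = ℕ.m*n≢0 (d !) ((m !) ℕ.^ d) {{d !≢0}} {{ℕ.m^n≢0 (m !) d {{m !≢0}}}}
      power≡ : ∀ d → power 1/! ≡.refl 1/!-suc m′ (1/! m) d ≡ frac 1 ((m !) ℕ.^ d) {{ℕ.m^n≢0 (m !) d {{m !≢0}}}}
      power≡ zero    = ≡.refl
      power≡ (suc d) = ≡.trans (≡.cong (1/! m ℚ.*_) (power≡ d)) (frac-* 1 1 (m !) ((m !) ℕ.^ d) {{m !≢0}} {{ℕ.m^n≢0 (m !) d {{m !≢0}}}})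

    W≡frac : ∀ d → W m (d * m) ≡ frac ((d * m) !) (D d) {{D≢0 d}}
    W≡frac d = frac-≡ ((d * m) !) ((d * m) !) (D (d * m / m)) (D d) {{D≢0 (d * m / m)}} {{D≢0 d}} (≡.cong (λ e → (d * m) ! * D e) (≡.sym (ℕ.m*n/n≡m d m)))

    h≃ : h-series m ≃ coeffℚ 0
    h≃ = mk λ d → ≡.trans (W≡frac d) (≡.sym (coeff≡frac 0 d))

    -- With g = dm, the factor g! of W_m(g) cancels against the binomial coefficient (m - 1 + g)! /
    -- ((m - 1)! g!), which leaves (m - 1 + g)! / ((m - 1)! (m!)^d d!).
    ℓ≃ : ℓ-series m ≃ 1/! m′ ∙ coeffℚ m′
    ℓ≃ = mk λ d → let g = d * m in begin
      W m g ℚ.* frac (λ-dim m g) 1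
        ≡⟨ ≡.cong (ℚ._* frac (λ-dim m g) 1) (W≡frac d) ⟩
      frac (g !) (D d) {{D≢0 d}} ℚ.* frac (λ-dim m g) 1
        ≡⟨ frac-* (g !) (λ-dim m g) (D d) 1 {{D≢0 d}} ⟩
      frac (g ! * λ-dim m g) (D d * 1) {{ℕ.m*n≢0 (D d) 1 {{D≢0 d}}}}
        ≡⟨ frac-≡ (g ! * λ-dim m g) (1 * (m′ + g) !) (D d * 1) (m′ ! * D d) {{ℕ.m*n≢0 (D d) 1 {{D≢0 d}}}} {{ℕ.m*n≢0 (m′ !) (D d) {{m′ !≢0}} {{D≢0 d}}}} (cross d) ⟩
      frac (1 * (m′ + g) !) (m′ ! * D d) {{ℕ.m*n≢0 (m′ !) (D d) {{m′ !≢0}} {{D≢0 d}}}}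
        ≡⟨ frac-* 1 ((m′ + g) !) (m′ !) (D d) {{m′ !≢0}} {{D≢0 d}} ⟨
      1/! m′ ℚ.* frac ((m′ + g) !) (D d) {{D≢0 d}}
        ≡⟨ ≡.cong (1/! m′ ℚ.*_) (coeff≡frac m′ d) ⟨
      1/! m′ ℚ.* coeffℚ m′ d ∎
      where
      open ≡.≡-Reasoning
      cross : ∀ d → (d * m) ! * λ-dim m (d * m) * (m′ ! * D d) ≡ 1 * (m′ + d * m) ! * (D d * 1)
      cross d = let g = d * m ; c = λ-dim m g in begin
        g ! * c * (m′ ! * D d)          ≡⟨ ℕ.*-assoc (g ! * c) (m′ !) (D d) ⟨
        g ! * c * m′ ! * D d            ≡⟨ ≡.cong (_* D d) (≡.trans (≡.cong (_* m′ !) (ℕ.*-comm (g !) c)) (≡.trans (ℕ.*-assoc c (g !) (m′ !)) (≡.cong (c *_) (ℕ.*-comm (g !) (m′ !))))) ⟩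
        c * (m′ ! * g !) * D d          ≡⟨ ≡.cong (_* D d) (binomial-! m′ g) ⟩
        (m′ + g) ! * D d                ≡⟨ ≡.cong₂ _*_ (ℕ.*-identityˡ ((m′ + g) !)) (ℕ.*-identityʳ (D d)) ⟨
        1 * (m′ + g) ! * (D d * 1)      ∎

-- The coefficient formula and the functional equation.

module FussCatalan (r′ m′ : ℕ) where

  private
    r m : ℕ
    r = suc r′
    m = suc m′

  open LocalSeries ℚ-semiring
  open Bridge

  κ : ℕ
  κ = LocalCount.Q r m (suc (suc r * m)) 1 0 (λ _ → 0)

  module _ (n : ℕ) where

    private
      N! : ℕ
      N! = (suc (r * n)) ! * n !
      instance
        N!≢0 : NonZero N!
        N!≢0 = ℕ.m*n≢0 ((suc (r * n)) !) (n !) {{suc (r * n) !≢0}} {{n !≢0}}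

    open Orbits r m n

    -- Multiplication by (rn + 1)! n! turns each 1/|Γ(T)| into the number of labelled trees
    -- isomorphic to T.
    FC-scaled : FC r m n ℚ.* ι N! ≡ ι (lsum trees walks)
    FC-scaled = ≡.trans (go (ℋ r n) (ListAll.deduplicate⁺ _≅?_ trees-All)) (≡.cong ι classes)
      where
      class : Hypergraph (suc (r * n)) n → ℕ
      class T = lsum trees λ S → ind (T ≅? S)
      weight : Hypergraph (suc (r * n)) n → ℚ
      weight T = Σᴿ λ v → walkRatio r m T v
      weight-Γ : ∀ T → weight T ℚ.* ι (∣Γ∣ T) ≡ ι (walks T)
      weight-Γ T = ≡.trans (*-distribʳ-sum (ι (∣Γ∣ T)) (walkRatio r m T))
        (≡.trans (sum-cong-≋ λ v → frac-ι (walkCount r m T v) (∣Γ∣ T) {{∣Γ∣≢0 T}}) (Σᴿ-ι (walkCount r m T)))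
      term : ∀ T → IsHypertree r n T → weight T ℚ.* ι N! ≡ ι (class T * walks T)
      term T hyp = begin
        weight T ℚ.* ι N!                              ≡⟨ ≡.cong (λ k → weight T ℚ.* ι k) (class-size hyp) ⟨
        weight T ℚ.* ι (class T * ∣Γ∣ T)               ≡⟨ ≡.cong (weight T ℚ.*_) (ι-* (class T) (∣Γ∣ T)) ⟩
        weight T ℚ.* (ι (class T) ℚ.* ι (∣Γ∣ T))       ≡⟨ x∙yz≈y∙xz (weight T) (ι (class T)) (ι (∣Γ∣ T)) ⟩
        ι (class T) ℚ.* (weight T ℚ.* ι (∣Γ∣ T))       ≡⟨ ≡.cong (ι (class T) ℚ.*_) (weight-Γ T) ⟩
        ι (class T) ℚ.* ι (walks T)                    ≡⟨ ι-* (class T) (walks T) ⟨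
        ι (class T * walks T)                          ∎
        where open ≡.≡-Reasoning
      go : ∀ xs → ListAll.All (IsHypertree r n) xs →
           List.foldr ℚ._+_ 0ℚ (List.map weight xs) ℚ.* ι N! ≡ ι (lsum xs λ T → class T * walks T)
      go [] ListAll.[] = ℚ.*-zeroˡ (ι N!)
      go (T ∷ xs) (hyp ListAll.∷ hyps) = ≡.trans (ℚ.*-distribʳ-+ (ι N!) (weight T) (List.foldr ℚ._+_ 0ℚ (List.map weight xs)))
        (≡.trans (≡.cong₂ ℚ._+_ (term T hyp) (go xs hyps)) (≡.sym (ι-+ (class T * walks T) (lsum xs λ T → class T * walks T))))

    module _ (G : PS) (G0 : G 0 ≡ 0ℚ)
      (G-eq : G ≃ shift (ι κ ∙ (1/! m′ ∙ B 1/! ≡.refl 1/!-suc m′ G G0 m′) ↑ r)) where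

      FC≡coefficient : FC r m n ≡ (h-series m ∘ˢ G) n
      FC≡coefficient = ≡.trans (ι-cancel N! (≡.trans FC-scaled (≡.trans (≡.cong ι all-walks)
          (≡.trans (Total.total ℚ-semiring 1/! ≡.refl 1/!-suc r′ m′ n G G0 G-eq) (ℚ.*-comm (ι N!) (B 1/! ≡.refl 1/!-suc m′ G G0 0 n))))))
        (at (∘ˢ-cong (S.sym (h≃ m′)) S.refl) n)

  module _ (f : ℕ → ℤ) (f-eq : fromℤ f ≈ x· ((ℓ-series m ⟨ fromℤ f ⟩) ^ˢ r)) where

    private
      F₀ : PS
      F₀ = fromℤ f

      G : PS
      G = F₀ [ ι κ ·x]

      dilated : ∀ {g h} → g ≃ h → g [ ι κ ·x] ≃ h [ ι κ ·x]
      dilated e = mk λ k → ≡.cong (ℚ._* (ι κ ^ℚ k)) (at e k)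

      pow-+ : ∀ i j → ι κ ^ℚ (i + j) ≡ (ι κ ^ℚ i) ℚ.* (ι κ ^ℚ j)
      pow-+ = ^-homo-* (ι κ)

      G0 : G 0 ≡ 0ℚ
      G0 = ≡.trans (≡.cong (ℚ._* 1ℚ) (f-eq 0)) (ℚ.*-zeroˡ 1ℚ)

      f-eq′ : F₀ ≃ shift ((ℓ-series m ∘ˢ F₀) ↑ r)
      f-eq′ = S.trans (mk f-eq) (S.trans (x·≃ ((ℓ-series m ⟨ F₀ ⟩) ^ˢ r)) (shift-cong
        (S.trans (^ˢ≃ (ℓ-series m ⟨ F₀ ⟩) r) (↑-cong r (⟨⟩≃ (ℓ-series m) F₀)))))

      dilate-shift : ∀ g → (shift g) [ ι κ ·x] ≃ shift (ι κ ∙ (g [ ι κ ·x]))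
      dilate-shift g = mk λ where
        zero    → ℚ.*-zeroˡ 1ℚ
        (suc k) → x∙yz≈y∙xz (g k) (ι κ) (ι κ ^ℚ k)

      -- Replacing x by κx in f = x ℓ(f)^r gives G = κ x ℓ(G)^r, and ℓ(G) is the factor of a newly
      -- discovered vertex. So the given f itself supplies the series that the counting asks for.
      G-eq : G ≃ shift (ι κ ∙ (1/! m′ ∙ B 1/! ≡.refl 1/!-suc m′ G G0 m′) ↑ r)
      G-eq = S.trans (dilated f-eq′) (S.trans (dilate-shift ((ℓ-series m ∘ˢ F₀) ↑ r)) (shift-cong (∙-congˢ (ι κ)
        (S.trans (dilate-↑ (ι κ ^ℚ_) ≡.refl pow-+ (ℓ-series m ∘ˢ F₀) r) (↑-cong r
          (S.trans (dilate-∘ˢ (ι κ ^ℚ_) ≡.refl pow-+ (ℓ-series m) F₀)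
            (S.trans (∘ˢ-cong {f = G} (ℓ≃ m′) S.refl) (∘ˢ-∙ G (1/! m′) (coeffℚ m′ m′)))))))))

      FC₁ : FC r m 1 ≡ ι κ
      FC₁ = ≡.trans (FC≡coefficient 1 G G0 G-eq) (≡.trans (at (∘ˢ-cong {f = G} (h≃ m′) S.refl) 1)
        (FirstCoefficient.first-coefficient ℚ-semiring 1/! ≡.refl 1/!-suc r m′ G G0 κ G-eq))

    FC-formula : ∀ n → FC r m n ≡ (h-series m ⟨ fromℤ f [ FC r m 1 ·x] ⟩) n
    FC-formula n = ≡.trans (FC≡coefficient n G G0 G-eq) (≡.trans (≡.sym (at (⟨⟩≃ (h-series m) G) n))
      (≡.cong (λ c → (h-series m ⟨ fromℤ f [ c ·x] ⟩) n) (≡.sym FC₁)))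

theorem4p7 : (r m : ℕ) .{{_ : NonZero r}} .{{_ : NonZero m}} (f : ℕ → ℤ) →
    fromℤ f ≈ x· ((ℓ-series m ⟨ fromℤ f ⟩) ^ˢ r) →
    F r m ≈ x· (h-series m ⟨ fromℤ f [ FC r m 1 ·x] ⟩)
theorem4p7 zero    m       f f-eq k = ⊥-elim (ℕ.≢-nonZero⁻¹ 0 ≡.refl)
theorem4p7 (suc r) zero    f f-eq k = ⊥-elim (ℕ.≢-nonZero⁻¹ 0 ≡.refl)
theorem4p7 (suc r) (suc m) f f-eq zero    = ≡.refl
theorem4p7 (suc r) (suc m) f f-eq (suc n) = FussCatalan.FC-formula r m f f-eq n
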